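{- Let $q$ be an odd prime power. For each integer $d\ge 3$ let $\mathcal{F}_d$ be the set of square-free monic polynomials of degree $d$ in $\mathbb{F}_q[X]$, and for $F\in\mathcal{F}_d$ let $S(F)=\sum_{x\in\mathbb{F}_q}\chi(F(x))$. Let $X_1,\dots,X_q$ be independent identically distributed random variables taking the values $0,1,-1$ with probabilities $\frac{1}{q+1}$, $\frac{1}{2(1+q^{ -1})}$, $\frac{1}{2(1+q^{ -1})}$ respectively. If $q$ is fixed and $d$ tends to infinity, then the distribution of $S(F)$, as $F$ ranges over all elements of $\mathcal{F}_d$ (with uniform probability), is asymptotically that of $\sum_{i=1}^q X_i$. More precisely, for every $s\in\mathbb{Z}$ with $|s|\le q$, $$\frac{|\{F\in\mathcal{F}_d : S(F)=s\}|}{|\mathcal{F}_d|}=\operatorname{Prob}\left(\sum_{i=1}^q X_i=s\right)\cdot\left(1+O\left(q^{(3q-d)/2}\right)\right),$$ where the implied constant is absolute (independent of $q$, $d$ and $s$).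
   Context: $\mathbb{F}_q$ is the finite field with $q$ elements, $q$ odd. $\chi$ is the quadratic character of $\mathbb{F}_q^\times$, extended by $\chi(0)=0$: $\chi(a)=1$ if $a$ is a nonzero square, $\chi(a)=-1$ if $a$ is a nonsquare. A polynomial is square-free if it is not divisible by the square of any nonconstant polynomial. An expression $A(1+O(B))$ with absolute implied constant means $A(1+\theta)$ with $|\theta|\le CB$, where $C$ is a universal constant. -}

module Defs where

open import Algebra.Bundles.Raw using (RawMagma)
open import Algebra.Core using (Op₁; Op₂)
open import Algebra.Structures using (IsCommutativeRing)
import Algebra.Definitions.RawMagma as Divisibility
open import Data.Empty using (⊥-elim)
open import Data.Fin.Base using (Fin)
import Data.Fin.Properties as Fin
open import Data.Integer.Base as ℤ using (ℤ; +_; 0ℤ; 1ℤ; -1ℤ)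
import Data.Integer.Properties as ℤ
open import Data.List.Base
  using (List; []; _∷_; _++_; map; foldr; filter; length; allFin; cartesianProductWith)
open import Data.List.Membership.Propositional using (_∈_; lose; find)
open import Data.List.Membership.Propositional.Properties
  using (∈-map⁺; ∈-allFin; ∈-cartesianProductWith⁺)
open import Data.List.Relation.Unary.Any using (Any; here; any?)
open import Data.Nat.Base as ℕ using (ℕ; zero; suc; z≤n; s≤s; NonZero)
open import Data.Nat.Divisibility using (_∤_)
open import Data.Nat.Primality using (Prime)
import Data.Nat.Properties as ℕ
open import Data.Product.Base using (∃; ∃-syntax; ∃₂; _×_; _,_; proj₁; proj₂)
open import Data.Rational.Base as ℚ using (ℚ; 0ℚ; 1ℚ; _/_)
open import Data.Sum.Base using (_⊎_; inj₁; inj₂)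
open import Data.Vec.Base as Vec using (Vec; []; _∷_; toList)
open import Function.Base using (_∘_)
open import Function.Bundles using (_↔_; Inverse)
open import Level using (0ℓ)
open import Relation.Binary.Definitions using (DecidableEquality; tri<; tri≈; tri>)
open import Relation.Binary.PropositionalEquality
  using (_≡_; _≢_; refl; sym; trans; cong; cong₂; subst)
open import Relation.Nullary.Decidable using (Dec; yes; no; map′; _×-dec_)
open import Relation.Nullary.Negation using (¬_)

OddPrimePower : ℕ → Set
OddPrimePower q = (∃₂ λ p k → Prime p × q ≡ p ℕ.^ suc k) × 2 ∤ q

vectors : {A : Set} → List A → ∀ n → List (Vec A n)
vectors xs zero    = [] ∷ []
vectors xs (suc n) = cartesianProductWith _∷_ xs (vectors xs n)

record FiniteField (q : ℕ) : Set₁ where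
  infixl 7 _*_
  infixl 6 _+_
  field
    Carrier           : Set
    _+_ _*_           : Op₂ Carrier
    -_                : Op₁ Carrier
    0# 1#             : Carrier
    isCommutativeRing : IsCommutativeRing _≡_ _+_ _*_ -_ 0# 1#
    0≢1               : 0# ≢ 1#
    inverse           : ∀ x → x ≢ 0# → ∃[ y ] x * y ≡ 1#
    enumeration       : Fin q ↔ Carrier

  open IsCommutativeRing isCommutativeRing public
    using (+-identityˡ; +-identityʳ; *-assoc; *-comm; *-identityˡ; zeroˡ; zeroʳ)

  open Inverse enumeration using (to; from; strictlyInverseˡ)

  elements : List Carrier
  elements = map to (allFin q)

  ∈-elements : ∀ x → x ∈ elements
  ∈-elements x =
    subst (_∈ elements) (strictlyInverseˡ x) (∈-map⁺ to (∈-allFin (from x)))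

  infix 4 _≟_
  _≟_ : DecidableEquality Carrier
  x ≟ y = map′
    (λ eq → trans (sym (strictlyInverseˡ x)) (trans (cong to eq) (strictlyInverseˡ y)))
    (cong from)
    (from x Fin.≟ from y)

module _ {q : ℕ} (𝔽 : FiniteField q) where
  open FiniteField 𝔽

  χ : Carrier → ℤ
  χ a with a ≟ 0#
  ... | yes _ = 0ℤ
  ... | no  _ with any? (λ x → x * x ≟ a) elements
  ...   | yes _ = 1ℤ
  ...   | no  _ = -1ℤ

  -- The list a₀ ∷ a₁ ∷ a₂ ∷ … stands for a₀ + a₁X + a₂X² + ⋯ .  Trailing zeros
  -- are allowed, so equality of polynomials is _≈ₚ_ rather than _≡_.
  Poly : Set
  Poly = List Carrier

  coeff : Poly → ℕ → Carrier
  coeff []      _       = 0#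
  coeff (a ∷ f) zero    = a
  coeff (a ∷ f) (suc n) = coeff f n

  infix 4 _≈ₚ_
  _≈ₚ_ : Poly → Poly → Set
  f ≈ₚ g = ∀ n → coeff f n ≡ coeff g n

  infixl 6 _+ₚ_
  _+ₚ_ : Op₂ Poly
  []      +ₚ g       = g
  (a ∷ f) +ₚ []      = a ∷ f
  (a ∷ f) +ₚ (b ∷ g) = (a + b) ∷ (f +ₚ g)

  infixl 7 _*ₚ_
  _*ₚ_ : Op₂ Poly
  []      *ₚ g = []
  (a ∷ f) *ₚ g = map (a *_) g +ₚ (0# ∷ f *ₚ g)

  eval : Poly → Carrier → Carrier
  eval []      x = 0#
  eval (a ∷ f) x = a + x * eval f x

  *ₚ-rawMagma : RawMagma 0ℓ 0ℓ
  *ₚ-rawMagma = record { Carrier = Poly ; _≈_ = _≈ₚ_ ; _∙_ = _*ₚ_ }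

  open Divisibility *ₚ-rawMagma using (_∣_; _,_)

  NonConstant : Poly → Set
  NonConstant f = ∃[ n ] coeff f (suc n) ≢ 0#

  SquareFree : Poly → Set
  SquareFree f = ∀ g → NonConstant g → ¬ (g *ₚ g ∣ f)

  module PolyProperties where
    infix 4 _≈ₚ?_
    _≈ₚ?_ : ∀ f g → Dec (f ≈ₚ g)
    [] ≈ₚ? [] = yes λ _ → refl
    [] ≈ₚ? (b ∷ g) = map′
      (λ { (p , e) zero → p ; (p , e) (suc n) → e n })
      (λ e → e 0 , e ∘ suc)
      ((0# ≟ b) ×-dec ([] ≈ₚ? g))
    (a ∷ f) ≈ₚ? [] = map′
      (λ { (p , e) zero → p ; (p , e) (suc n) → e n })
      (λ e → e 0 , e ∘ suc)
      ((a ≟ 0#) ×-dec (f ≈ₚ? []))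
    (a ∷ f) ≈ₚ? (b ∷ g) = map′
      (λ { (p , e) zero → p ; (p , e) (suc n) → e n })
      (λ e → e 0 , e ∘ suc)
      ((a ≟ b) ×-dec (f ≈ₚ? g))

    coeff-+ₚ : ∀ f g n → coeff (f +ₚ g) n ≡ coeff f n + coeff g n
    coeff-+ₚ []      g       n       = sym (+-identityˡ _)
    coeff-+ₚ (a ∷ f) []      n       = sym (+-identityʳ _)
    coeff-+ₚ (a ∷ f) (b ∷ g) zero    = refl
    coeff-+ₚ (a ∷ f) (b ∷ g) (suc n) = coeff-+ₚ f g n

    coeff-scale : ∀ a g n → coeff (map (a *_) g) n ≡ a * coeff g n
    coeff-scale a []      n       = sym (zeroʳ a)
    coeff-scale a (b ∷ g) zero    = refl
    coeff-scale a (b ∷ g) (suc n) = coeff-scale a g n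

    coeff-*ₚ : ∀ a f g n →
      coeff ((a ∷ f) *ₚ g) n ≡ a * coeff g n + coeff (0# ∷ f *ₚ g) n
    coeff-*ₚ a f g n = trans (coeff-+ₚ (map (a *_) g) _ n)
      (cong (_+ coeff (0# ∷ f *ₚ g) n) (coeff-scale a g n))

    ∷-cong : ∀ {a b} f g → a ≡ b → f ≈ₚ g → (a ∷ f) ≈ₚ (b ∷ g)
    ∷-cong f g a≡b f≈g zero    = a≡b
    ∷-cong f g a≡b f≈g (suc n) = f≈g n

    *ₚ-congʳ : ∀ f g h → g ≈ₚ h → f *ₚ g ≈ₚ f *ₚ h
    *ₚ-congʳ []      g h e n = refl
    *ₚ-congʳ (a ∷ f) g h e n = trans (coeff-*ₚ a f g n)
      (trans (cong₂ _+_ (cong (a *_) (e n))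
                        (∷-cong (f *ₚ g) (f *ₚ h) refl (*ₚ-congʳ f g h e) n))
             (sym (coeff-*ₚ a f h n)))

    *ₚ-zeroˡ : ∀ f g → f ≈ₚ [] → f *ₚ g ≈ₚ []
    *ₚ-zeroˡ []      g e n = refl
    *ₚ-zeroˡ (a ∷ f) g e n = trans (coeff-*ₚ a f g n)
      (trans (cong₂ _+_ (trans (cong (_* coeff g n) (e 0)) (zeroˡ _)) (shifted n))
             (+-identityˡ 0#))
      where
      shifted : ∀ n → coeff (0# ∷ f *ₚ g) n ≡ 0#
      shifted zero    = refl
      shifted (suc n) = *ₚ-zeroˡ f g (e ∘ suc) n

    *ₚ-zeroʳ : ∀ f g → g ≈ₚ [] → f *ₚ g ≈ₚ []
    *ₚ-zeroʳ []      g e n = refl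
    *ₚ-zeroʳ (a ∷ f) g e n = trans (coeff-*ₚ a f g n)
      (trans (cong₂ _+_ (trans (cong (a *_) (e n)) (zeroʳ _)) (shifted n))
             (+-identityˡ 0#))
      where
      shifted : ∀ n → coeff (0# ∷ f *ₚ g) n ≡ 0#
      shifted zero    = refl
      shifted (suc n) = *ₚ-zeroʳ f g e n

    *ₚ-congˡ : ∀ f g h → f ≈ₚ g → f *ₚ h ≈ₚ g *ₚ h
    *ₚ-congˡ []      g       h e n = sym (*ₚ-zeroˡ g h (λ m → sym (e m)) n)
    *ₚ-congˡ (a ∷ f) []      h e n = *ₚ-zeroˡ (a ∷ f) h e n
    *ₚ-congˡ (a ∷ f) (b ∷ g) h e n = trans (coeff-*ₚ a f h n)
      (trans (cong₂ _+_ (cong (_* coeff h n) (e 0))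
                        (∷-cong (f *ₚ h) (g *ₚ h) refl (*ₚ-congˡ f g h (e ∘ suc)) n))
             (sym (coeff-*ₚ b g h n)))

    HasDegree : Poly → ℕ → Set
    HasDegree f n = coeff f n ≢ 0# × (∀ m → n ℕ.< m → coeff f m ≡ 0#)

    degree : ∀ f → f ≈ₚ [] ⊎ ∃ (HasDegree f)
    degree []      = inj₁ λ _ → refl
    degree (a ∷ f) with degree f
    ... | inj₂ (n , lead , high) =
      inj₂ (suc n , lead , λ { (suc m) (s≤s n<m) → high m n<m })
    ... | inj₁ f≈0 with a ≟ 0#
    ...   | yes a≡0 = inj₁ λ { zero → a≡0 ; (suc n) → f≈0 n }
    ...   | no  a≢0 = inj₂ (0 , a≢0 , λ { (suc m) _ → f≈0 m })

    degree-unique : ∀ f g {m n} → f ≈ₚ g → HasDegree f m → HasDegree g n → m ≡ n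
    degree-unique f g {m} {n} e (lf , hf) (lg , hg) with ℕ.<-cmp m n
    ... | tri< m<n _ _ = ⊥-elim (lg (trans (sym (e n)) (hf n m<n)))
    ... | tri≈ _ m≡n _ = m≡n
    ... | tri> _ _ n<m = ⊥-elim (lf (trans (e m) (hg m n<m)))

    *-nonzero : ∀ {x y} → x ≢ 0# → y ≢ 0# → x * y ≢ 0#
    *-nonzero {x} {y} x≢0 y≢0 xy≡0 with inverse x x≢0
    ... | z , xz≡1 = y≢0
      (trans (sym (*-identityˡ y))
      (trans (cong (_* y) (trans (sym xz≡1) (*-comm x z)))
      (trans (*-assoc z x y)
      (trans (cong (z *_) xy≡0) (zeroʳ z)))))

    *ₚ-degree : ∀ f g {m n} → HasDegree f m → HasDegree g n →
                HasDegree (f *ₚ g) (m ℕ.+ n)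
    *ₚ-degree []      g           (lf , hf) dg = ⊥-elim (lf refl)
    *ₚ-degree (a ∷ f) g {zero}  {n} (lf , hf) (lg , hg) =
      (λ e → *-nonzero lf lg (trans (sym (value n)) e)) ,
      (λ m n<m → trans (value m) (trans (cong (a *_) (hg m n<m)) (zeroʳ a)))
      where
      shifted : ∀ k → coeff (0# ∷ f *ₚ g) k ≡ 0#
      shifted zero    = refl
      shifted (suc k) = *ₚ-zeroˡ f g (λ m → hf (suc m) (s≤s z≤n)) k
      value : ∀ k → coeff ((a ∷ f) *ₚ g) k ≡ a * coeff g k
      value k = trans (coeff-*ₚ a f g k)
        (trans (cong (_+_ (a * coeff g k)) (shifted k)) (+-identityʳ _))
    *ₚ-degree (a ∷ f) g {suc m} {n} (lf , hf) (lg , hg)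
      with *ₚ-degree f g {m} {n} (lf , λ k m<k → hf (suc k) (s≤s m<k)) (lg , hg)
    ... | lead , high =
      (λ e → lead (trans (sym (value (m ℕ.+ n) (ℕ.m≤n+m n m))) e)) ,
      (λ { (suc k) (s≤s mn<k) →
             trans (value k (ℕ.≤-trans (ℕ.m≤n+m n m) (ℕ.<⇒≤ mn<k))) (high k mn<k) })
      where
      value : ∀ k → n ℕ.≤ k → coeff ((a ∷ f) *ₚ g) (suc k) ≡ coeff (f *ₚ g) k
      value k n≤k = trans (coeff-*ₚ a f g (suc k))
        (trans (cong (_+ coeff (f *ₚ g) k)
                     (trans (cong (a *_) (hg (suc k) (s≤s n≤k))) (zeroʳ a)))
               (+-identityˡ _))

    nonConstant? : ∀ f → Dec (NonConstant f)
    nonConstant? f with degree f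
    ... | inj₁ f≈0                   = no λ (n , c) → c (f≈0 (suc n))
    ... | inj₂ (zero  , lead , high) = no λ (n , c) → c (high (suc n) (s≤s z≤n))
    ... | inj₂ (suc n , lead , high) = yes (n , lead)

    truncate : ∀ n → Poly → Vec Carrier n
    truncate zero    f       = []
    truncate (suc n) []      = 0# ∷ truncate n []
    truncate (suc n) (a ∷ f) = a ∷ truncate n f

    truncate-≈ₚ : ∀ n f → (∀ m → n ℕ.≤ m → coeff f m ≡ 0#) →
                  toList (truncate n f) ≈ₚ f
    truncate-≈ₚ zero    f       h m       = sym (h m z≤n)
    truncate-≈ₚ (suc n) []      h zero    = refl
    truncate-≈ₚ (suc n) []      h (suc m) = truncate-≈ₚ n [] (λ _ _ → refl) m
    truncate-≈ₚ (suc n) (a ∷ f) h zero    = refl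
    truncate-≈ₚ (suc n) (a ∷ f) h (suc m) =
      truncate-≈ₚ n f (λ k n≤k → h (suc k) (s≤s n≤k)) m

    ∈-vectors : ∀ {n} (v : Vec Carrier n) → v ∈ vectors elements n
    ∈-vectors []      = here refl
    ∈-vectors (x ∷ v) = ∈-cartesianProductWith⁺ _∷_ (∈-elements x) (∈-vectors v)

    truncate-degree : ∀ {d} f {n} → n ℕ.≤ d → HasDegree f n →
                      toList (truncate (suc d) f) ≈ₚ f
    truncate-degree {d} f n≤d (_ , high) =
      truncate-≈ₚ (suc d) f (λ m d<m → high m (ℕ.≤-<-trans n≤d d<m))

    SquareFactor : ∀ d → Poly → Set
    SquareFactor d f =
      Any (λ g → NonConstant (toList g) ×
                 Any (λ h → toList h *ₚ (toList g *ₚ toList g) ≈ₚ f)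
                     (vectors elements (suc d)))
          (vectors elements (suc d))

    squareFactor? : ∀ d f → Dec (SquareFactor d f)
    squareFactor? d f =
      any? (λ g → nonConstant? (toList g) ×-dec
                  any? (λ h → toList h *ₚ (toList g *ₚ toList g) ≈ₚ? f) _) _

    bounded : ∀ {d} f → HasDegree f d →
              ∀ g → NonConstant g → g *ₚ g ∣ f → SquareFactor d f
    bounded {d} f df g (i , gᵢ≢0) (h , hgg≈f) with degree g | degree h
    ... | inj₁ g≈0 | _        = ⊥-elim (gᵢ≢0 (g≈0 (suc i)))
    ... | inj₂ _   | inj₁ h≈0 =
      ⊥-elim (proj₁ df (trans (sym (hgg≈f d)) (*ₚ-zeroˡ h (g *ₚ g) h≈0 d)))
    ... | inj₂ (e , dg) | inj₂ (k , dh) =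
      lose (∈-vectors (truncate (suc d) g))
        ((i , λ eq → gᵢ≢0 (trans (sym (g′≈g (suc i))) eq)) ,
         lose (∈-vectors (truncate (suc d) h)) product)
      where
      d≡ : k ℕ.+ (e ℕ.+ e) ≡ d
      d≡ = degree-unique (h *ₚ (g *ₚ g)) f hgg≈f
             (*ₚ-degree h (g *ₚ g) dh (*ₚ-degree g g dg dg)) df
      g′ h′ : Poly
      g′ = toList (truncate (suc d) g)
      h′ = toList (truncate (suc d) h)
      g′≈g : g′ ≈ₚ g
      g′≈g = truncate-degree g
        (subst (e ℕ.≤_) d≡ (ℕ.≤-trans (ℕ.m≤m+n e e) (ℕ.m≤n+m (e ℕ.+ e) k))) dg
      h′≈h : h′ ≈ₚ h
      h′≈h = truncate-degree h (subst (k ℕ.≤_) d≡ (ℕ.m≤m+n k (e ℕ.+ e))) dh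
      product : h′ *ₚ (g′ *ₚ g′) ≈ₚ f
      product n =
        trans (*ₚ-congˡ h′ h (g′ *ₚ g′) h′≈h n)
        (trans (*ₚ-congʳ h (g′ *ₚ g′) (g *ₚ g)
                 (λ m → trans (*ₚ-congˡ g′ g g′ g′≈g m) (*ₚ-congʳ g g′ g g′≈g m)) n)
               (hgg≈f n))

  open PolyProperties

  squareFree? : ∀ f → Dec (SquareFree f)
  squareFree? f with degree f
  ... | inj₁ f≈0 =
    no λ sf → sf (0# ∷ 1# ∷ []) (0 , λ 1≡0 → 0≢1 (sym 1≡0)) ([] , λ n → sym (f≈0 n))
  ... | inj₂ (d , df) with squareFactor? d f
  ...   | no  none = yes λ g nc gg∣f → none (bounded f df g nc gg∣f)
  ...   | yes some with find some
  ...     | g , _ , nc , some′ with find some′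
  ...       | h , _ , eq = no λ sf → sf (toList g) nc (toList h , eq)

  -- A monic polynomial of degree d is determined by its d lower coefficients,
  -- so each one is listed exactly once.
  monics : ℕ → List Poly
  monics d = map (λ v → toList v ++ 1# ∷ []) (vectors elements d)

  𝓕 : ℕ → List Poly
  𝓕 d = filter squareFree? (monics d)

  S : Poly → ℤ
  S f = foldr ℤ._+_ 0ℤ (map (λ x → χ (eval f x)) elements)

  proportion : ∀ d → .{{NonZero (length (𝓕 d))}} → ℤ → ℚ
  proportion d s = + length (filter (λ f → S f ℤ.≟ s) (𝓕 d)) / length (𝓕 d)

data Outcome : Set where
  zer pos neg : Outcome

value : Outcome → ℤ
value zer = 0ℤ
value pos = 1ℤ
value neg = -1ℤ

-- q / (2(q + 1)) is 1 / (2(1 + q⁻¹)) with denominators cleared.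
law : ℕ → Outcome → ℚ
law q zer = + 1 / suc q
law q pos = + q / (2 ℕ.* suc q)
law q neg = + q / (2 ℕ.* suc q)

total : ∀ {n} → Vec Outcome n → ℤ
total ω = foldr ℤ._+_ 0ℤ (map value (toList ω))

-- By independence the joint law of (X₁ , … , X_q) is the product measure on
-- Outcome^q.
weight : ∀ q {n} → Vec Outcome n → ℚ
weight q ω = foldr ℚ._*_ 1ℚ (map (law q) (toList ω))

Prob[ΣX≡_] : ℤ → ℕ → ℚ
Prob[ΣX≡ s ] q =
  foldr ℚ._+_ 0ℚ
    (map (weight q)
      (filter (λ ω → total ω ℤ.≟ s) (vectors (zer ∷ pos ∷ neg ∷ []) q)))

-- |θ| ≤ C q^((3q − d)/2).  The right-hand side may be irrational, so both
-- (nonnegative) sides are squared; q^(−d) is moved to the left.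
ErrorBound : (C q d : ℕ) → ℚ → Set
ErrorBound C q d θ =
  θ ℚ.* θ ℚ.* (+ (q ℕ.^ d) / 1) ℚ.≤ + (C ℕ.^ 2 ℕ.* q ℕ.^ (3 ℕ.* q)) / 1

-- Let nl be the set of irreducible monic polynomials of degree from 2 to d. Sieving by the
-- squares p², p ∈ nl, one at a time, expresses the number N(n, b) of monic polynomials of degree
-- n that are free of these squares and take prescribed nonzero values b on 𝔽_q as a signed sum
-- over the products g of distinct p ∈ nl of the number of monic polynomials of degree
-- n − 2 deg g with the values b / g². By interpolation that number is q^(n − 2 deg g − q) as soon
-- as the degree is at least q, and at most 1 below that. Hence N(d, b) and q^m N(d − m, b′), for
-- m ≤ q, differ only through the g with deg g ≤ d / 2, and by at most 4 q^((d + q) / 2): the main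
-- term of the sieve never has to be evaluated.
--
-- A square-free F of degree d with exactly m zeros in 𝔽_q is the product of the m linear factors
-- and a cofactor of degree d − m without zeros, whose values are free at the zeros and of
-- prescribed quadratic character elsewhere. The number of admissible value vectors turns
-- q^m N(d − m, b) into a constant times the weight that the random model gives to the vector of
-- the χ(F(x)). The constant cancels in the quotient by |𝓕_d|, which is at least q^d / 2.

module Submission where

open import Algebra.Bundles using (CommutativeRing)
open import Algebra.Definitions.RawMagma using (_,_)
import Algebra.Solver.Ring
import Algebra.Solver.Ring.AlmostCommutativeRing as ACR
open import Algebra.Structures using (IsCommutativeRing)
import Data.Fin.Base as Fin
import Data.Fin.Properties as Fin
open import Data.Integer.Base as ℤ using (ℤ; 0ℤ; 1ℤ; -[1+_]; _⊖_)
import Data.Integer.Properties as ℤ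
open import Data.List.Base as List
  using (List; []; _∷_; _++_; map; foldr; filter; length; replicate; take; drop; allFin; cartesianProductWith)
open import Data.List.Membership.Propositional using (_∈_; find; lose)
open import Data.List.Membership.Propositional.Properties
  using (∈-∃++; ∈-++⁺ˡ; ∈-++⁺ʳ; ∈-++⁻; ∈-filter⁺; ∈-filter⁻; ∈-map⁺; ∈-map⁻; ∈-cartesianProductWith⁺)
open import Data.List.Properties
  using (∷-injectiveˡ; ∷-injectiveʳ; ++-assoc; ++-identityʳ; length-++; length-++-sucʳ; length-map;
         length-replicate; length-tabulate; length-take; length-drop; take++drop≡id; map-∘; map-tabulate;
         filter-accept; filter-reject; filter-++)
  renaming (≡-dec to List-≡-dec)
open import Data.List.Relation.Unary.All as All using (All; []; _∷_; all?)
open import Data.List.Relation.Unary.AllPairs using ([]; _∷_)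
open import Data.List.Relation.Unary.Any using (here; there; any?)
open import Data.List.Relation.Unary.Unique.Propositional using (Unique)
import Data.List.Relation.Unary.Unique.Propositional.Properties as Unique
import Data.Maybe.Base as Maybe
open import Data.Nat.Base as ℕ using (ℕ; zero; suc; NonZero; _≤_; _<_; z≤n; s≤s)
open import Data.Nat.Divisibility using (_∤_; divides)
import Data.Nat.Properties as ℕ
open import Data.Nat.Solver using (module +-*-Solver)
open import Data.Product.Base using (Σ-syntax; ∃-syntax; _×_; _,_; proj₁; proj₂)
open import Data.Rational.Base as ℚ using (ℚ; 0ℚ; 1ℚ; _/_; toℚᵘ; Positive; NonNegative)
import Data.Rational.Properties as ℚ
open import Data.Rational.Unnormalised.Base as ℚᵘ using (mkℚᵘ)
import Data.Rational.Unnormalised.Properties as ℚᵘ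
open import Data.Sum.Base using (_⊎_; inj₁; inj₂)
open import Data.Unit.Base using (⊤; tt)
open import Data.Vec.Base as Vec using (Vec; []; _∷_; toList)
open import Data.Vec.Properties as Vec
  using (toList∘fromList; length-toList; lookup-map; lookup∘tabulate; tabulate∘lookup; tabulate-∘; tabulate-cong)
  renaming (≡-dec to Vec-≡-dec)
open import Data.Vec.Relation.Binary.Pointwise.Inductive as Pointwise using (Pointwise; []; _∷_)
open import Data.Vec.Relation.Unary.All as VAll using ([]; _∷_)
import Data.Vec.Relation.Unary.All.Properties as VAll
open import Data.Vec.Relation.Unary.AllPairs using ([]; _∷_)
open import Data.Vec.Relation.Unary.Unique.Propositional using () renaming (Unique to UniqueVec)
import Data.Vec.Relation.Unary.Unique.Propositional.Properties as UniqueVec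
open import Defs
open import Function.Base using (_∘_; id)
open import Function.Bundles using (Inverse)
open import Level using (0ℓ)
open import Relation.Binary.Bundles using (Setoid)
import Relation.Binary.Definitions as B
open import Relation.Binary.Definitions using (DecidableEquality; tri<; tri≈; tri>)
open import Relation.Binary.PropositionalEquality as ≡
  using (_≡_; _≢_; refl; sym; trans; cong; cong₂; subst; module ≡-Reasoning)
open import Relation.Binary.Structures using (IsEquivalence)
open import Relation.Nullary.Decidable using (Dec; yes; no; dec⇒maybe; _×-dec_; ¬?)
open import Relation.Nullary.Negation using (¬_; contradiction)
open import Relation.Unary using (Decidable)

-- Integer coefficients for the ring solver

-- Prescribed values can be divided by g² only if g has no zeros on 𝔽_q. Linear polynomials violate
-- this, so their squares stay outside the sieve and are controlled through the zeros of F; this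
-- forces the split into complete sign patterns before anything is estimated. In the signed sums for
-- N(d, b) and q^m N(d - m, b′) a given g carries the same sign, and the factor q^m offsets the m
-- lost degrees. As long as degree at least q remains on both sides, the two contributions of g
-- agree exactly, whatever b and b′ are; the other g only have to be counted. The exponent (3q -
-- d)/2 has three sources: (d + q)/2 from the sieve, q from the number of value vectors measured
-- against the weights of the model, and -d from the division by |𝓕_d|. A relative error uniform in
-- s, including values s of tiny probability, is within reach because each single pattern is
-- estimated with an error proportional to its own weight.

module IntegerSolver {c ℓ} (R : CommutativeRing c ℓ) where
  open import Data.Integer.Base using (+_; -[1+_]; _⊖_)
  open CommutativeRing R hiding (zero; refl; sym; trans)
  private module E = CommutativeRing R
  open import Algebra.Properties.Ring ring
  open import Algebra.Properties.Semiring.Mult semiring using (×-homo-+; ×1-homo-*)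
    renaming (_×_ to infixr 8 _·_)
  open import Relation.Binary.Reasoning.Setoid setoid

  ⟦_⟧ : ℤ → Carrier
  ⟦ + n ⟧      = n · 1#
  ⟦ -[1+ n ] ⟧ = - (suc n · 1#)

  cancel-suc : ∀ x y → (1# + x) + - (1# + y) ≈ x + - y
  cancel-suc x y = begin
    (1# + x) + - (1# + y)       ≈⟨ +-cong (+-comm 1# x) (E.sym (-‿+-comm 1# y)) ⟩
    (x + 1#) + (- 1# + - y)     ≈⟨ +-assoc x 1# _ ⟩
    x + (1# + (- 1# + - y))     ≈⟨ +-congˡ (+-assoc 1# (- 1#) (- y)) ⟨
    x + ((1# + - 1#) + - y)     ≈⟨ +-congˡ (+-congʳ (-‿inverseʳ 1#)) ⟩
    x + (0# + - y)              ≈⟨ +-congˡ (+-identityˡ (- y)) ⟩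
    x + - y                     ∎

  ⊖-homo : ∀ m n → ⟦ m ⊖ n ⟧ ≈ m · 1# + - (n · 1#)
  ⊖-homo m       zero    = E.sym (E.trans (+-congˡ -0#≈0#) (+-identityʳ _))
  ⊖-homo zero    (suc n) = E.sym (+-identityˡ _)
  ⊖-homo (suc m) (suc n) = begin
    ⟦ suc m ⊖ suc n ⟧                 ≡⟨ ≡.cong ⟦_⟧ (ℤ.[1+m]⊖[1+n]≡m⊖n m n) ⟩
    ⟦ m ⊖ n ⟧                         ≈⟨ ⊖-homo m n ⟩
    m · 1# + - (n · 1#)               ≈⟨ cancel-suc _ _ ⟨
    suc m · 1# + - (suc n · 1#)       ∎

  -‿homo : ∀ i → ⟦ ℤ.- i ⟧ ≈ - ⟦ i ⟧
  -‿homo (+ zero)  = E.sym -0#≈0#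
  -‿homo (+ suc n) = E.refl
  -‿homo -[1+ n ]  = E.sym (-‿involutive _)

  +-homo : ∀ i j → ⟦ i ℤ.+ j ⟧ ≈ ⟦ i ⟧ + ⟦ j ⟧
  +-homo (+ m)    (+ n)    = ×-homo-+ 1# m n
  +-homo (+ m)    -[1+ n ] = ⊖-homo m (suc n)
  +-homo -[1+ m ] (+ n)    = E.trans (⊖-homo n (suc m)) (+-comm _ _)
  +-homo -[1+ m ] -[1+ n ] = begin
    - (suc (suc (m ℕ.+ n)) · 1#)        ≡⟨ ≡.cong (λ k → - (suc k · 1#)) (ℕ.+-suc m n) ⟨
    - ((suc m ℕ.+ suc n) · 1#)          ≈⟨ -‿cong (×-homo-+ 1# (suc m) (suc n)) ⟩
    - (suc m · 1# + suc n · 1#)         ≈⟨ -‿+-comm _ _ ⟨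
    - (suc m · 1#) + - (suc n · 1#)     ∎

  *-homo : ∀ i j → ⟦ i ℤ.* j ⟧ ≈ ⟦ i ⟧ * ⟦ j ⟧
  *-homo (+ m) (+ n) = E.trans (reflexive (≡.cong ⟦_⟧ (≡.sym (ℤ.pos-* m n)))) (×1-homo-* m n)
  *-homo (+ m) -[1+ n ] = begin
    ⟦ + m ℤ.* -[1+ n ] ⟧            ≡⟨ ≡.cong ⟦_⟧ (ℤ.neg-distribʳ-* (+ m) (+ suc n)) ⟨
    ⟦ ℤ.- (+ m ℤ.* + suc n) ⟧       ≈⟨ -‿homo (+ m ℤ.* + suc n) ⟩
    - ⟦ + m ℤ.* + suc n ⟧           ≈⟨ -‿cong (*-homo (+ m) (+ suc n)) ⟩
    - (m · 1# * (suc n · 1#))       ≈⟨ -‿distribʳ-* _ _ ⟩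
    m · 1# * - (suc n · 1#)         ∎
  *-homo -[1+ m ] (+ n) = begin
    ⟦ -[1+ m ] ℤ.* + n ⟧            ≡⟨ ≡.cong ⟦_⟧ (ℤ.neg-distribˡ-* (+ suc m) (+ n)) ⟨
    ⟦ ℤ.- (+ suc m ℤ.* + n) ⟧       ≈⟨ -‿homo (+ suc m ℤ.* + n) ⟩
    - ⟦ + suc m ℤ.* + n ⟧           ≈⟨ -‿cong (*-homo (+ suc m) (+ n)) ⟩
    - (suc m · 1# * (n · 1#))       ≈⟨ -‿distribˡ-* _ _ ⟩
    - (suc m · 1#) * (n · 1#)       ∎
  *-homo -[1+ m ] -[1+ n ] = begin
    ⟦ -[1+ m ] ℤ.* -[1+ n ] ⟧            ≈⟨ *-homo (+ suc m) (+ suc n) ⟩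
    (suc m · 1#) * (suc n · 1#)          ≈⟨ -‿involutive _ ⟨
    - - ((suc m · 1#) * (suc n · 1#))    ≈⟨ -‿cong (-‿distribˡ-* _ _) ⟩
    - (- (suc m · 1#) * (suc n · 1#))    ≈⟨ -‿distribʳ-* _ _ ⟩
    - (suc m · 1#) * - (suc n · 1#)      ∎

  homomorphism : ℤ.+-*-rawRing ACR.-Raw-AlmostCommutative⟶ ACR.fromCommutativeRing R
  homomorphism = record
    { ⟦_⟧ = ⟦_⟧ ; +-homo = +-homo ; *-homo = *-homo ; -‿homo = -‿homo
    ; 0-homo = E.refl ; 1-homo = +-identityʳ 1# }

  -- Distinct integers may have the same image in a ring of positive characteristic. A weak decision
  -- may leave such cases open, so comparing the integers is enough.
  coefficient? : B.WeaklyDecidable (ACR.Induced-equivalence homomorphism)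
  coefficient? i j = Maybe.map (λ i≡j → reflexive (≡.cong ⟦_⟧ i≡j)) (dec⇒maybe (i ℤ.≟ j))

  open Algebra.Solver.Ring ℤ.+-*-rawRing (ACR.fromCommutativeRing R) homomorphism coefficient? public
    using (solve; _:=_; _:+_; _:*_; :-_; con)

-- Counting in lists

private variable
  A B : Set

-- Each step deletes the partner of the head from `ys`, and injectivity guarantees that no later
-- element needs the deleted entry. A relation is used in place of a function because partners such
-- as quotients and square roots come out of existence proofs.
rel-length : (R : A → B → Set) {xs : List A} {ys : List B} → Unique xs →
  (∀ {x} → x ∈ xs → ∃[ y ] (y ∈ ys × R x y)) →
  (∀ {x x′ y} → x ∈ xs → x′ ∈ xs → R x y → R x′ y → x ≡ x′) →
  length xs ≤ length ys
rel-length R {[]}     []       tot inj = z≤n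
rel-length R {x ∷ xs} (x∉ ∷ u) tot inj with tot (here refl)
... | y , y∈ , r with ∈-∃++ y∈
... | as , bs , refl =
  subst (suc (length xs) ≤_) (sym (length-++-sucʳ as y bs))
    (s≤s (rel-length R u tot′ (λ p p′ → inj (there p) (there p′))))
  where
  tot′ : ∀ {x′} → x′ ∈ xs → ∃[ y′ ] (y′ ∈ as ++ bs × R x′ y′)
  tot′ p with tot (there p)
  ... | y′ , y′∈ , r′ with ∈-++⁻ as y′∈
  ... | inj₁ ∈as         = y′ , ∈-++⁺ˡ ∈as , r′
  ... | inj₂ (there ∈bs) = y′ , ∈-++⁺ʳ as ∈bs , r′
  ... | inj₂ (here refl) =
    contradiction (inj (here refl) (there p) r r′) (All.lookup x∉ p)

count : {P : A → Set} → Decidable P → List A → ℕ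
count P? xs = length (filter P? xs)

count-rel : {P : A → Set} {Q : B → Set} (P? : Decidable P) (Q? : Decidable Q)
  (R : A → B → Set) {xs : List A} {ys : List B} → Unique xs →
  (∀ {x} → x ∈ xs → P x → ∃[ y ] (y ∈ ys × Q y × R x y)) →
  (∀ {x x′ y} → P x → P x′ → R x y → R x′ y → x ≡ x′) →
  count P? xs ≤ count Q? ys
count-rel P? Q? R {xs} u tot inj = rel-length R (Unique.filter⁺ P? u)
  (λ p → let x∈ , Px = ∈-filter⁻ P? p ; y , y∈ , Qy , r = tot x∈ Px in
         y , ∈-filter⁺ Q? y∈ Qy , r)
  (λ p p′ → inj (proj₂ (∈-filter⁻ P? {xs = xs} p)) (proj₂ (∈-filter⁻ P? {xs = xs} p′)))

count-cong : {P Q : A → Set} (P? : Decidable P) (Q? : Decidable Q) {xs : List A} →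
  (∀ {x} → x ∈ xs → P x → Q x) → (∀ {x} → x ∈ xs → Q x → P x) →
  count P? xs ≡ count Q? xs
count-cong P? Q? {[]}     f g = refl
count-cong P? Q? {x ∷ xs} f g with P? x | Q? x
... | yes p | yes q = cong suc (count-cong P? Q? (f ∘ there) (g ∘ there))
... | no ¬p | no ¬q = count-cong P? Q? (f ∘ there) (g ∘ there)
... | yes p | no ¬q = contradiction (f (here refl) p) ¬q
... | no ¬p | yes q = contradiction (g (here refl) q) ¬p

count-split : {P Q : A → Set} (P? : Decidable P) (Q? : Decidable Q) (¬Q? : Decidable (¬_ ∘ Q)) →
  ∀ xs → count P? xs ≡ count (λ x → P? x ×-dec Q? x) xs ℕ.+ count (λ x → P? x ×-dec ¬Q? x) xs
count-split P? Q? ¬Q? []       = refl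
count-split P? Q? ¬Q? (x ∷ xs) with P? x | Q? x | ¬Q? x
... | no  _ | _     | _      = count-split P? Q? ¬Q? xs
... | yes _ | yes _ | no  _  = cong suc (count-split P? Q? ¬Q? xs)
... | yes _ | no  _ | yes _  = trans (cong suc (count-split P? Q? ¬Q? xs)) (sym (ℕ.+-suc _ _))
... | yes _ | yes q | yes ¬q = contradiction q ¬q
... | yes _ | no ¬q | no ¬¬q = contradiction ¬q ¬¬q

count-∧ : {P Q : A → Set} (P? : Decidable P) (Q? : Decidable Q) → ∀ xs →
  count Q? (filter P? xs) ≡ count (λ x → P? x ×-dec Q? x) xs
count-∧ P? Q? []       = refl
count-∧ P? Q? (x ∷ xs) with P? x
... | no  _ = count-∧ P? Q? xs
... | yes _ with Q? x
...   | no  _ = count-∧ P? Q? xs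
...   | yes _ = cong suc (count-∧ P? Q? xs)

count-map : {Q : B → Set} (Q? : Decidable Q) (f : A → B) → ∀ xs →
  count Q? (map f xs) ≡ count (Q? ∘ f) xs
count-map Q? f []       = refl
count-map Q? f (x ∷ xs) with Q? (f x)
... | yes _ = cong suc (count-map Q? f xs)
... | no  _ = count-map Q? f xs

∑ : List A → (A → ℕ) → ℕ
∑ []       f = 0
∑ (x ∷ xs) f = f x ℕ.+ ∑ xs f

∑-cong : ∀ (xs : List A) {f g : A → ℕ} → (∀ {x} → x ∈ xs → f x ≡ g x) → ∑ xs f ≡ ∑ xs g
∑-cong []       e = refl
∑-cong (x ∷ xs) e = cong₂ ℕ._+_ (e (here refl)) (∑-cong xs (e ∘ there))

∑-zero : ∀ (xs : List A) → ∑ xs (λ _ → 0) ≡ 0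
∑-zero []       = refl
∑-zero (x ∷ xs) = ∑-zero xs

∑-*ˡ : ∀ (xs : List A) k (f : A → ℕ) → k ℕ.* ∑ xs f ≡ ∑ xs (λ x → k ℕ.* f x)
∑-*ˡ []       k f = ℕ.*-zeroʳ k
∑-*ˡ (x ∷ xs) k f = trans (ℕ.*-distribˡ-+ k (f x) _) (cong (k ℕ.* f x ℕ.+_) (∑-*ˡ xs k f))

∑-one : ∀ (xs : List A) → ∑ xs (λ _ → 1) ≡ length xs
∑-one []       = refl
∑-one (x ∷ xs) = cong suc (∑-one xs)

-- The counting step of `count-fibre`: a new element raises the summand of its own fibre by one, and
-- uniqueness of `ys` makes this happen exactly once.
∑-bump : (f g : B → ℕ) {z : B} {ys : List B} → Unique ys → z ∈ ys →
  f z ≡ suc (g z) → (∀ {y} → z ≢ y → f y ≡ g y) → ∑ ys f ≡ suc (∑ ys g)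
∑-bump f g {z} {y ∷ ys} (y∉ ∷ u) (here refl) e e′ =
  cong₂ ℕ._+_ e (∑-cong ys (λ p → e′ (All.lookup y∉ p)))
∑-bump f g {z} {y ∷ ys} (y∉ ∷ u) (there p) e e′ =
  trans (cong₂ ℕ._+_ (e′ (λ { refl → All.lookup y∉ p refl })) (∑-bump f g u p e e′))
        (ℕ.+-suc (g y) _)

count-fibre : {P : A → Set} (P? : Decidable P) (f : A → B) (_≟_ : DecidableEquality B)
  {ys : List B} → Unique ys → ∀ xs → (∀ {x} → x ∈ xs → P x → f x ∈ ys) →
  count P? xs ≡ ∑ ys (λ y → count (λ x → P? x ×-dec (f x ≟ y)) xs)
count-fibre P? f _≟_ {ys} u []       h = sym (∑-zero ys)
count-fibre {P = P} P? f _≟_ {ys} u (x ∷ xs) h = step (P? x)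
  where
  step : Dec (P x) → count P? (x ∷ xs) ≡ ∑ ys (λ y → count (λ x → P? x ×-dec (f x ≟ y)) (x ∷ xs))
  step (no ¬p) = trans (cong length (filter-reject P? ¬p))
    (trans (count-fibre P? f _≟_ u xs (h ∘ there))
      (∑-cong ys (λ {y} _ → cong length (sym
        (filter-reject (λ x → P? x ×-dec (f x ≟ y)) (¬p ∘ proj₁))))))
  step (yes p) = trans (cong length (filter-accept P? p))
    (trans (cong suc (count-fibre P? f _≟_ u xs (h ∘ there)))
      (sym (∑-bump _ _ u (h (here refl) p)
        (cong length (filter-accept (λ x′ → P? x′ ×-dec (f x′ ≟ f x)) (p , refl)))
        (λ {y} ne → cong length
          (filter-reject (λ x → P? x ×-dec (f x ≟ y)) (ne ∘ proj₂))))))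

-- Two-sided error bounds in ℕ, free of subtraction.
Close : ℕ → ℕ → ℕ → Set
Close a b e = a ≤ b ℕ.+ e × b ≤ a ℕ.+ e

close-sym : ∀ {a b e} → Close a b e → Close b a e
close-sym (p , q) = q , p

close-weaken : ∀ {a b e e′} → e ≤ e′ → Close a b e → Close a b e′
close-weaken {a} {b} e≤ (p , q) =
  ℕ.≤-trans p (ℕ.+-monoʳ-≤ b e≤) , ℕ.≤-trans q (ℕ.+-monoʳ-≤ a e≤)

close-+ : ∀ {a b e a′ b′ e′} → Close a b e → Close a′ b′ e′ →
  Close (a ℕ.+ a′) (b ℕ.+ b′) (e ℕ.+ e′)
close-+ {a} {b} {e} {a′} {b′} {e′} (p , q) (p′ , q′) =
  ℕ.≤-trans (ℕ.+-mono-≤ p p′) (ℕ.≤-reflexive (shuffle b e b′ e′)) ,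
  ℕ.≤-trans (ℕ.+-mono-≤ q q′) (ℕ.≤-reflexive (shuffle a e a′ e′))
  where
  open +-*-Solver
  shuffle : ∀ b e b′ e′ → (b ℕ.+ e) ℕ.+ (b′ ℕ.+ e′) ≡ (b ℕ.+ b′) ℕ.+ (e ℕ.+ e′)
  shuffle = solve 4 (λ b e b′ e′ → (b :+ e) :+ (b′ :+ e′) := (b :+ b′) :+ (e :+ e′)) refl

close-* : ∀ k {a b e} → Close a b e → Close (k ℕ.* a) (k ℕ.* b) (k ℕ.* e)
close-* k {a} {b} {e} (p , q) =
  ℕ.≤-trans (ℕ.*-monoʳ-≤ k p) (ℕ.≤-reflexive (ℕ.*-distribˡ-+ k b e)) ,
  ℕ.≤-trans (ℕ.*-monoʳ-≤ k q) (ℕ.≤-reflexive (ℕ.*-distribˡ-+ k a e))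

-- Estimates `(x + y) − y` without subtraction, at the price of adding the errors. One
-- inclusion-exclusion step has this shape.
close-cancel : ∀ {x y x′ y′ e e′} → Close (x ℕ.+ y) (x′ ℕ.+ y′) e → Close y y′ e′ →
  Close x x′ (e ℕ.+ e′)
close-cancel {x} {y} {x′} {y′} {e} {e′} (p , q) (p′ , q′) = go x y x′ y′ p q′ , go x′ y′ x y q p′
  where
  open +-*-Solver
  go : ∀ x y x′ y′ → x ℕ.+ y ≤ x′ ℕ.+ y′ ℕ.+ e → y′ ≤ y ℕ.+ e′ → x ≤ x′ ℕ.+ (e ℕ.+ e′)
  go x y x′ y′ p q = ℕ.+-cancelʳ-≤ y x _ (ℕ.≤-trans p (ℕ.≤-trans
    (ℕ.+-monoˡ-≤ e (ℕ.+-monoʳ-≤ x′ q))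
    (ℕ.≤-reflexive (solve 4 (λ x′ y e e′ → x′ :+ (y :+ e′) :+ e := x′ :+ (e :+ e′) :+ y)
      refl x′ y e e′))))

-- The error stays proportional to the total weight `∑ ys w`, which is what later turns it into a
-- relative error.
close-∑ : ∀ (ys : List B) (f w : B → ℕ) {R E} →
  (∀ {y} → y ∈ ys → Close (f y) (w y ℕ.* R) (w y ℕ.* E)) →
  Close (∑ ys f) (∑ ys w ℕ.* R) (∑ ys w ℕ.* E)
close-∑ []       f w h = z≤n , z≤n
close-∑ (y ∷ ys) f w {R} {E} h =
  ≡.subst₂ (Close _) (sym (ℕ.*-distribʳ-+ R (w y) _)) (sym (ℕ.*-distribʳ-+ E (w y) _))
    (close-+ (h (here refl)) (close-∑ ys f w (h ∘ there)))

-- Vectors with independent conditions on the coordinates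

length-cartesianProductWith : ∀ {C : Set} (f : A → B → C) xs ys →
  length (cartesianProductWith f xs ys) ≡ length xs ℕ.* length ys
length-cartesianProductWith f []       ys = refl
length-cartesianProductWith f (x ∷ xs) ys = trans (length-++ (map (f x) ys))
  (cong₂ ℕ._+_ (length-map (f x) ys) (length-cartesianProductWith f xs ys))

length-vectors : ∀ (xs : List A) n → length (vectors xs n) ≡ length xs ℕ.^ n
length-vectors xs zero    = refl
length-vectors xs (suc n) = trans (length-cartesianProductWith _∷_ xs (vectors xs n))
  (cong (length xs ℕ.*_) (length-vectors xs n))

vectors-unique : ∀ {xs : List A} n → Unique xs → Unique (vectors xs n)
vectors-unique zero    u = [] ∷ []
vectors-unique (suc n) u =
  Unique.cartesianProductWith⁺ _∷_ (λ { refl → refl , refl }) u (vectors-unique n u)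

∈-vectors-complete : ∀ {xs : List A} → (∀ x → x ∈ xs) → ∀ {n} (v : Vec A n) → v ∈ vectors xs n
∈-vectors-complete all []      = here refl
∈-vectors-complete all (x ∷ v) =
  ∈-cartesianProductWith⁺ _∷_ (all x) (∈-vectors-complete all v)

module _ {X : Set} {C : A → X → Set} (C? : B.Decidable C) where
  pointwise? : ∀ {n} (as : Vec A n) → Decidable (Pointwise C {n} {n} as)
  pointwise? as v = Pointwise.decidable C? as v

  ∏-count : ∀ {n} → Vec A n → List X → ℕ
  ∏-count []       xs = 1
  ∏-count (a ∷ as) xs = count (C? a) xs ℕ.* ∏-count as xs

  -- Conditions on separate coordinates do not interact, so the counts multiply. This is the
  -- counterpart, for value vectors, of the product measure of the model.
  count-pointwise : ∀ {n} (as : Vec A n) xs →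
    count (pointwise? as) (vectors xs n) ≡ ∏-count as xs
  count-pointwise []                xs = refl
  count-pointwise {suc n} (a ∷ as) xs =
    trans (go xs) (cong (count (C? a) xs ℕ.*_) (count-pointwise as xs))
    where
    vs = vectors xs n
    go : ∀ ys → count (pointwise? (a ∷ as)) (cartesianProductWith _∷_ ys vs) ≡
                count (C? a) ys ℕ.* count (pointwise? as) vs
    go []       = refl
    go (y ∷ ys) = trans (trans (cong length (filter-++ rest? (map (y ∷_) vs) _))
                               (length-++ (filter rest? (map (y ∷_) vs))))
                 (trans (cong₂ ℕ._+_ (count-map rest? (y ∷_) vs) (go ys)) (step (C? a y)))
      where
      rest? = pointwise? (a ∷ as)
      none : ¬ C a y → ∀ vs → count (rest? ∘ (y ∷_)) vs ≡ 0
      none ¬c []       = refl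
      none ¬c (v ∷ vs) = trans (cong length
        (filter-reject (rest? ∘ (y ∷_)) {v} {vs} λ { (c ∷ _) → ¬c c })) (none ¬c vs)
      step : Dec (C a y) → count (rest? ∘ (y ∷_)) vs ℕ.+ count (C? a) ys ℕ.* count (pointwise? as) vs
                         ≡ count (C? a) (y ∷ ys) ℕ.* count (pointwise? as) vs
      step (yes c) = trans
        (cong (ℕ._+ (count (C? a) ys ℕ.* count (pointwise? as) vs)) (count-cong (rest? ∘ (y ∷_)) (pointwise? as) {vs}
          (λ { _ (_ ∷ p) → p }) (λ _ p → c ∷ p)))
        (cong (λ l → length l ℕ.* count (pointwise? as) vs) (sym (filter-accept (C? a) c)))
      step (no ¬c) = trans (cong (ℕ._+ (count (C? a) ys ℕ.* count (pointwise? as) vs)) (none ¬c vs))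
        (cong (λ l → length l ℕ.* count (pointwise? as) vs) (sym (filter-reject (C? a) ¬c)))

-- Polynomials over 𝔽_q and Euclid's lemma

module Polynomials {q : ℕ} (𝔽 : FiniteField q) where
  open FiniteField 𝔽 public
  open IsCommutativeRing isCommutativeRing public
    using (+-assoc; +-comm; distribˡ; distribʳ; -‿inverseˡ; -‿inverseʳ; *-identityʳ)
  open PolyProperties 𝔽 public

  fieldRing : CommutativeRing 0ℓ 0ℓ
  fieldRing = record { isCommutativeRing = isCommutativeRing }

  module F = IntegerSolver fieldRing

  infixl 6 _⊞_
  infixl 7 _⊠_ _·_
  _⊞_ _⊠_ : List Carrier → List Carrier → List Carrier
  _⊞_ = _+ₚ_ 𝔽
  _⊠_ = _*ₚ_ 𝔽
  _·_ : Carrier → List Carrier → List Carrier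
  a · f = map (a *_) f
  ⊟_ : List Carrier → List Carrier
  ⊟ f = map -_ f
  ev : List Carrier → Carrier → Carrier
  ev = eval 𝔽
  co : List Carrier → ℕ → Carrier
  co = coeff 𝔽

  -- A record, so that both sides can be inferred from the type.
  infix 4 _≋_
  record _≋_ (f g : List Carrier) : Set where
    constructor mk
    field at : _≈ₚ_ 𝔽 f g
  open _≋_ public

  ≋-isEquivalence : IsEquivalence _≋_
  ≋-isEquivalence = record
    { refl  = mk λ _ → refl
    ; sym   = λ e → mk λ n → sym (at e n)
    ; trans = λ e e′ → mk λ n → trans (at e n) (at e′ n)
    }

  polySetoid : Setoid 0ℓ 0ℓ
  polySetoid = record { isEquivalence = ≋-isEquivalence }

  open IsEquivalence ≋-isEquivalence public
    using () renaming (refl to ≋-refl; sym to ≋-sym; trans to ≋-trans; reflexive to ≋-reflexive)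
  open import Relation.Binary.Reasoning.Setoid polySetoid

  ∷-≋ : ∀ {a b f g} → a ≡ b → f ≋ g → a ∷ f ≋ b ∷ g
  ∷-≋ {f = f} {g} e e′ = mk (∷-cong f g e (at e′))

  tail-≋ : ∀ {a b f g} → a ∷ f ≋ b ∷ g → f ≋ g
  tail-≋ e = mk λ n → at e (suc n)

  0∷[]≋[] : 0# ∷ [] ≋ []
  0∷[]≋[] = mk λ { zero → refl ; (suc n) → refl }

  ⊞-cong : ∀ {f f′ g g′} → f ≋ f′ → g ≋ g′ → f ⊞ g ≋ f′ ⊞ g′
  ⊞-cong {f} {f′} {g} {g′} e e′ = mk λ n →
    trans (coeff-+ₚ f g n) (trans (cong₂ _+_ (at e n) (at e′ n)) (sym (coeff-+ₚ f′ g′ n)))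

  ⊞-assoc : ∀ f g h → (f ⊞ g) ⊞ h ≋ f ⊞ (g ⊞ h)
  ⊞-assoc f g h = mk λ n →
    trans (coeff-+ₚ (f ⊞ g) h n) (trans (cong (_+ co h n) (coeff-+ₚ f g n))
    (trans (+-assoc _ _ _)
    (sym (trans (coeff-+ₚ f (g ⊞ h) n) (cong (co f n +_) (coeff-+ₚ g h n))))))

  ⊞-comm : ∀ f g → f ⊞ g ≋ g ⊞ f
  ⊞-comm f g = mk λ n →
    trans (coeff-+ₚ f g n) (trans (+-comm _ _) (sym (coeff-+ₚ g f n)))

  ⊞-identityˡ : ∀ f → [] ⊞ f ≋ f
  ⊞-identityˡ f = ≋-refl

  ⊞-identityʳ : ∀ f → f ⊞ [] ≋ f
  ⊞-identityʳ f = ⊞-comm f []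

  coeff-⊟ : ∀ f n → co (⊟ f) n ≡ - co f n
  coeff-⊟ []      n       = F.solve 0 (F.con 0ℤ F.:= F.:- F.con 0ℤ) refl
  coeff-⊟ (a ∷ f) zero    = refl
  coeff-⊟ (a ∷ f) (suc n) = coeff-⊟ f n

  ⊟-cong : ∀ {f g} → f ≋ g → ⊟ f ≋ ⊟ g
  ⊟-cong {f} {g} e = mk λ n → trans (coeff-⊟ f n) (trans (cong -_ (at e n)) (sym (coeff-⊟ g n)))

  ⊟-inverseˡ : ∀ f → ⊟ f ⊞ f ≋ []
  ⊟-inverseˡ f = mk λ n → trans (coeff-+ₚ (⊟ f) f n)
    (trans (cong (_+ co f n) (coeff-⊟ f n)) (-‿inverseˡ _))

  ⊟-inverseʳ : ∀ f → f ⊞ ⊟ f ≋ []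
  ⊟-inverseʳ f = ≋-trans (⊞-comm f (⊟ f)) (⊟-inverseˡ f)

  ⊠-cong : ∀ {f f′ g g′} → f ≋ f′ → g ≋ g′ → f ⊠ g ≋ f′ ⊠ g′
  ⊠-cong {f} {f′} {g} {g′} e e′ = mk λ n →
    trans (*ₚ-congˡ f f′ g (at e) n) (*ₚ-congʳ f′ g g′ (at e′) n)

  ·-cong : ∀ {a b f g} → a ≡ b → f ≋ g → a · f ≋ b · g
  ·-cong {a} {b} {f} {g} e e′ = mk λ n →
    trans (coeff-scale a f n) (trans (cong₂ _*_ e (at e′ n)) (sym (coeff-scale b g n)))

  ·-assoc : ∀ a b f → (a * b) · f ≋ a · (b · f)
  ·-assoc a b f = mk λ n → trans (coeff-scale (a * b) f n) (trans (*-assoc a b _)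
    (sym (trans (coeff-scale a (b · f) n) (cong (a *_) (coeff-scale b f n)))))

  ·-distribˡ : ∀ a f g → a · (f ⊞ g) ≋ a · f ⊞ a · g
  ·-distribˡ a f g = mk λ n →
    trans (coeff-scale a (f ⊞ g) n) (trans (cong (a *_) (coeff-+ₚ f g n))
    (trans (distribˡ a _ _)
    (sym (trans (coeff-+ₚ (a · f) (a · g) n) (cong₂ _+_ (coeff-scale a f n) (coeff-scale a g n))))))

  ·-distribʳ : ∀ a b f → (a + b) · f ≋ a · f ⊞ b · f
  ·-distribʳ a b f = mk λ n →
    trans (coeff-scale (a + b) f n) (trans (distribʳ _ a b)
    (sym (trans (coeff-+ₚ (a · f) (b · f) n) (cong₂ _+_ (coeff-scale a f n) (coeff-scale b f n)))))

  0·-zero : ∀ f → 0# · f ≋ []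
  0·-zero f = mk λ n → trans (coeff-scale 0# f n) (zeroˡ _)

  1·-identity : ∀ f → 1# · f ≋ f
  1·-identity f = mk λ n → trans (coeff-scale 1# f n) (*-identityˡ _)

  ⊞-interchange : ∀ a b c d → (a ⊞ b) ⊞ (c ⊞ d) ≋ (a ⊞ c) ⊞ (b ⊞ d)
  ⊞-interchange a b c d = begin
    (a ⊞ b) ⊞ (c ⊞ d)   ≈⟨ ⊞-assoc a b (c ⊞ d) ⟩
    a ⊞ (b ⊞ (c ⊞ d))   ≈⟨ ⊞-cong (≋-refl {a}) (⊞-assoc b c d) ⟨
    a ⊞ ((b ⊞ c) ⊞ d)   ≈⟨ ⊞-cong (≋-refl {a}) (⊞-cong (⊞-comm b c) ≋-refl) ⟩
    a ⊞ ((c ⊞ b) ⊞ d)   ≈⟨ ⊞-cong (≋-refl {a}) (⊞-assoc c b d) ⟩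
    a ⊞ (c ⊞ (b ⊞ d))   ≈⟨ ⊞-assoc a c (b ⊞ d) ⟨
    (a ⊞ c) ⊞ (b ⊞ d)   ∎

  ⊠-distribʳ : ∀ h f g → (f ⊞ g) ⊠ h ≋ f ⊠ h ⊞ g ⊠ h
  ⊠-distribʳ h []      g       = ≋-refl
  ⊠-distribʳ h (a ∷ f) []      = ≋-sym (⊞-identityʳ _)
  ⊠-distribʳ h (a ∷ f) (b ∷ g) = begin
    (a + b) · h ⊞ (0# ∷ (f ⊞ g) ⊠ h)
      ≈⟨ ⊞-cong (·-distribʳ a b h) (∷-≋ (sym (+-identityˡ 0#)) (⊠-distribʳ h f g)) ⟩
    (a · h ⊞ b · h) ⊞ ((0# ∷ f ⊠ h) ⊞ (0# ∷ g ⊠ h))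
      ≈⟨ ⊞-interchange (a · h) (b · h) (0# ∷ f ⊠ h) (0# ∷ g ⊠ h) ⟩
    (a ∷ f) ⊠ h ⊞ (b ∷ g) ⊠ h ∎

  ·-⊠-assoc : ∀ a f g → (a · f) ⊠ g ≋ a · (f ⊠ g)
  ·-⊠-assoc a []      g = ≋-refl
  ·-⊠-assoc a (b ∷ f) g = begin
    (a * b) · g ⊞ (0# ∷ (a · f) ⊠ g)
      ≈⟨ ⊞-cong (·-assoc a b g) (∷-≋ (sym (zeroʳ a)) (·-⊠-assoc a f g)) ⟩
    a · (b · g) ⊞ a · (0# ∷ f ⊠ g)
      ≈⟨ ·-distribˡ a (b · g) (0# ∷ f ⊠ g) ⟨
    a · ((b ∷ f) ⊠ g) ∎

  shift-⊠ : ∀ f g → (0# ∷ f) ⊠ g ≋ 0# ∷ (f ⊠ g)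
  shift-⊠ f g = ⊞-cong (0·-zero g) ≋-refl

  ⊠-assoc : ∀ f g h → (f ⊠ g) ⊠ h ≋ f ⊠ (g ⊠ h)
  ⊠-assoc []      g h = ≋-refl
  ⊠-assoc (a ∷ f) g h = begin
    (a · g ⊞ (0# ∷ f ⊠ g)) ⊠ h         ≈⟨ ⊠-distribʳ h (a · g) _ ⟩
    (a · g) ⊠ h ⊞ (0# ∷ f ⊠ g) ⊠ h
      ≈⟨ ⊞-cong (·-⊠-assoc a g h) (≋-trans (shift-⊠ (f ⊠ g) h) (∷-≋ refl (⊠-assoc f g h))) ⟩
    (a ∷ f) ⊠ (g ⊠ h)                  ∎

  ⊠-zeroʳ : ∀ f → f ⊠ [] ≋ []
  ⊠-zeroʳ f = mk (*ₚ-zeroʳ f [] λ _ → refl)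

  ⊠-∷ʳ : ∀ f b g → f ⊠ (b ∷ g) ≋ b · f ⊞ (0# ∷ f ⊠ g)
  ⊠-∷ʳ []      b g = ≋-sym 0∷[]≋[]
  ⊠-∷ʳ (a ∷ f) b g = ∷-≋ (cong (_+ 0#) (*-comm a b)) (begin
    a · g ⊞ f ⊠ (b ∷ g)                ≈⟨ ⊞-cong (≋-refl {a · g}) (⊠-∷ʳ f b g) ⟩
    a · g ⊞ (b · f ⊞ (0# ∷ f ⊠ g))     ≈⟨ ⊞-assoc (a · g) (b · f) _ ⟨
    (a · g ⊞ b · f) ⊞ (0# ∷ f ⊠ g)     ≈⟨ ⊞-cong (⊞-comm (a · g) (b · f)) ≋-refl ⟩
    (b · f ⊞ a · g) ⊞ (0# ∷ f ⊠ g)     ≈⟨ ⊞-assoc (b · f) (a · g) _ ⟩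
    b · f ⊞ (a · g ⊞ (0# ∷ f ⊠ g))     ∎)

  ⊠-comm : ∀ f g → f ⊠ g ≋ g ⊠ f
  ⊠-comm []      g = ≋-sym (⊠-zeroʳ g)
  ⊠-comm (a ∷ f) g = ≋-trans (⊞-cong ≋-refl (∷-≋ refl (⊠-comm f g))) (≋-sym (⊠-∷ʳ g a f))

  ⊠-identityˡ : ∀ f → (1# ∷ []) ⊠ f ≋ f
  ⊠-identityˡ f = ≋-trans (⊞-cong (1·-identity f) 0∷[]≋[]) (⊞-identityʳ f)

  polyRing : CommutativeRing 0ℓ 0ℓ
  polyRing = record
    { Carrier = List Carrier ; _≈_ = _≋_ ; _+_ = _⊞_ ; _*_ = _⊠_ ; -_ = ⊟_
    ; 0# = [] ; 1# = 1# ∷ []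
    ; isCommutativeRing = record
      { isRing = record
        { +-isAbelianGroup = record
          { isGroup = record
            { isMonoid = record
              { isSemigroup = record
                { isMagma = record { isEquivalence = ≋-isEquivalence ; ∙-cong = ⊞-cong }
                ; assoc = ⊞-assoc }
              ; identity = ⊞-identityˡ , ⊞-identityʳ }
            ; inverse = ⊟-inverseˡ , ⊟-inverseʳ
            ; ⁻¹-cong = ⊟-cong }
          ; comm = ⊞-comm }
        ; *-cong = ⊠-cong
        ; *-assoc = ⊠-assoc
        ; *-identity = ⊠-identityˡ , λ f → ≋-trans (⊠-comm f _) (⊠-identityˡ f)
        ; distrib = (λ h f g → ≋-trans (⊠-comm h (f ⊞ g)) (≋-trans (⊠-distribʳ h f g)
                                 (⊞-cong (⊠-comm f h) (⊠-comm g h)))) , ⊠-distribʳ }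
      ; *-comm = ⊠-comm } }

  module P = IntegerSolver polyRing

  eval-⊞ : ∀ f g x → ev (f ⊞ g) x ≡ ev f x + ev g x
  eval-⊞ []      g       x = sym (+-identityˡ _)
  eval-⊞ (a ∷ f) []      x = sym (+-identityʳ _)
  eval-⊞ (a ∷ f) (b ∷ g) x = trans (cong (λ e → a + b + x * e) (eval-⊞ f g x))
    (F.solve 5 (λ a b x f g → a F.:+ b F.:+ x F.:* (f F.:+ g) F.:=
                              a F.:+ x F.:* f F.:+ (b F.:+ x F.:* g)) refl a b x (ev f x) (ev g x))

  eval-· : ∀ a f x → ev (a · f) x ≡ a * ev f x
  eval-· a []      x = sym (zeroʳ a)
  eval-· a (b ∷ f) x = trans (cong (λ e → a * b + x * e) (eval-· a f x))
    (F.solve 4 (λ a b x f → a F.:* b F.:+ x F.:* (a F.:* f) F.:=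
                            a F.:* (b F.:+ x F.:* f)) refl a b x (ev f x))

  eval-⊠ : ∀ f g x → ev (f ⊠ g) x ≡ ev f x * ev g x
  eval-⊠ []      g x = sym (zeroˡ _)
  eval-⊠ (a ∷ f) g x = trans (eval-⊞ (a · g) (0# ∷ f ⊠ g) x)
    (trans (cong₂ (λ e e′ → e + (0# + x * e′)) (eval-· a g x) (eval-⊠ f g x))
    (F.solve 4 (λ a x f g → a F.:* g F.:+ (F.con 0ℤ F.:+ x F.:* (f F.:* g)) F.:=
                            (a F.:+ x F.:* f) F.:* g) refl a x (ev f x) (ev g x)))

  eval-[] : ∀ f → f ≋ [] → ∀ x → ev f x ≡ 0#
  eval-[] []      e x = refl
  eval-[] (a ∷ f) e x = trans (cong₂ (λ b c → b + x * c) (at e 0) (eval-[] f (mk (at e ∘ suc)) x))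
    (trans (+-identityˡ _) (zeroʳ x))

  eval-cong : ∀ f g → f ≋ g → ∀ x → ev f x ≡ ev g x
  eval-cong []      g       e x = sym (eval-[] g (≋-sym e) x)
  eval-cong (a ∷ f) []      e x = eval-[] (a ∷ f) e x
  eval-cong (a ∷ f) (b ∷ g) e x =
    cong₂ (λ b c → b + x * c) (at e 0) (eval-cong f g (tail-≋ e) x)

  -- Monic polynomials are represented by the list of their lower coefficients,
  -- on which propositional equality is equality of polynomials.
  Monic : Set
  Monic = List Carrier

  mono : Monic → List Carrier
  mono f = f ++ 1# ∷ []

  mono-lead : ∀ f → co (mono f) (length f) ≡ 1#
  mono-lead []      = refl
  mono-lead (a ∷ f) = mono-lead f

  mono-high : ∀ f m → length f < m → co (mono f) m ≡ 0#
  mono-high []      (suc m) _       = refl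
  mono-high (a ∷ f) (suc m) (s≤s p) = mono-high f m p

  mono-degree : ∀ f → HasDegree (mono f) (length f)
  mono-degree f = (λ e → 0≢1 (trans (sym e) (mono-lead f))) , mono-high f

  mono-injective : ∀ f g → mono f ≋ mono g → f ≡ g
  mono-injective []      []      e = refl
  mono-injective []      (b ∷ g) e = contradiction (trans (at e (suc (length g))) (mono-lead g)) 0≢1
  mono-injective (a ∷ f) []      e =
    contradiction (trans (sym (at e (suc (length f)))) (mono-lead f)) 0≢1
  mono-injective (a ∷ f) (b ∷ g) e = cong₂ _∷_ (at e 0) (mono-injective f g (tail-≋ e))

  infixl 7 _⊗_
  -- Multiplication transported along `mono`: with `a ∷ f` read as `a + X f`, the leading one of the
  -- product comes from the second summand, since `a · mono g` is no longer than the list of lower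
  -- coefficients of the product.
  _⊗_ : Monic → Monic → Monic
  []      ⊗ g = g
  (a ∷ f) ⊗ g = a · mono g ⊞ (0# ∷ f ⊗ g)

  length-⊞ : ∀ f g → length f ≤ length g → length (f ⊞ g) ≡ length g
  length-⊞ []      g       p       = refl
  length-⊞ (a ∷ f) (b ∷ g) (s≤s p) = cong suc (length-⊞ f g p)

  mono-⊞ : ∀ f g → length f ≤ length g → mono (f ⊞ g) ≡ f ⊞ mono g
  mono-⊞ []      g       p       = refl
  mono-⊞ (a ∷ f) (b ∷ g) (s≤s p) = cong (a + b ∷_) (mono-⊞ f g p)

  length-⊗ : ∀ f g → length (f ⊗ g) ≡ length f ℕ.+ length g
  ·mono-length : ∀ a f g → length (a · mono g) ≤ suc (length (f ⊗ g))

  length-⊗ []      g = refl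
  length-⊗ (a ∷ f) g = trans (length-⊞ (a · mono g) (0# ∷ f ⊗ g) (·mono-length a f g))
    (cong suc (length-⊗ f g))

  ·mono-length a f g = ℕ.≤-trans
    (ℕ.≤-reflexive (trans (length-map (a *_) (mono g)) (trans (length-++ g) (ℕ.+-comm (length g) 1))))
    (s≤s (ℕ.≤-trans (ℕ.m≤n+m (length g) (length f)) (ℕ.≤-reflexive (sym (length-⊗ f g)))))

  mono-⊗ : ∀ f g → mono (f ⊗ g) ≋ mono f ⊠ mono g
  mono-⊗ []      g = ≋-sym (⊠-identityˡ (mono g))
  mono-⊗ (a ∷ f) g = begin
    mono (a · mono g ⊞ (0# ∷ f ⊗ g))  ≡⟨ mono-⊞ (a · mono g) (0# ∷ f ⊗ g) (·mono-length a f g) ⟩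
    a · mono g ⊞ (0# ∷ mono (f ⊗ g))  ≈⟨ ⊞-cong (≋-refl {a · mono g}) (∷-≋ refl (mono-⊗ f g)) ⟩
    mono (a ∷ f) ⊠ mono g             ∎

  ⊗-comm : ∀ f g → f ⊗ g ≡ g ⊗ f
  ⊗-comm f g = mono-injective _ _ (begin
    mono (f ⊗ g)      ≈⟨ mono-⊗ f g ⟩
    mono f ⊠ mono g   ≈⟨ ⊠-comm (mono f) (mono g) ⟩
    mono g ⊠ mono f   ≈⟨ mono-⊗ g f ⟨
    mono (g ⊗ f)      ∎)

  ⊗-assoc : ∀ f g h → (f ⊗ g) ⊗ h ≡ f ⊗ (g ⊗ h)
  ⊗-assoc f g h = mono-injective _ _ (begin
    mono ((f ⊗ g) ⊗ h)           ≈⟨ mono-⊗ (f ⊗ g) h ⟩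
    mono (f ⊗ g) ⊠ mono h        ≈⟨ ⊠-cong (mono-⊗ f g) ≋-refl ⟩
    mono f ⊠ mono g ⊠ mono h     ≈⟨ ⊠-assoc (mono f) (mono g) (mono h) ⟩
    mono f ⊠ (mono g ⊠ mono h)   ≈⟨ ⊠-cong (≋-refl {mono f}) (mono-⊗ g h) ⟨
    mono f ⊠ mono (g ⊗ h)        ≈⟨ mono-⊗ f (g ⊗ h) ⟨
    mono (f ⊗ (g ⊗ h))           ∎)

  ⊗-identityʳ : ∀ f → f ⊗ [] ≡ f
  ⊗-identityʳ f = ⊗-comm f []

  ⊠-cancelʳ-mono : ∀ f p → f ⊠ mono p ≋ [] → f ≋ []
  ⊠-cancelʳ-mono f p e with degree f
  ... | inj₁ f≈0      = mk f≈0
  ... | inj₂ (n , df) =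
    contradiction (at e (n ℕ.+ length p)) (proj₁ (*ₚ-degree f (mono p) df (mono-degree p)))

  ⊗-cancelʳ : ∀ p {f g} → f ⊗ p ≡ g ⊗ p → f ≡ g
  ⊗-cancelʳ p {f} {g} e = mono-injective f g (begin
    mono f                       ≈⟨ P.solve 2 (λ f g → f P.:= (f P.:+ P.:- g) P.:+ g) ≋-refl (mono f) (mono g) ⟩
    (mono f ⊞ ⊟ mono g) ⊞ mono g ≈⟨ ⊞-cong (⊠-cancelʳ-mono (mono f ⊞ ⊟ mono g) p diff) ≋-refl ⟩
    mono g                       ∎)
    where
    diff : (mono f ⊞ ⊟ mono g) ⊠ mono p ≋ []
    diff = begin
      (mono f ⊞ ⊟ mono g) ⊠ mono p
        ≈⟨ P.solve 3 (λ f g p → (f P.:+ P.:- g) P.:* p P.:= f P.:* p P.:+ P.:- (g P.:* p)) ≋-refl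
             (mono f) (mono g) (mono p) ⟩
      mono f ⊠ mono p ⊞ ⊟ (mono g ⊠ mono p)
        ≈⟨ ⊞-cong (mono-⊗ f p) (⊟-cong (mono-⊗ g p)) ⟨
      mono (f ⊗ p) ⊞ ⊟ mono (g ⊗ p)
        ≡⟨ cong (λ h → mono h ⊞ ⊟ mono (g ⊗ p)) e ⟩
      mono (g ⊗ p) ⊞ ⊟ mono (g ⊗ p)
        ≈⟨ ⊟-inverseʳ (mono (g ⊗ p)) ⟩
      [] ∎

  -- Divisibility and division with remainder

  infix 4 _∣_
  _∣_ : Monic → Monic → Set
  f ∣ g = ∃[ h ] g ≡ h ⊗ f

  ∣-⊗ˡ : ∀ f {p g} → p ∣ g → p ∣ f ⊗ g
  ∣-⊗ˡ f {p} (h , refl) = f ⊗ h , sym (⊗-assoc f h p)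

  ∣-⊗ʳ : ∀ g {p f} → p ∣ f → p ∣ f ⊗ g
  ∣-⊗ʳ g {p} {f} d = subst (p ∣_) (⊗-comm g f) (∣-⊗ˡ g d)

  ∣-trans : ∀ {f g h} → f ∣ g → g ∣ h → f ∣ h
  ∣-trans d (k , refl) = ∣-⊗ˡ k d

  ∣-length : ∀ {f g} → f ∣ g → length f ≤ length g
  ∣-length {f} (h , refl) = ℕ.≤-trans (ℕ.m≤n+m (length f) (length h)) (ℕ.≤-reflexive (sym (length-⊗ h f)))

  -- One step of long division: `s` has one entry more than `p`, and the multiplier `t` is its last
  -- entry.
  reduce : ∀ p s → length s ≡ suc (length p) →
    ∃[ t ] ∃[ r ] (length r ≡ length p × s ≋ t · mono p ⊞ r)
  reduce []      (t ∷ []) e = t , [] , refl , ∷-≋ (sym (*-identityʳ t)) ≋-refl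
  reduce (b ∷ p) (a ∷ s)  e with reduce p s (ℕ.suc-injective e)
  ... | t , r , lr , s≋ = t , (a + - (t * b)) ∷ r , cong suc lr ,
    ∷-≋ (F.solve 2 (λ a b → a F.:= b F.:+ (a F.:+ F.:- b)) refl a (t * b)) s≋

  -- The remainder is padded to exactly `length p` entries, so that `a + X r` always has the length
  -- that `reduce` expects.
  divide : ∀ p f → ∃[ u ] ∃[ r ] (length r ≡ length p × f ≋ u ⊠ mono p ⊞ r)
  divide p []      = [] , replicate (length p) 0# , length-replicate (length p) , zeros (length p)
    where
    zeros : ∀ n → [] ≋ replicate n 0#
    zeros zero    = ≋-refl
    zeros (suc n) = ≋-trans (≋-sym 0∷[]≋[]) (∷-≋ refl (zeros n))
  divide p (a ∷ f) with divide p f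
  ... | u , r , lr , f≋ with reduce p (a ∷ r) (cong suc lr)
  ... | t , r′ , lr′ , ar≋ = t ∷ u , r′ , lr′ , (begin
    a ∷ f                                  ≈⟨ ∷-≋ refl f≋ ⟩
    a ∷ u ⊠ mono p ⊞ r                     ≈⟨ ∷-≋ (+-identityˡ a) ≋-refl ⟨
    (0# ∷ u ⊠ mono p) ⊞ (a ∷ r)            ≈⟨ ⊞-cong (≋-refl {0# ∷ u ⊠ mono p}) ar≋ ⟩
    (0# ∷ u ⊠ mono p) ⊞ (t · mono p ⊞ r′)  ≈⟨ ⊞-assoc (0# ∷ u ⊠ mono p) (t · mono p) r′ ⟨
    (0# ∷ u ⊠ mono p) ⊞ t · mono p ⊞ r′    ≈⟨ ⊞-cong (⊞-comm (0# ∷ u ⊠ mono p) (t · mono p)) ≋-refl ⟩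
    (t ∷ u) ⊠ mono p ⊞ r′                  ∎)

  -- Strips the padding of a remainder and makes it monic; `length c < length r` is the drop in
  -- degree that drives the descent in `euclid-small`.
  normalise : ∀ r → r ≋ [] ⊎
    ∃[ a ] ∃[ c ] (a ≢ 0# × length c < length r × r ≋ a · mono c)
  normalise []      = inj₁ ≋-refl
  normalise (b ∷ r) with normalise r
  ... | inj₂ (a , c , a≢0 , lc , r≋) = let a⁻¹ , aa⁻¹≡1 = inverse a a≢0 in
    inj₂ (a , a⁻¹ * b ∷ c , a≢0 , s≤s lc ,
      ∷-≋ (sym (trans (sym (*-assoc a a⁻¹ b)) (trans (cong (_* b) aa⁻¹≡1) (*-identityˡ b)))) r≋)
  ... | inj₁ r≋0 with b ≟ 0#
  ...   | yes refl = inj₁ (≋-trans (∷-≋ refl r≋0) 0∷[]≋[])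
  ...   | no  b≢0  = inj₂ (b , [] , b≢0 , s≤s z≤n , ∷-≋ (sym (*-identityʳ b)) r≋0)

  ·-mono-injective : ∀ a f g → a ≢ 0# → a · mono f ≋ mono g → f ≡ g
  ·-mono-injective a f g a≢0 e = mono-injective f g
    (≋-trans (≋-sym (1·-identity (mono f))) (≋-trans (·-cong (sym a≡1) ≋-refl) e))
    where
    lead : co (a · mono f) (length f) ≡ a
    lead = trans (coeff-scale a (mono f) _) (trans (cong (a *_) (mono-lead f)) (*-identityʳ a))
    lengths : length f ≡ length g
    lengths = degree-unique (a · mono f) (mono g) (at e)
      ((λ z → a≢0 (trans (sym lead) z)) ,
       (λ m p → trans (coeff-scale a (mono f) m) (trans (cong (a *_) (mono-high f m p)) (zeroʳ a))))
      (mono-degree g)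
    a≡1 : a ≡ 1#
    a≡1 = trans (sym lead) (trans (at e (length f))
      (trans (cong (co (mono g)) lengths) (mono-lead g)))

  -- A quotient found among all polynomials is a scalar times a monic one, and comparing leading
  -- coefficients forces the scalar to be one. Divisibility thus descends to `Monic`.
  monic-quotient : ∀ t p f → t ⊠ mono p ≋ mono f → p ∣ f
  monic-quotient t p f e with normalise t
  ... | inj₁ t≋0 = contradiction
    (trans (sym (mono-lead f)) (at (≋-trans (≋-sym e) (⊠-cong t≋0 ≋-refl)) (length f))) (0≢1 ∘ sym)
  ... | inj₂ (a , h , a≢0 , _ , t≋) = h , sym (·-mono-injective a (h ⊗ p) f a≢0 (begin
    a · mono (h ⊗ p)        ≈⟨ ·-cong refl (mono-⊗ h p) ⟩
    a · (mono h ⊠ mono p)   ≈⟨ ·-⊠-assoc a (mono h) (mono p) ⟨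
    (a · mono h) ⊠ mono p   ≈⟨ ⊠-cong t≋ ≋-refl ⟨
    t ⊠ mono p              ≈⟨ e ⟩
    mono f                  ∎))

  -- Irreducible polynomials

  Irreducible : Monic → Set
  Irreducible p = 1 ≤ length p × (∀ g h → h ⊗ g ≡ p → length g ≡ 0 ⊎ length h ≡ 0)

  -- Because `r b = x b − u (y b)`, the common divisor `p` passes to `r b`, and the unit `a` is
  -- divided out afterwards. The lemma serves both to reduce a factor modulo `p` and to reduce `p`
  -- modulo a multiplier of smaller degree.
  ∣-remainder : ∀ {p b x y u r a c v w} → a ≢ 0# → r ≋ a · mono c → x ≋ u ⊠ y ⊞ r →
    x ⊠ mono b ≋ v ⊠ mono p → y ⊠ mono b ≋ w ⊠ mono p → p ∣ c ⊗ b
  ∣-remainder {p} {b} {x} {y} {u} {r} {a} {c} {v} {w} a≢0 r≋ x≋ xb yb =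
    let a⁻¹ , aa⁻¹≡1 = inverse a a≢0 in
    monic-quotient (a⁻¹ · (v ⊞ ⊟ (u ⊠ w))) p (c ⊗ b) (begin
      (a⁻¹ · (v ⊞ ⊟ (u ⊠ w))) ⊠ mono p
        ≈⟨ ·-⊠-assoc a⁻¹ (v ⊞ ⊟ (u ⊠ w)) (mono p) ⟩
      a⁻¹ · ((v ⊞ ⊟ (u ⊠ w)) ⊠ mono p)
        ≈⟨ ·-cong refl rb ⟩
      a⁻¹ · (r ⊠ mono b)
        ≈⟨ ·-cong refl (≋-trans (⊠-cong r≋ ≋-refl) (·-⊠-assoc a (mono c) (mono b))) ⟩
      a⁻¹ · (a · (mono c ⊠ mono b))
        ≈⟨ ·-assoc a⁻¹ a (mono c ⊠ mono b) ⟨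
      (a⁻¹ * a) · (mono c ⊠ mono b)
        ≈⟨ ·-cong (trans (*-comm a⁻¹ a) aa⁻¹≡1) ≋-refl ⟩
      1# · (mono c ⊠ mono b)
        ≈⟨ 1·-identity _ ⟩
      mono c ⊠ mono b
        ≈⟨ mono-⊗ c b ⟨
      mono (c ⊗ b) ∎)
    where
    rb : (v ⊞ ⊟ (u ⊠ w)) ⊠ mono p ≋ r ⊠ mono b
    rb = begin
      (v ⊞ ⊟ (u ⊠ w)) ⊠ mono p
        ≈⟨ P.solve 4 (λ v u w p → (v P.:+ P.:- (u P.:* w)) P.:* p P.:=
                                  v P.:* p P.:+ P.:- (u P.:* (w P.:* p))) ≋-refl v u w (mono p) ⟩
      v ⊠ mono p ⊞ ⊟ (u ⊠ (w ⊠ mono p))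
        ≈⟨ ⊞-cong xb (⊟-cong (⊠-cong (≋-refl {u}) yb)) ⟨
      x ⊠ mono b ⊞ ⊟ (u ⊠ (y ⊠ mono b))
        ≈⟨ ⊞-cong (⊠-cong x≋ ≋-refl) ≋-refl ⟩
      (u ⊠ y ⊞ r) ⊠ mono b ⊞ ⊟ (u ⊠ (y ⊠ mono b))
        ≈⟨ P.solve 4 (λ u y r b → (u P.:* y P.:+ r) P.:* b P.:+ P.:- (u P.:* (y P.:* b)) P.:= r P.:* b)
             ≋-refl u y r (mono b) ⟩
      r ⊠ mono b ∎

  ⊗-⊠ : ∀ {c b t p} → c ⊗ b ≡ t ⊗ p → mono c ⊠ mono b ≋ mono t ⊠ mono p
  ⊗-⊠ {c} {b} {t} {p} e = ≋-trans (≋-sym (mono-⊗ c b)) (≋-trans (≋-reflexive (cong mono e)) (mono-⊗ t p))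

  length≡0 : ∀ (c : Monic) → length c ≡ 0 → c ≡ []
  length≡0 [] _ = refl

  -- Dividing p by c replaces c by a multiplier of smaller degree, until it is constant.
  euclid-small : ∀ {p} → Irreducible p → ∀ b n c → length c ≤ n → length c < length p →
    p ∣ c ⊗ b → p ∣ b
  euclid-small {p} irr b n c c≤n c<p (t , e) with divide c (mono p)
  ... | u , r , lr , p≋ with normalise r
  ... | inj₁ r≋0 with monic-quotient u c p (≋-sym (≋-trans p≋ (≋-trans (⊞-cong ≋-refl r≋0) (⊞-identityʳ _))))
  ...   | h , p≡ with proj₂ irr c h (sym p≡)
  ...     | inj₁ c≡0 = t , trans (cong (_⊗ b) (sym (length≡0 c c≡0))) e
  ...     | inj₂ h≡0 = contradiction
    (sym (trans (cong length p≡) (trans (length-⊗ h c) (cong (ℕ._+ length c) h≡0)))) (ℕ.<⇒≢ c<p)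
  euclid-small {p} irr b zero c c≤n c<p (t , e) | u , r , lr , p≋ | inj₂ (a , c′ , a≢0 , c′<r , r≋) =
    contradiction (ℕ.<-≤-trans c′<r (ℕ.≤-trans (ℕ.≤-reflexive lr) c≤n)) λ ()
  euclid-small {p} irr b (suc n) c c≤n c<p (t , e) | u , r , lr , p≋ | inj₂ (a , c′ , a≢0 , c′<r , r≋) =
    euclid-small irr b n c′ (ℕ.≤-pred (ℕ.≤-trans c′<c c≤n)) (ℕ.<-trans c′<c c<p)
      (∣-remainder {y = mono c} {u} {v = mono b} {mono t} a≢0 r≋ p≋ (⊠-comm (mono p) (mono b)) (⊗-⊠ {c} {b} {t} {p} e))
    where c′<c = ℕ.<-≤-trans c′<r (ℕ.≤-reflexive lr)

  euclid : ∀ {p} → Irreducible p → ∀ a b → p ∣ a ⊗ b → p ∣ a ⊎ p ∣ b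
  euclid {p} irr a b (t , e) with divide p (mono a)
  ... | u , r , lr , a≋ with normalise r
  ... | inj₁ r≋0 =
    inj₁ (monic-quotient u p a (≋-sym (≋-trans a≋ (≋-trans (⊞-cong ≋-refl r≋0) (⊞-identityʳ _)))))
  ... | inj₂ (k , c , k≢0 , c<r , r≋) =
    inj₂ (euclid-small irr b (length c) c ℕ.≤-refl (ℕ.<-≤-trans c<r (ℕ.≤-reflexive lr))
      (∣-remainder {y = mono p} {u} {v = mono t} {mono b} k≢0 r≋ a≋ (⊗-⊠ {a} {b} {t} {p} e) (⊠-comm (mono p) (mono b))))

  -- Euclid's lemma twice: the first application takes one factor `p` out of `b`, and cancelling `p`
  -- prepares the second.
  square-coprime : ∀ {p} → Irreducible p → ∀ a b → ¬ p ∣ a → p ⊗ p ∣ a ⊗ b → p ⊗ p ∣ b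
  square-coprime {p} irr a b p∤a (t , e) = first (euclid irr a b (t ⊗ p , trans e (sym (⊗-assoc t p p))))
    where
    first : p ∣ a ⊎ p ∣ b → p ⊗ p ∣ b
    first (inj₁ p∣a)        = contradiction p∣a p∤a
    first (inj₂ (b′ , b≡)) = second (euclid irr a b′ (t , ⊗-cancelʳ p {a ⊗ b′} {t ⊗ p} cancelled))
      where
      cancelled : (a ⊗ b′) ⊗ p ≡ (t ⊗ p) ⊗ p
      cancelled = trans (⊗-assoc a b′ p) (trans (cong (a ⊗_) (sym b≡)) (trans e (sym (⊗-assoc t p p))))
      second : p ∣ a ⊎ p ∣ b′ → p ⊗ p ∣ b
      second (inj₁ p∣a)         = contradiction p∣a p∤a
      second (inj₂ (b″ , b′≡)) = b″ , trans b≡ (trans (cong (_⊗ p) b′≡) (⊗-assoc b″ p p))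

-- Values and interpolation

module Values {q : ℕ} (𝔽 : FiniteField q) where
  open Polynomials 𝔽 public
  open Inverse enumeration public using (to; from; strictlyInverseˡ; strictlyInverseʳ)

  *-cancelʳ-nonzero : ∀ {x y z} → z ≢ 0# → x * z ≡ y * z → x ≡ y
  *-cancelʳ-nonzero {x} {y} {z} z≢0 e = let w , zw≡1 = inverse z z≢0 in
    trans (undo x w zw≡1) (trans (cong (_* w) e) (sym (undo y w zw≡1)))
    where
    undo : ∀ x w → z * w ≡ 1# → x ≡ x * z * w
    undo x w zw≡1 = sym (trans (*-assoc x z w) (trans (cong (x *_) zw≡1) (*-identityʳ x)))

  x-y≡0⇒x≡y : ∀ {x y} → x + - y ≡ 0# → x ≡ y
  x-y≡0⇒x≡y {x} {y} e = trans (F.solve 2 (λ x y → x F.:= x F.:+ F.:- y F.:+ y) refl x y)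
    (trans (cong (_+ y) e) (+-identityˡ y))

  elements-unique : Unique elements
  elements-unique = Unique.map⁺
    (λ {i} {j} e → trans (sym (strictlyInverseʳ i)) (trans (cong from e) (strictlyInverseʳ j)))
    (Unique.allFin⁺ q)

  length-elements : length elements ≡ q
  length-elements = trans (length-map to (allFin q)) (length-tabulate id)

  -- c + (X − x) g
  mulLin : Carrier → Carrier → List Carrier → List Carrier
  mulLin c x []      = c ∷ []
  mulLin c x (a ∷ g) = c + - (x * a) ∷ mulLin a x g

  length-mulLin : ∀ c x g → length (mulLin c x g) ≡ suc (length g)
  length-mulLin c x []      = refl
  length-mulLin c x (a ∷ g) = cong suc (length-mulLin a x g)

  eval-mulLin : ∀ c x g y → ev (mulLin c x g) y ≡ c + (y + - x) * ev g y
  eval-mulLin c x []      y =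
    F.solve 3 (λ c x y → c F.:+ y F.:* F.con 0ℤ F.:= c F.:+ (y F.:+ F.:- x) F.:* F.con 0ℤ) refl c x y
  eval-mulLin c x (a ∷ g) y = trans (cong (λ e → c + - (x * a) + y * e) (eval-mulLin a x g y))
    (F.solve 5 (λ c x a y g → c F.:+ F.:- (x F.:* a) F.:+ y F.:* (a F.:+ (y F.:+ F.:- x) F.:* g)
                  F.:= c F.:+ (y F.:+ F.:- x) F.:* (a F.:+ y F.:* g)) refl c x a y (ev g y))

  -- Horner's scheme, with `c` the value at `x`. It preserves the number of coefficients, so
  -- polynomials of bounded length can be compared by `≡`.
  synthetic : ∀ x a f → ∃[ c ] ∃[ g ] (length g ≡ length f × a ∷ f ≡ mulLin c x g)
  synthetic x a []      = a , [] , refl , refl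
  synthetic x a (b ∷ f) with synthetic x b f
  ... | c , g , lg , e = a + x * c , c ∷ g , cong suc lg ,
    cong₂ _∷_ (F.solve 2 (λ a b → a F.:= a F.:+ b F.:+ F.:- b) refl a (x * c)) e

  eval-mulLin-root : ∀ c x g → ev (mulLin c x g) x ≡ c
  eval-mulLin-root c x g = trans (eval-mulLin c x g x)
    (F.solve 3 (λ c x g → c F.:+ (x F.:+ F.:- x) F.:* g F.:= c) refl c x (ev g x))

  -- Induction on the points: at `x` the constants of the two synthetic divisions agree, and at
  -- every other point `y` the factor `y − x` can be cancelled, which leaves quotients with one
  -- coefficient less.
  agree : ∀ {xs} → Unique xs → ∀ f g → length f ≡ length g → length f ≤ length xs →
    (∀ {x} → x ∈ xs → ev f x ≡ ev g x) → f ≡ g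
  agree u []      []      e l h = refl
  agree {x ∷ xs} (x∉ ∷ u) (a ∷ f) (b ∷ g) e (s≤s l) h
    with synthetic x a f | synthetic x b g
  ... | c , f′ , lf , f≡ | d , g′ , lg , g≡ =
    trans f≡ (trans (cong₂ (λ c h → mulLin c x h) c≡d rest) (sym g≡))
    where
    evs : ∀ {y} → y ∈ x ∷ xs → ev (mulLin c x f′) y ≡ ev (mulLin d x g′) y
    evs {y} y∈ = trans (cong (λ f → ev f y) (sym f≡)) (trans (h y∈) (cong (λ f → ev f y) g≡))
    c≡d : c ≡ d
    c≡d = trans (sym (eval-mulLin-root c x f′)) (trans (evs (here refl)) (eval-mulLin-root d x g′))
    rest : f′ ≡ g′
    rest = agree u f′ g′ (trans lf (trans (ℕ.suc-injective e) (sym lg)))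
      (ℕ.≤-trans (ℕ.≤-reflexive lf) l)
      (λ {y} y∈ → *-cancelʳ-nonzero {z = y + - x} (λ z → All.lookup x∉ y∈ (sym (x-y≡0⇒x≡y z)))
        (same c≡d (trans (sym (eval-mulLin c x f′ y)) (trans (evs (there y∈)) (eval-mulLin d x g′ y)))))
      where
      same : ∀ {c d u v w} → c ≡ d → c + u * v ≡ d + u * w → v * u ≡ w * u
      same {c} {u = u} {v} {w} refl e = trans (cancel v) (trans (cong (- c +_) e) (sym (cancel w)))
        where
        cancel : ∀ v → v * u ≡ - c + (c + u * v)
        cancel v = F.solve 3 (λ c u v → v F.:* u F.:= F.:- c F.:+ (c F.:+ u F.:* v)) refl c u v

  -- Newton's method: the difference quotients with respect to `x` are interpolated on the remaining
  -- points.
  interpolate : ∀ {xs} → Unique xs → ∀ (b : Carrier → Carrier) →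
    ∃[ f ] (length f ≡ length xs × (∀ {x} → x ∈ xs → ev f x ≡ b x))
  interpolate {[]}     []       b = [] , refl , λ ()
  interpolate {x ∷ xs} (x∉ ∷ u) b with interpolate u slope
    where
    slope : Carrier → Carrier
    slope y with (y + - x) ≟ 0#
    -- A default at `y = x`, a point that does not recur in `xs`.
    ... | yes _  = 0#
    ... | no  ne = (b y + - b x) * proj₁ (inverse (y + - x) ne)
  ... | g , lg , hg = mulLin (b x) x g , trans (length-mulLin (b x) x g) (cong suc lg) , val
    where
    val : ∀ {y} → y ∈ x ∷ xs → ev (mulLin (b x) x g) y ≡ b y
    val (here refl) = eval-mulLin-root (b x) x g
    val {y} (there y∈) with (y + - x) ≟ 0# | hg y∈
    ... | yes z | _ = contradiction (sym (x-y≡0⇒x≡y z)) (All.lookup x∉ y∈)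
    ... | no ne | e = trans (eval-mulLin (b x) x g y) (trans (cong (λ v → b x + (y + - x) * v) e)
      (trans (cong (b x +_) (trans
        (F.solve 3 (λ u v w → u F.:* (v F.:* w) F.:= v F.:* (u F.:* w)) refl (y + - x) (b y + - b x) _)
        (trans (cong ((b y + - b x) *_) (proj₂ (inverse (y + - x) ne))) (*-identityʳ _))))
        (F.solve 2 (λ a b → b F.:+ (a F.:+ F.:- b) F.:= a) refl (b y) (b x))))

  pow : Carrier → ℕ → Carrier
  pow x zero    = 1#
  pow x (suc n) = x * pow x n

  eval-++ : ∀ f g x → ev (f ++ g) x ≡ ev f x + pow x (length f) * ev g x
  eval-++ []      g x = sym (trans (+-identityˡ _) (*-identityˡ _))
  eval-++ (a ∷ f) g x = trans (cong (λ e → a + x * e) (eval-++ f g x))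
    (F.solve 5 (λ a x f p g → a F.:+ x F.:* (f F.:+ p F.:* g) F.:= a F.:+ x F.:* f F.:+ x F.:* p F.:* g)
      refl a x (ev f x) (pow x (length f)) (ev g x))

  words : ℕ → List Monic
  words n = map toList (vectors elements n)

  words-unique : ∀ n → Unique (words n)
  words-unique n = Unique.map⁺ toList-injective′ (vectors-unique n elements-unique)
    where
    toList-injective′ : ∀ {n} {v w : Vec Carrier n} → toList v ≡ toList w → v ≡ w
    toList-injective′ {v = []}    {[]}    e    = refl
    toList-injective′ {v = x ∷ v} {y ∷ w} e =
      cong₂ _∷_ (∷-injectiveˡ e) (toList-injective′ (∷-injectiveʳ e))

  ∈-words : ∀ {n} f → length f ≡ n → f ∈ words n
  ∈-words f refl = subst (_∈ words (length f)) (toList∘fromList f)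
    (∈-map⁺ toList (∈-vectors-complete ∈-elements (Vec.fromList f)))

  length-∈-words : ∀ {n f} → f ∈ words n → length f ≡ n
  length-∈-words f∈ with ∈-map⁻ toList f∈
  ... | v , _ , refl = length-toList v

  length-words : ∀ n → length (words n) ≡ q ℕ.^ n
  length-words n = trans (length-map toList (vectors elements n))
    (trans (length-vectors elements n) (cong (ℕ._^ n) length-elements))

  -- The monic polynomials of degree n − i, none if i > n.
  words↓ : ℕ → ℕ → List Monic
  words↓ n       zero    = words n
  words↓ zero    (suc i) = []
  words↓ (suc n) (suc i) = words↓ n i

  words↓-unique : ∀ n i → Unique (words↓ n i)
  words↓-unique n       zero    = words-unique n
  words↓-unique zero    (suc i) = []
  words↓-unique (suc n) (suc i) = words↓-unique n i

  ∈-words↓ : ∀ n i f → i ℕ.+ length f ≡ n → f ∈ words↓ n i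
  ∈-words↓ n       zero    f e = ∈-words f e
  ∈-words↓ (suc n) (suc i) f e = ∈-words↓ n i f (ℕ.suc-injective e)

  length-∈-words↓ : ∀ n i {f} → f ∈ words↓ n i → i ℕ.+ length f ≡ n
  length-∈-words↓ n       zero    f∈ = length-∈-words f∈
  length-∈-words↓ (suc n) (suc i) f∈ = cong suc (length-∈-words↓ n i f∈)

  infix 4 _≟ᵐ_ _≟ᵛ_ _∣?_
  _≟ᵐ_ : DecidableEquality Monic
  _≟ᵐ_ = List-≡-dec _≟_

  _≟ᵛ_ : ∀ {n} → DecidableEquality (Vec Carrier n)
  _≟ᵛ_ = Vec-≡-dec _≟_

  _∣?_ : B.Decidable _∣_
  f ∣? g with any? (λ h → g ≟ᵐ h ⊗ f) (words (length g ℕ.∸ length f))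
  ... | yes some = yes (let h , _ , e = find some in h , e)
  ... | no  none = no λ { (h , e) → none (lose (∈-words h (sym (trans
    (cong (ℕ._∸ length f) (trans (cong length e) (length-⊗ h f))) (ℕ.m+n∸n≡m (length h) (length f))))) e) }

  points : Vec Carrier q
  points = Vec.tabulate to

  vals : List Carrier → Vec Carrier q
  vals f = Vec.map (ev f) points

  lookup-vals : ∀ f i → Vec.lookup (vals f) i ≡ ev f (to i)
  lookup-vals f i = trans (lookup-map i (ev f) points) (cong (ev f) (lookup∘tabulate to i))

  vals-intro : ∀ f b → (∀ i → ev f (to i) ≡ Vec.lookup b i) → vals f ≡ b
  vals-intro f b h = trans (sym (tabulate-∘ (ev f) to)) (trans (tabulate-cong h) (tabulate∘lookup b))

  vals-elim : ∀ f g → vals f ≡ vals g → ∀ x → ev f x ≡ ev g x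
  vals-elim f g e x = subst (λ x → ev f x ≡ ev g x) (strictlyInverseˡ x)
    (trans (sym (lookup-vals f (from x))) (trans (cong (λ v → Vec.lookup v (from x)) e) (lookup-vals g (from x))))

  eval-⊗ : ∀ f g x → ev (mono (f ⊗ g)) x ≡ ev (mono f) x * ev (mono g) x
  eval-⊗ f g x = trans (eval-cong (mono (f ⊗ g)) (mono f ⊠ mono g) (mono-⊗ f g) x)
    (eval-⊠ (mono f) (mono g) x)

  vals-⊗ : ∀ f g → vals (mono (f ⊗ g)) ≡ Vec.zipWith _*_ (vals (mono f)) (vals (mono g))
  vals-⊗ f g = go points
    where
    go : ∀ {n} (xs : Vec Carrier n) → Vec.map (ev (mono (f ⊗ g))) xs ≡
      Vec.zipWith _*_ (Vec.map (ev (mono f)) xs) (Vec.map (ev (mono g)) xs)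
    go []       = refl
    go (x ∷ xs) = cong₂ _∷_ (eval-⊗ f g x) (go xs)

  NonZeros : ∀ {n} → Vec Carrier n → Set
  NonZeros = VAll.All (_≢ 0#)

  quotient : ∀ {n} {b c : Vec Carrier n} → NonZeros b → NonZeros c →
    ∃[ a ] (NonZeros a × Vec.zipWith _*_ a c ≡ b)
  quotient []       []       = [] , [] , refl
  quotient {b = x ∷ _} {y ∷ _} (x≢0 ∷ p) (y≢0 ∷ r) with quotient p r | inverse y y≢0
  ... | a , a≢0 , e | z , yz≡1 = x * z ∷ a , (λ xz≡0 → x≢0 (trans (sym xzy) (trans (cong (_* y) xz≡0) (zeroˡ y)))) ∷ a≢0 ,
    cong₂ _∷_ xzy e
    where
    xzy : x * z * y ≡ x
    xzy = trans (*-assoc x z y) (trans (cong (x *_) (trans (*-comm z y) yz≡1)) (*-identityʳ x))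

  zipWith-*-cancelʳ : ∀ {n} {a b c : Vec Carrier n} → NonZeros c →
    Vec.zipWith _*_ a c ≡ Vec.zipWith _*_ b c → a ≡ b
  zipWith-*-cancelʳ {a = []}    {[]}    []        e = refl
  zipWith-*-cancelʳ {a = x ∷ a} {y ∷ b} (z≢0 ∷ r) e =
    cong₂ _∷_ (*-cancelʳ-nonzero z≢0 (Vec.∷-injectiveˡ e)) (zipWith-*-cancelʳ r (Vec.∷-injectiveʳ e))

  -- Monic polynomials with prescribed values

  withValues : ℕ → ℕ → Vec Carrier q → ℕ
  withValues n i b = count (λ f → vals (mono f) ≟ᵛ b) (words↓ n i)

  withValues-0 : ∀ n i b → n < i → withValues n i b ≡ 0
  withValues-0 zero    (suc i) b _       = refl
  withValues-0 (suc n) (suc i) b (s≤s p) = withValues-0 n i b p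

  -- Subtracting the common upper part, formed by `h` and the leading one, leaves two polynomials
  -- with at most `q` coefficients and the same values at all `q` points.
  agree-mono : ∀ f g h → length f ≡ length g → length f ≤ q →
    vals (mono (f ++ h)) ≡ vals (mono (g ++ h)) → f ≡ g
  agree-mono f g h e l v = agree elements-unique f g e (ℕ.≤-trans l (ℕ.≤-reflexive (sym length-elements)))
    λ {x} _ → +-cancelʳ-≡ (trans (sym (expand f x)) (trans (vals-elim (mono (f ++ h)) (mono (g ++ h)) v x) (trans (expand g x)
      (cong (λ n → ev g x + pow x n * ev (mono h) x) (sym e)))))
    where
    expand : ∀ f x → ev (mono (f ++ h)) x ≡ ev f x + pow x (length f) * ev (mono h) x
    expand f x = trans (cong (λ l → ev l x) (++-assoc f h (1# ∷ []))) (eval-++ f (mono h) x)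
    +-cancelʳ-≡ : ∀ {x y z} → x + z ≡ y + z → x ≡ y
    +-cancelʳ-≡ {x} {y} {z} e = trans (undo x) (trans (cong (_+ - z) e) (sym (undo y)))
      where
      undo : ∀ x → x ≡ x + z + - z
      undo x = F.solve 2 (λ x z → x F.:= x F.:+ z F.:+ F.:- z) refl x z

  -- In degree at most `q` there are at most `q` free coefficients, and the values determine them.
  -- The boundary degree `q` is also covered by `withValues-exact` with `j = 0`.
  withValues-≤1 : ∀ n i b → n ≤ i ℕ.+ q → withValues n i b ≤ 1
  withValues-≤1 n i b n≤ = ℕ.≤-trans
    (rel-length (λ _ _ → ⊤) {ys = tt ∷ []} (Unique.filter⁺ P? (words↓-unique n i))
      (λ _ → tt , here refl , tt) (λ {f} {g} {y} → inj {f} {g} {y})) ℕ.≤-refl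
    where
    P? : Decidable (λ f → vals (mono f) ≡ b)
    P? f = vals (mono f) ≟ᵛ b
    inj : ∀ {f g} {y : ⊤} → f ∈ filter P? (words↓ n i) → g ∈ filter P? (words↓ n i) → ⊤ → ⊤ → f ≡ g
    inj {f} {g} f∈ g∈ _ _ with ∈-filter⁻ P? {xs = words↓ n i} f∈ | ∈-filter⁻ P? {xs = words↓ n i} g∈
    ... | f∈w , vf | g∈w , vg = agree-mono f g [] (ℕ.+-cancelˡ-≡ i _ _ (trans lf (sym lg)))
      (ℕ.+-cancelˡ-≤ i _ _ (ℕ.≤-trans (ℕ.≤-reflexive lf) n≤))
      (trans (cong (vals ∘ mono) (++-identityʳ f)) (trans (trans vf (sym vg)) (cong (vals ∘ mono) (sym (++-identityʳ g)))))
      where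
      lf = length-∈-words↓ n i f∈w
      lg = length-∈-words↓ n i g∈w

  -- Of the `q + j` free coefficients the upper `j`, the list `h`, are arbitrary, and the lower `q`
  -- are then fixed by interpolation. `Split` relates a polynomial to its upper block.
  withValues-exact : ∀ n i j b → i ℕ.+ (q ℕ.+ j) ≡ n → withValues n i b ≡ q ℕ.^ j
  withValues-exact n i j b n≡ = trans (ℕ.≤-antisym upper lower) (length-words j)
    where
    P? : Decidable (λ f → vals (mono f) ≡ b)
    P? f = vals (mono f) ≟ᵛ b
    Split : Monic → Monic → Set
    Split f h = ∃[ l ] (length l ≡ q × f ≡ l ++ h)
    upper : withValues n i b ≤ length (words j)
    upper = rel-length Split (Unique.filter⁺ P? (words↓-unique n i)) tot inj
      where
      tot : ∀ {f} → f ∈ filter P? (words↓ n i) → ∃[ h ] (h ∈ words j × Split f h)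
      tot {f} f∈ = drop q f , ∈-words (drop q f) (trans (length-drop q f) (trans (cong (ℕ._∸ q) lf) (ℕ.m+n∸m≡n q j))) ,
        take q f , trans (length-take q f) (trans (cong (q ℕ.⊓_) lf) (ℕ.m≤n⇒m⊓n≡m (ℕ.m≤m+n q j))) ,
        sym (take++drop≡id q f)
        where
        lf : length f ≡ q ℕ.+ j
        lf = ℕ.+-cancelˡ-≡ i _ _ (trans (length-∈-words↓ n i (proj₁ (∈-filter⁻ P? f∈))) (sym n≡))
      inj : ∀ {f g h} → f ∈ filter P? (words↓ n i) → g ∈ filter P? (words↓ n i) →
        Split f h → Split g h → f ≡ g
      inj {h = h} f∈ g∈ (l , ll , refl) (m , lm , refl) = cong (_++ h)
        (agree-mono l m h (trans ll (sym lm)) (ℕ.≤-reflexive ll)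
          (trans (proj₂ (∈-filter⁻ P? {xs = words↓ n i} f∈)) (sym (proj₂ (∈-filter⁻ P? {xs = words↓ n i} g∈)))))
    lower : length (words j) ≤ withValues n i b
    lower = rel-length (λ h f → Split f h) (words-unique j) tot inj
      where
      tot : ∀ {h} → h ∈ words j → ∃[ f ] (f ∈ filter P? (words↓ n i) × Split f h)
      -- The lower block has to supply what `x^q · h(x)` leaves of the prescribed value.
      tot {h} h∈ with interpolate elements-unique (λ x → Vec.lookup b (from x) + - (pow x q * ev (mono h) x))
      ... | l , ll , hl = l ++ h , ∈-filter⁺ P? (∈-words↓ n i (l ++ h)
          (trans (cong (i ℕ.+_) (trans (length-++ l) (cong₂ ℕ._+_ ll′ (length-∈-words h∈)))) n≡))
          (vals-intro (mono (l ++ h)) b λ k → trans (cong (λ f → ev f (to k)) (++-assoc l h (1# ∷ [])))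
            (trans (eval-++ l (mono h) (to k)) (trans
              (cong₂ (λ e n → e + pow (to k) n * ev (mono h) (to k)) (hl (∈-elements (to k))) ll′)
              (trans (F.solve 2 (λ b p → b F.:+ F.:- p F.:+ p F.:= b) refl _ (pow (to k) q * ev (mono h) (to k)))
                (cong (Vec.lookup b) (strictlyInverseʳ k)))))) ,
        l , ll′ , refl
        where
        ll′ : length l ≡ q
        ll′ = trans ll length-elements
      inj : ∀ {h h′ f} → h ∈ words j → h′ ∈ words j → Split f h → Split f h′ → h ≡ h′
      inj {h} {h′} _ _ (l , ll , refl) (m , lm , e) = go l m (trans ll (sym lm)) e
        where
        go : ∀ l m → length l ≡ length m → l ++ h ≡ m ++ h′ → h ≡ h′
        go []      []      _ e = e
        go (x ∷ l) (y ∷ m) s e = go l m (ℕ.suc-injective s) (∷-injectiveʳ e)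

-- The sieve

module Sieve {q : ℕ} (𝔽 : FiniteField q) (3≤q : 3 ≤ q) where
  open Values 𝔽 public

  1≤q^ : ∀ n → 1 ≤ q ℕ.^ n
  1≤q^ zero    = ℕ.≤-refl
  1≤q^ (suc n) = ℕ.*-mono-≤ (ℕ.≤-trans (s≤s z≤n) 3≤q) (1≤q^ n)

  q^-mono : ∀ {m n} → m ≤ n → q ℕ.^ m ≤ q ℕ.^ n
  q^-mono = ℕ.^-monoʳ-≤ q {{ℕ.>-nonZero (ℕ.≤-trans (s≤s z≤n) 3≤q)}}

  below : ℕ → List Monic
  below zero    = []
  below (suc n) = words n ++ below n

  ∈-below : ∀ n f → length f < n → f ∈ below n
  ∈-below (suc n) f (s≤s p) with ℕ.m≤n⇒m<n∨m≡n p
  ... | inj₁ lt = ∈-++⁺ʳ (words n) (∈-below n f lt)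
  ... | inj₂ eq = ∈-++⁺ˡ (∈-words f eq)

  -- The geometric sum `(q^n − 1)/(q − 1)` is less than `q^n / 2` because `q ≥ 3`. The same factor
  -- two later leaves at least half of the monic polynomials square-free.
  2*below< : ∀ n → 2 ℕ.* length (below n) < q ℕ.^ n
  2*below< zero    = s≤s z≤n
  2*below< (suc n) = begin-strict
    2 ℕ.* length (words n ++ below n)           ≡⟨ cong (2 ℕ.*_) (length-++ (words n)) ⟩
    2 ℕ.* (length (words n) ℕ.+ length (below n)) ≡⟨ ℕ.*-distribˡ-+ 2 (length (words n)) _ ⟩
    2 ℕ.* length (words n) ℕ.+ 2 ℕ.* length (below n) ≡⟨ cong (λ l → 2 ℕ.* l ℕ.+ 2 ℕ.* length (below n)) (length-words n) ⟩
    2 ℕ.* q ℕ.^ n ℕ.+ 2 ℕ.* length (below n)    <⟨ ℕ.+-monoʳ-< (2 ℕ.* q ℕ.^ n) (2*below< n) ⟩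
    2 ℕ.* q ℕ.^ n ℕ.+ q ℕ.^ n                   ≡⟨ solve 1 (λ x → con 2 :* x :+ x := con 3 :* x) refl (q ℕ.^ n) ⟩
    3 ℕ.* q ℕ.^ n                               ≤⟨ ℕ.*-monoˡ-≤ (q ℕ.^ n) 3≤q ⟩
    q ℕ.* q ℕ.^ n                               ∎
    where
    open ℕ.≤-Reasoning
    open +-*-Solver

  length-below-suc : ∀ n → length (below (suc n)) ≤ 2 ℕ.* q ℕ.^ n
  length-below-suc n = begin
    length (words n ++ below n)           ≡⟨ length-++ (words n) ⟩
    length (words n) ℕ.+ length (below n) ≤⟨ ℕ.+-mono-≤ (ℕ.≤-reflexive (length-words n))
                                              (ℕ.≤-trans (ℕ.m≤m+n _ _) (ℕ.<⇒≤ (2*below< n))) ⟩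
    q ℕ.^ n ℕ.+ q ℕ.^ n                   ≡⟨ solve 1 (λ x → x :+ x := con 2 :* x) refl (q ℕ.^ n) ⟩
    2 ℕ.* q ℕ.^ n                         ∎
    where
    open ℕ.≤-Reasoning
    open +-*-Solver

  -- Irreducible factors

  ProperFactor : Monic → Monic → Set
  ProperFactor p g = 1 ≤ length g × length g < length p × g ∣ p

  properFactor? : ∀ p → Dec (∃[ g ] ProperFactor p g)
  properFactor? p with any? (λ g → (1 ℕ.≤? length g) ×-dec ((length g ℕ.<? length p) ×-dec (g ∣? p))) (below (length p))
  ... | yes some = yes (let g , _ , h = find some in g , h)
  ... | no  none = no λ { (g , h) → none (lose (∈-below (length p) g (proj₁ (proj₂ h))) h) }

  no-factor⇒irreducible : ∀ {p} → 1 ≤ length p → ¬ (∃[ g ] ProperFactor p g) → Irreducible p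
  no-factor⇒irreducible {p} 1≤p none = 1≤p , λ g h e → go g h e (length g) refl
    where
    go : ∀ g h → h ⊗ g ≡ p → ∀ n → length g ≡ n → length g ≡ 0 ⊎ length h ≡ 0
    go g h e zero    lg = inj₁ lg
    go g []      e (suc n) lg = inj₂ refl
    go g (x ∷ h) e (suc n) lg = contradiction
      (g , ℕ.≤-trans (s≤s z≤n) (ℕ.≤-reflexive (sym lg)) ,
       ℕ.≤-trans (s≤s (ℕ.m≤n+m (length g) (length h)))
         (ℕ.≤-reflexive (trans (sym (length-⊗ (x ∷ h) g)) (cong length e))) ,
       (x ∷ h) , sym e) none

  irreducible⇒no-factor : ∀ {p} → Irreducible p → ¬ (∃[ g ] ProperFactor p g)
  irreducible⇒no-factor {p} (_ , irr) (g , 1≤g , g<p , h , e) with irr g h (sym e)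
  ... | inj₁ g≡0 = contradiction (ℕ.≤-trans 1≤g (ℕ.≤-reflexive g≡0)) λ ()
  ... | inj₂ h≡0 = ℕ.<-irrefl (sym (trans (cong length e) (trans (length-⊗ h g) (cong (ℕ._+ length g) h≡0)))) g<p

  irreducible? : Decidable Irreducible
  irreducible? p with 1 ℕ.≤? length p | properFactor? p
  ... | yes 1≤p | no none = yes (no-factor⇒irreducible 1≤p none)
  ... | yes _   | yes some = no λ irr → irreducible⇒no-factor irr some
  ... | no 1≰p  | _        = no (1≰p ∘ proj₁)

  irreducible-factor : ∀ n f → length f ≤ n → 1 ≤ length f → ∃[ p ] (Irreducible p × p ∣ f)
  irreducible-factor n f f≤n 1≤f with properFactor? f
  irreducible-factor n       f f≤n 1≤f | no none = f , no-factor⇒irreducible 1≤f none , [] , refl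
  irreducible-factor zero    f f≤n 1≤f | yes _ = contradiction (ℕ.≤-trans 1≤f f≤n) λ ()
  irreducible-factor (suc n) f f≤n 1≤f | yes (g , 1≤g , g<f , g∣f)
    with irreducible-factor n g (ℕ.≤-pred (ℕ.≤-trans g<f f≤n)) 1≤g
  ... | p , irr , p∣g = p , irr , ∣-trans {p} {g} {f} p∣g g∣f

  irreducible-∤ : ∀ {p r} → Irreducible p → Irreducible r → p ≢ r → ¬ p ∣ r
  irreducible-∤ {p} {r} (1≤p , _) (_ , irr) p≢r (h , e) with irr p h (sym e)
  ... | inj₁ p≡0 = contradiction (ℕ.≤-trans 1≤p (ℕ.≤-reflexive p≡0)) λ ()
  ... | inj₂ h≡0 = p≢r (sym (trans e (cong (_⊗ p) (length≡0 h h≡0))))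

  irreducible-∤-⊗ : ∀ {p} → Irreducible p → ∀ {a b} → ¬ p ∣ a → ¬ p ∣ b → ¬ p ∣ a ⊗ b
  irreducible-∤-⊗ irr {a} {b} p∤a p∤b p∣ab with euclid irr a b p∣ab
  ... | inj₁ p∣a = p∤a p∣a
  ... | inj₂ p∣b = p∤b p∣b

  irreducible-∤-[] : ∀ {p} → Irreducible p → ¬ p ∣ []
  irreducible-∤-[] {p} (1≤p , _) p∣1 = contradiction (ℕ.≤-trans 1≤p (∣-length {p} {[]} p∣1)) λ ()

  -- Sieving by the squares of irreducibles

  Free : List Monic → Monic → Set
  Free ps f = All (λ p → ¬ (p ⊗ p ∣ f)) ps

  free? : ∀ ps → Decidable (Free ps)
  free? ps f = all? (λ p → ¬? (p ⊗ p ∣? f)) ps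

  free-⊗⁺ : ∀ {ps} a f → All Irreducible ps → All (λ p → ¬ p ∣ a) ps → Free ps f → Free ps (a ⊗ f)
  free-⊗⁺ a f []          []           []           = []
  free-⊗⁺ a f (irr ∷ irrs) (p∤a ∷ p∤as) (free ∷ frees) =
    (free ∘ square-coprime irr a f p∤a) ∷ free-⊗⁺ a f irrs p∤as frees

  free-⊗⁻ : ∀ {ps} a f → Free ps (a ⊗ f) → Free ps f
  free-⊗⁻ a f = All.map (λ {p} free → free ∘ ∣-⊗ˡ a {p ⊗ p} {f})

  sieved? : ∀ ps b → Decidable (λ f → Free ps f × vals (mono f) ≡ b)
  sieved? ps b f = free? ps f ×-dec (vals (mono f) ≟ᵛ b)

  sieved : List Monic → ℕ → ℕ → Vec Carrier q → ℕ
  sieved ps n i b = count (sieved? ps b) (words↓ n i)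

  NonVanishing : Monic → Set
  NonVanishing p = NonZeros (vals (mono p))

  NonZeros-⊗ : ∀ {n} {b c : Vec Carrier n} → NonZeros b → NonZeros c → NonZeros (Vec.zipWith _*_ b c)
  NonZeros-⊗ {b = []}    {[]}    []      []      = []
  NonZeros-⊗ {b = x ∷ b} {y ∷ c} (p ∷ ps) (r ∷ rs) = *-nonzero p r ∷ NonZeros-⊗ ps rs

  nonVanishing-⊗ : ∀ f g → NonVanishing f → NonVanishing g → NonVanishing (f ⊗ g)
  nonVanishing-⊗ f g p r = subst NonZeros (sym (vals-⊗ f g)) (NonZeros-⊗ p r)

  double : ℕ → ℕ
  double n = n ℕ.+ n

  -- The polynomials free of the squares from `ps` are split by divisibility by `p²`. Dividing by
  -- `p²` lowers the degree by `2 deg p` and divides the values, which is reversible as `p` has no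
  -- zeros. Freeness survives in both directions, since the other irreducibles do not divide `p²`.
  sieve-step : ∀ p ps → Irreducible p → NonVanishing p → All Irreducible ps → All (λ r → p ≢ r) ps →
    ∀ n i b b′ → Vec.zipWith _*_ b′ (vals (mono (p ⊗ p))) ≡ b →
    sieved ps n i b ≡ sieved (p ∷ ps) n i b ℕ.+ sieved ps n (i ℕ.+ double (length p)) b′
  sieve-step p ps irr nv irrs p≢ n i b b′ b≡ =
    trans (count-split (sieved? ps b) (p ⊗ p ∣?_) (λ f → ¬? (p ⊗ p ∣? f)) (words↓ n i))
      (trans (ℕ.+-comm (count D? (words↓ n i)) _) (cong₂ ℕ._+_ freed (ℕ.≤-antisym upper lower)))
    where
    D? : Decidable (λ f → (Free ps f × vals (mono f) ≡ b) × p ⊗ p ∣ f)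
    D? f = sieved? ps b f ×-dec (p ⊗ p ∣? f)
    freed : count (λ f → sieved? ps b f ×-dec ¬? (p ⊗ p ∣? f)) (words↓ n i) ≡ sieved (p ∷ ps) n i b
    freed = count-cong (λ f → sieved? ps b f ×-dec ¬? (p ⊗ p ∣? f)) (sieved? (p ∷ ps) b) {words↓ n i}
      (λ { _ ((free , v) , new) → new ∷ free , v }) (λ { _ (new ∷ free , v) → (free , v) , new })
    p∤ : All (λ r → ¬ r ∣ p ⊗ p) ps
    p∤ = All.zipWith (λ { {r} (irr′ , p≢r) → irreducible-∤-⊗ irr′ (irreducible-∤ irr′ irr (p≢r ∘ sym))
                                             (irreducible-∤ irr′ irr (p≢r ∘ sym)) }) (irrs , p≢)
    Quotient : Monic → Monic → Set
    Quotient f h = f ≡ h ⊗ (p ⊗ p)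
    size : ∀ f h → Quotient f h → i ℕ.+ length f ≡ (i ℕ.+ double (length p)) ℕ.+ length h
    size f h e = trans (cong (i ℕ.+_) (trans (cong length e) (trans (length-⊗ h (p ⊗ p))
      (trans (ℕ.+-comm (length h) _) (cong (ℕ._+ length h) (length-⊗ p p)))))) (sym (ℕ.+-assoc i _ _))
    upper : count D? (words↓ n i) ≤ sieved ps n (i ℕ.+ double (length p)) b′
    upper = count-rel D? (sieved? ps b′) Quotient (words↓-unique n i)
      (λ { {f} f∈ ((free , v) , h , e) → h ,
        ∈-words↓ n _ h (trans (sym (size f h e)) (length-∈-words↓ n i f∈)) ,
        (free-⊗⁻ (p ⊗ p) h (subst (Free ps) (trans e (⊗-comm h (p ⊗ p))) free) ,
         zipWith-*-cancelʳ (nonVanishing-⊗ p p nv nv)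
           (trans (sym (vals-⊗ h (p ⊗ p))) (trans (cong (vals ∘ mono) (sym e)) (trans v (sym b≡))))) ,
        e })
      (λ _ _ e e′ → trans e (sym e′))
    lower : sieved ps n (i ℕ.+ double (length p)) b′ ≤ count D? (words↓ n i)
    lower = count-rel (sieved? ps b′) D? (λ h f → Quotient f h) (words↓-unique n (i ℕ.+ double (length p)))
      (λ { {h} h∈ (free , v) → h ⊗ (p ⊗ p) ,
        ∈-words↓ n i _ (trans (size (h ⊗ (p ⊗ p)) h refl) (length-∈-words↓ n (i ℕ.+ double (length p)) h∈)) ,
        ((subst (Free ps) (⊗-comm (p ⊗ p) h) (free-⊗⁺ (p ⊗ p) h irrs p∤ free) ,
          trans (vals-⊗ h (p ⊗ p)) (trans (cong (λ v → Vec.zipWith _*_ v _) v) b≡)) , h , refl) ,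
        refl })
      (λ _ _ e e′ → ⊗-cancelʳ (p ⊗ p) (trans (sym e) e′))

  -- The indices `g` of the inclusion-exclusion sum, without signs: the bounds of `Close` are
  -- absolute, so only the degrees of the `g` matter.
  products : List Monic → List Monic
  products []       = [] ∷ []
  products (p ∷ ps) = products ps ++ map (_⊗ p) (products ps)

  products-coprime : ∀ {p ps} → Irreducible p → All Irreducible ps → All (λ r → p ≢ r) ps →
    ∀ {g} → g ∈ products ps → ¬ p ∣ g
  products-coprime {ps = []}     irr []            []         (here refl) = irreducible-∤-[] irr
  products-coprime {ps = r ∷ ps} irr (irr′ ∷ irrs) (p≢r ∷ p≢) g∈ with ∈-++⁻ (products ps) g∈
  ... | inj₁ g∈′ = products-coprime irr irrs p≢ g∈′
  ... | inj₂ g∈′ with ∈-map⁻ (_⊗ r) g∈′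
  ... | h , h∈ , refl = irreducible-∤-⊗ irr (products-coprime irr irrs p≢ h∈) (irreducible-∤ irr irr′ p≢r)

  -- A product containing `p` cannot equal a product of other irreducibles, by Euclid's lemma.
  -- Without repetitions, the products of small degree are at most as many as all monic polynomials
  -- of small degree.
  products-unique : ∀ {ps} → Unique ps → All Irreducible ps → Unique (products ps)
  products-unique []       []           = [] ∷ []
  products-unique {p ∷ ps} (p∉ ∷ u) (irr ∷ irrs) =
    Unique.++⁺ (products-unique u irrs) (Unique.map⁺ (⊗-cancelʳ p) (products-unique u irrs)) disjoint
    where
    disjoint : ∀ {g} → ¬ (g ∈ products ps × g ∈ map (_⊗ p) (products ps))
    disjoint (g∈ , g∈′) with ∈-map⁻ (_⊗ p) g∈′
    ... | h , _ , e = products-coprime irr irrs p∉ g∈ (h , e)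

  fitting : List Monic → ℕ → ℕ → ℕ
  fitting gs n i = count (λ g → i ℕ.+ double (length g) ℕ.≤? n) gs

  -- Every `g` that fits into degree `n − i` is charged one unit, and `q^m` more if it still fits
  -- into degree `n − i − m`. These are the discrepancies allowed by `sieved-[]-close`.
  error : List Monic → ℕ → ℕ → ℕ → ℕ
  error gs n i m = q ℕ.^ m ℕ.* fitting gs n (i ℕ.+ m) ℕ.+ fitting gs n i

  fitting-∷ : ∀ p ps n i → fitting (products (p ∷ ps)) n i ≡
    fitting (products ps) n i ℕ.+ fitting (products ps) n (i ℕ.+ double (length p))
  fitting-∷ p ps n i = trans (cong length (filter-++ fits? (products ps) _))
    (trans (length-++ (filter fits? (products ps)))
    (cong (fitting (products ps) n i ℕ.+_) (trans (count-map fits? (_⊗ p) (products ps))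
      (count-cong (fits? ∘ (_⊗ p)) (λ g → (i ℕ.+ double (length p)) ℕ.+ double (length g) ℕ.≤? n) {products ps}
        (λ {g} _ → ℕ.≤-trans (ℕ.≤-reflexive (sym (size g))))
        (λ {g} _ → ℕ.≤-trans (ℕ.≤-reflexive (size g)))))))
    where
    fits? : Decidable (λ g → i ℕ.+ double (length g) ≤ n)
    fits? g = i ℕ.+ double (length g) ℕ.≤? n
    open +-*-Solver
    size : ∀ g → i ℕ.+ double (length (g ⊗ p)) ≡ (i ℕ.+ double (length p)) ℕ.+ double (length g)
    size g = trans (cong (λ l → i ℕ.+ double l) (length-⊗ g p))
      (solve 3 (λ i g p → i :+ ((g :+ p) :+ (g :+ p)) := (i :+ (p :+ p)) :+ (g :+ g)) refl i (length g) (length p))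

  -- The errors satisfy the recursion of `sieve-step` with the minus sign turned into a plus, as
  -- `close-cancel` demands.
  error-∷ : ∀ p ps n i m → error (products (p ∷ ps)) n i m ≡
    error (products ps) n i m ℕ.+ error (products ps) n (i ℕ.+ double (length p)) m
  error-∷ p ps n i m = trans (cong₂ (λ x y → q ℕ.^ m ℕ.* x ℕ.+ y) (fitting-∷ p ps n (i ℕ.+ m)) (fitting-∷ p ps n i))
    (trans (cong (λ k → q ℕ.^ m ℕ.* (fitting gs n (i ℕ.+ m) ℕ.+ fitting gs n k) ℕ.+ fitting2) (swap i m (double (length p))))
      (solve 5 (λ Q a b c d → Q :* (a :+ b) :+ (c :+ d) := (Q :* a :+ c) :+ (Q :* b :+ d)) refl
        (q ℕ.^ m) (fitting gs n (i ℕ.+ m)) (fitting gs n (i ℕ.+ double (length p) ℕ.+ m)) (fitting gs n i) (fitting gs n (i ℕ.+ double (length p)))))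
    where
    gs = products ps
    fitting2 = fitting gs n i ℕ.+ fitting gs n (i ℕ.+ double (length p))
    open +-*-Solver
    swap : ∀ a b c → a ℕ.+ b ℕ.+ c ≡ a ℕ.+ c ℕ.+ b
    swap = solve 3 (λ a b c → a :+ b :+ c := a :+ c :+ b) refl

  -- Four ranges of the degree `D = n − i`. For `D < 0` both counts vanish. For `0 ≤ D < m` the
  -- second vanishes and the first is at most one, since `m ≤ q`. For `m ≤ D ≤ m + q` both sides are
  -- at most `q^m`. Beyond that the exact counts agree, the factor `q^m` making up for the `m` lost
  -- degrees.
  sieved-[]-close : ∀ n i m b b′ → m ≤ q →
    Close (sieved [] n i b) (q ℕ.^ m ℕ.* sieved [] n (i ℕ.+ m) b′) (error ([] ∷ []) n i m)
  sieved-[]-close n i m b b′ m≤q =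
    ≡.subst₂ (λ x y → Close x (q ℕ.^ m ℕ.* y) (error ([] ∷ []) n i m)) (unsieved i b) (unsieved (i ℕ.+ m) b′)
      (cases (n ℕ.<? i) (n ℕ.<? i ℕ.+ m) (n ℕ.≤? i ℕ.+ m ℕ.+ q))
    where
    unsieved : ∀ i b → withValues n i b ≡ sieved [] n i b
    unsieved i b = count-cong (λ f → vals (mono f) ≟ᵛ b) (sieved? [] b) {words↓ n i} (λ _ v → [] , v) (λ _ → proj₂)
    fitting-1 : ∀ i → ¬ (n < i) → fitting ([] ∷ []) n i ≡ 1
    fitting-1 i n≮i = cong length (filter-accept (λ g → i ℕ.+ double (length g) ℕ.≤? n)
      (ℕ.≤-trans (ℕ.≤-reflexive (ℕ.+-identityʳ i)) (ℕ.≮⇒≥ n≮i)))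
    small : ¬ (n < i) → n ≤ i ℕ.+ m ℕ.+ q → withValues n i b ≤ q ℕ.^ m
    small n≮i n≤ with n ℕ.≤? i ℕ.+ q
    ... | yes n≤i+q = ℕ.≤-trans (withValues-≤1 n i b n≤i+q) (1≤q^ m)
    ... | no  n≰i+q with ℕ.m≤n⇒∃[o]m+o≡n (ℕ.<⇒≤ (ℕ.≰⇒> n≰i+q))
    ... | j , e = ℕ.≤-trans (ℕ.≤-reflexive (withValues-exact n i j b (trans (sym (ℕ.+-assoc i q j)) e)))
      (q^-mono (ℕ.+-cancelˡ-≤ (i ℕ.+ q) j m (ℕ.≤-trans (ℕ.≤-reflexive e) (ℕ.≤-trans n≤
        (ℕ.≤-reflexive (solve 3 (λ i m q → i :+ m :+ q := i :+ q :+ m) refl i m q))))))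
      where open +-*-Solver
    cases : Dec (n < i) → Dec (n < i ℕ.+ m) → Dec (n ≤ i ℕ.+ m ℕ.+ q) →
      Close (withValues n i b) (q ℕ.^ m ℕ.* withValues n (i ℕ.+ m) b′) (error ([] ∷ []) n i m)
    cases (yes n<i) _ _
      rewrite withValues-0 n i b n<i
            | withValues-0 n (i ℕ.+ m) b′ (ℕ.<-≤-trans n<i (ℕ.m≤m+n i m)) | ℕ.*-zeroʳ (q ℕ.^ m) = z≤n , z≤n
    cases (no n≮i) (yes n<i+m) _
      rewrite withValues-0 n (i ℕ.+ m) b′ n<i+m | ℕ.*-zeroʳ (q ℕ.^ m) | fitting-1 i n≮i =
      ℕ.≤-trans (withValues-≤1 n i b (ℕ.<⇒≤ (ℕ.<-≤-trans n<i+m (ℕ.+-monoʳ-≤ i m≤q)))) (ℕ.m≤n+m 1 _) , z≤n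
    cases (no n≮i) (no n≮i+m) (yes n≤) rewrite fitting-1 i n≮i | fitting-1 (i ℕ.+ m) n≮i+m | ℕ.*-identityʳ (q ℕ.^ m) =
      ℕ.≤-trans (small n≮i n≤) (ℕ.≤-trans (ℕ.m≤m+n _ 1) (ℕ.m≤n+m _ (q ℕ.^ m ℕ.* withValues n (i ℕ.+ m) b′))) ,
      ℕ.≤-trans (ℕ.*-monoʳ-≤ (q ℕ.^ m) (withValues-≤1 n (i ℕ.+ m) b′ n≤))
        (ℕ.≤-trans (ℕ.≤-reflexive (ℕ.*-identityʳ _)) (ℕ.≤-trans (ℕ.m≤m+n _ 1) (ℕ.m≤n+m _ (withValues n i b))))
    cases (no _) (no _) (no n≰) with ℕ.m≤n⇒∃[o]m+o≡n (ℕ.<⇒≤ (ℕ.≰⇒> n≰))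
    ... | j , e = subst (λ x → Close (withValues n i b) x (error ([] ∷ []) n i m)) equal
        (ℕ.m≤m+n _ _ , ℕ.m≤m+n _ _)
      where
      open +-*-Solver
      equal : withValues n i b ≡ q ℕ.^ m ℕ.* withValues n (i ℕ.+ m) b′
      equal = trans (withValues-exact n i (m ℕ.+ j) b (trans
          (solve 4 (λ i m q j → i :+ (q :+ (m :+ j)) := i :+ m :+ q :+ j) refl i m q j) e))
        (trans (ℕ.^-distribˡ-+-* q m j)
          (cong (q ℕ.^ m ℕ.*_) (sym (withValues-exact n (i ℕ.+ m) j b′ (trans (sym (ℕ.+-assoc (i ℕ.+ m) q j)) e)))))

  -- Induction over the sieving irreducibles. The vectors `b` and `b′` are arbitrary and unrelated
  -- and `i` is general, which keeps the induction closed when both vectors are divided by `p²` and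
  -- the degree drops.
  sieved-close : ∀ ps → Unique ps → All Irreducible ps → All NonVanishing ps →
    ∀ n i m b b′ → m ≤ q → NonZeros b → NonZeros b′ →
    Close (sieved ps n i b) (q ℕ.^ m ℕ.* sieved ps n (i ℕ.+ m) b′) (error (products ps) n i m)
  sieved-close []       _        _            _          n i m b b′ m≤q _ _ = sieved-[]-close n i m b b′ m≤q
  sieved-close (p ∷ ps) (p∉ ∷ u) (irr ∷ irrs) (nv ∷ nvs) n i m b b′ m≤q b≢0 b′≢0
    with quotient b≢0 (nonVanishing-⊗ p p nv nv) | quotient b′≢0 (nonVanishing-⊗ p p nv nv)
  ... | c , c≢0 , c≡ | c′ , c′≢0 , c′≡ =
    subst (Close _ _) (sym (error-∷ p ps n i m))
      (close-cancel
        (≡.subst₂ (λ x y → Close x y (error (products ps) n i m))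
          (sieve-step p ps irr nv irrs p∉ n i b c c≡)
          (trans (cong (q ℕ.^ m ℕ.*_) (sieve-step p ps irr nv irrs p∉ n (i ℕ.+ m) b′ c′ c′≡))
            (trans (ℕ.*-distribˡ-+ (q ℕ.^ m) _ _)
              (cong (λ k → q ℕ.^ m ℕ.* sieved (p ∷ ps) n (i ℕ.+ m) b′ ℕ.+ q ℕ.^ m ℕ.* sieved ps n k c′)
                (solve 3 (λ a b c → a :+ b :+ c := a :+ c :+ b) refl i m (double (length p))))))
          (sieved-close ps u irrs nvs n i m b b′ m≤q b≢0 b′≢0))
        (sieved-close ps u irrs nvs n (i ℕ.+ double (length p)) m c c′ m≤q c≢0 c′≢0))
    where open +-*-Solver

  -- Adding `m + 2 deg g ≤ n` to `n + m ≤ 2L + 1` and halving gives `deg g ≤ L − m`, and at most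
  -- `2 q^(L − m)` monic polynomials have such a degree. For `m > L` nothing fits, because then
  -- `n < m`.
  fitting-bound : ∀ gs → Unique gs → ∀ n m L → n ℕ.+ m ≤ suc (double L) →
    q ℕ.^ m ℕ.* fitting gs n m ≤ 2 ℕ.* q ℕ.^ L
  fitting-bound gs u n m L nm≤ with m ℕ.≤? L
  ... | yes m≤L = begin
    q ℕ.^ m ℕ.* fitting gs n m                 ≤⟨ ℕ.*-monoʳ-≤ (q ℕ.^ m) (rel-length _≡_
                                                    (Unique.filter⁺ fits? u)
                                                    (λ {g} g∈ → g , ∈-below _ g (short {g} (proj₂ (∈-filter⁻ fits? {xs = gs} g∈))) , refl)
                                                    (λ { _ _ refl refl → refl })) ⟩
    q ℕ.^ m ℕ.* length (below (suc (L ℕ.∸ m))) ≤⟨ ℕ.*-monoʳ-≤ (q ℕ.^ m) (length-below-suc (L ℕ.∸ m)) ⟩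
    q ℕ.^ m ℕ.* (2 ℕ.* q ℕ.^ (L ℕ.∸ m))        ≡⟨ solve 2 (λ x y → x :* (con 2 :* y) := con 2 :* (x :* y)) refl (q ℕ.^ m) (q ℕ.^ (L ℕ.∸ m)) ⟩
    2 ℕ.* (q ℕ.^ m ℕ.* q ℕ.^ (L ℕ.∸ m))        ≡⟨ cong (2 ℕ.*_) (ℕ.^-distribˡ-+-* q m (L ℕ.∸ m)) ⟨
    2 ℕ.* q ℕ.^ (m ℕ.+ (L ℕ.∸ m))              ≡⟨ cong (λ k → 2 ℕ.* q ℕ.^ k) (ℕ.m+[n∸m]≡n m≤L) ⟩
    2 ℕ.* q ℕ.^ L                              ∎
    where
    open ℕ.≤-Reasoning
    open +-*-Solver
    fits? : Decidable (λ g → m ℕ.+ double (length g) ≤ n)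
    fits? g = m ℕ.+ double (length g) ℕ.≤? n
    short : ∀ {g} → m ℕ.+ double (length g) ≤ n → length g < suc (L ℕ.∸ m)
    short {g} h = s≤s (ℕ.+-cancelˡ-≤ m _ _ (ℕ.≤-trans (half (begin
      double (m ℕ.+ length g)           ≡⟨ solve 2 (λ m g → (m :+ g) :+ (m :+ g) := m :+ (g :+ g) :+ m) refl m (length g) ⟩
      m ℕ.+ double (length g) ℕ.+ m     ≤⟨ ℕ.+-monoˡ-≤ m h ⟩
      n ℕ.+ m                           ≤⟨ nm≤ ⟩
      suc (double L)                    ∎)) (ℕ.≤-reflexive (sym (ℕ.m+[n∸m]≡n m≤L)))))
      where
      half : ∀ {a b} → double a ≤ suc (double b) → a ≤ b
      half {a} {b} p = ℕ.≮⇒≥ λ b<a → ℕ.<-irrefl refl (ℕ.<-≤-trans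
        (s≤s (ℕ.≤-reflexive (sym (ℕ.+-suc b b)))) (ℕ.≤-trans (ℕ.+-mono-≤ b<a b<a) p))
  ... | no m≰L = ℕ.≤-trans (ℕ.≤-reflexive (trans (cong (q ℕ.^ m ℕ.*_) (none gs)) (ℕ.*-zeroʳ (q ℕ.^ m)))) z≤n
    where
    n<m : n < m
    n<m = ℕ.+-cancelʳ-< m n m (ℕ.≤-<-trans nm≤ (ℕ.≤-trans
      (s≤s (ℕ.≤-reflexive (sym (ℕ.+-suc L L)))) (ℕ.+-mono-≤ (ℕ.≰⇒> m≰L) (ℕ.≰⇒> m≰L))))
    none : ∀ gs → fitting gs n m ≡ 0
    none []       = refl
    none (g ∷ gs) = trans (cong length (filter-reject (λ g → m ℕ.+ double (length g) ℕ.≤? n) {g} {gs}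
      λ h → ℕ.<-irrefl refl (ℕ.<-≤-trans n<m (ℕ.≤-trans (ℕ.m≤m+n m _) h)))) (none gs)

  error-bound : ∀ gs → Unique gs → ∀ n m L → m ≤ q → n ℕ.+ q ≤ suc (double L) →
    error gs n 0 m ≤ 4 ℕ.* q ℕ.^ L
  error-bound gs u n m L m≤q nq≤ = begin
    error gs n 0 m                                 ≤⟨ ℕ.+-mono-≤
        (fitting-bound gs u n m L (ℕ.≤-trans (ℕ.+-monoʳ-≤ n m≤q) nq≤))
        (ℕ.≤-trans (ℕ.≤-reflexive (sym (ℕ.*-identityˡ _)))
          (fitting-bound gs u n 0 L (ℕ.≤-trans (ℕ.+-monoʳ-≤ n z≤n) nq≤))) ⟩
    2 ℕ.* q ℕ.^ L ℕ.+ 2 ℕ.* q ℕ.^ L                ≡⟨ solve 1 (λ x → con 2 :* x :+ con 2 :* x := con 4 :* x) refl (q ℕ.^ L) ⟩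
    4 ℕ.* q ℕ.^ L                                  ∎
    where
    open ℕ.≤-Reasoning
    open +-*-Solver

-- Quadratic characters

module Signs {q : ℕ} (𝔽 : FiniteField q) (2∤q : 2 ∤ q) where
  open Values 𝔽

  -- The character with its values kept as `Outcome`s, so that sign patterns of polynomials and
  -- sample points of the model share one type.
  sgn : Carrier → Outcome
  sgn a with a ≟ 0#
  ... | yes _ = zer
  ... | no  _ with any? (λ x → x * x ≟ a) elements
  ...   | yes _ = pos
  ...   | no  _ = neg

  value-sgn : ∀ a → value (sgn a) ≡ χ 𝔽 a
  value-sgn a with a ≟ 0#
  ... | yes _ = refl
  ... | no  _ with any? (λ x → x * x ≟ a) elements
  ...   | yes _ = refl
  ...   | no  _ = refl

  sgn-zer⁺ : ∀ {a} → a ≡ 0# → sgn a ≡ zer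
  sgn-zer⁺ {a} a≡0 with a ≟ 0#
  ... | yes _  = refl
  ... | no a≢0 = contradiction a≡0 a≢0

  sgn-zer⁻ : ∀ {a} → sgn a ≡ zer → a ≡ 0#
  sgn-zer⁻ {a} e with a ≟ 0#
  ... | yes a≡0 = a≡0
  ... | no  _ with any? (λ x → x * x ≟ a) elements
  sgn-zer⁻ {a} () | no _ | yes _
  sgn-zer⁻ {a} () | no _ | no _

  sgn-pos⁺ : ∀ {x a} → a ≢ 0# → x * x ≡ a → sgn a ≡ pos
  sgn-pos⁺ {x} {a} a≢0 e with a ≟ 0#
  ... | yes a≡0 = contradiction a≡0 a≢0
  ... | no  _ with any? (λ x → x * x ≟ a) elements
  ...   | yes _   = refl
  ...   | no none = contradiction (lose (∈-elements x) e) none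

  sgn-pos⁻ : ∀ {a} → sgn a ≡ pos → ∃[ x ] x * x ≡ a
  sgn-pos⁻ {a} e with a ≟ 0#
  sgn-pos⁻ {a} () | yes _
  ... | no  _ with any? (λ x → x * x ≟ a) elements
  ...   | yes some = let x , _ , xx≡a = find some in x , xx≡a
  sgn-pos⁻ {a} () | no _ | no _

  infix 4 _≟ᵒ_
  _≟ᵒ_ : DecidableEquality Outcome
  zer ≟ᵒ zer = yes refl
  zer ≟ᵒ pos = no λ ()
  zer ≟ᵒ neg = no λ ()
  pos ≟ᵒ zer = no λ ()
  pos ≟ᵒ pos = yes refl
  pos ≟ᵒ neg = no λ ()
  neg ≟ᵒ zer = no λ ()
  neg ≟ᵒ pos = no λ ()
  neg ≟ᵒ neg = yes refl

  nonzero? : Decidable (λ x → x ≢ 0#)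
  nonzero? x = ¬? (x ≟ 0#)

  module _ {P : Carrier → Set} (P? : Decidable P) (σ : Carrier → Carrier)
    (P-σ : ∀ {x} → P x → P (σ x)) (σσ : ∀ x → σ (σ x) ≡ x) (σ≢ : ∀ {x} → P x → σ x ≢ x) where

    -- A fixed-point-free involution splits `P` into pairs, and the order of the enumeration
    -- decidably selects one member of each. It is applied to `x ↦ x + 1` and to `x ↦ −x`.
    Lower : Carrier → Set
    Lower x = from x Fin.< from (σ x)

    lower? : Decidable Lower
    lower? x = from x Fin.<? from (σ x)

    from-injective : ∀ {x y} → from x ≡ from y → x ≡ y
    from-injective {x} {y} e = trans (sym (strictlyInverseˡ x)) (trans (cong to e) (strictlyInverseˡ y))

    σ-lower : ∀ {x} → P x → ¬ Lower x → Lower (σ x)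
    σ-lower {x} p ¬l with Fin.<-cmp (from x) (from (σ x))
    ... | tri< l _ _ = contradiction l ¬l
    ... | tri≈ _ e _ = contradiction (sym (from-injective e)) (σ≢ p)
    ... | tri> _ _ g = subst (λ y → from (σ x) Fin.< from y) (sym (σσ x)) g

    σ-upper : ∀ {x} → Lower x → ¬ Lower (σ x)
    σ-upper {x} l l′ = Fin.<-asym l (subst (λ y → from (σ x) Fin.< from y) (σσ x) l′)

    half : ℕ
    half = count (λ x → P? x ×-dec lower? x) elements

    count-involution : count P? elements ≡ half ℕ.+ half
    count-involution = trans (count-split P? lower? (λ x → ¬? (lower? x)) elements)
      (cong (half ℕ.+_) (ℕ.≤-antisym
        (count-rel upper? lowerP? (λ x y → y ≡ σ x) elements-unique
          (λ { {x} _ (p , ¬l) → σ x , ∈-elements _ , (P-σ p , σ-lower p ¬l) , refl })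
          (λ {x} {x′} _ _ → σ-injective))
        (count-rel lowerP? upper? (λ x y → y ≡ σ x) elements-unique
          (λ { {x} _ (p , l) → σ x , ∈-elements _ , (P-σ p , σ-upper l) , refl })
          (λ {x} {x′} _ _ → σ-injective))))
      where
      upper? lowerP? : Decidable _
      upper? x  = P? x ×-dec ¬? (lower? x)
      lowerP? x = P? x ×-dec lower? x
      σ-injective : ∀ {x x′ y} → y ≡ σ x → y ≡ σ x′ → x ≡ x′
      σ-injective {x} {x′} e e′ = trans (sym (σσ x)) (trans (cong σ (trans (sym e) e′)) (σσ x′))

  count-all : ∀ {A : Set} (xs : List A) → count (λ _ → yes tt) xs ≡ length xs
  count-all []       = refl
  count-all (x ∷ xs) = cong suc (count-all xs)

  -- In characteristic 2, x ↦ x + 1 would pair off the elements.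
  1+1≢0 : 1# + 1# ≢ 0#
  1+1≢0 e = 2∤q (divides h (trans (sym length-elements) (trans (sym (count-all elements))
    (trans (count-involution (λ _ → yes tt) (_+ 1#) _ involutive fixed-free)
      (trans (cong (h ℕ.+_) (sym (ℕ.+-identityʳ h))) (ℕ.*-comm 2 h))))))
    where
    involutive : ∀ x → x + 1# + 1# ≡ x
    involutive x = trans (+-assoc x 1# 1#) (trans (cong (x +_) e) (+-identityʳ x))
    fixed-free : ∀ {x} → ⊤ → x + 1# ≢ x
    fixed-free {x} _ e = 0≢1 (sym (trans (F.solve 2 (λ x u → u F.:= x F.:+ u F.:+ F.:- x) refl x 1#)
      (trans (cong (_+ - x) e) (-‿inverseʳ x))))
    h = half (λ _ → yes tt) (_+ 1#) _ involutive fixed-free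

  -x≢x : ∀ {x} → x ≢ 0# → - x ≢ x
  -x≢x {x} x≢0 e = *-nonzero 1+1≢0 x≢0 (trans (F.solve 2 (λ u x → (u F.:+ u) F.:* x F.:= u F.:* x F.:+ u F.:* x) refl 1# x)
    (trans (cong₂ _+_ (*-identityˡ x) (*-identityˡ x)) (trans (cong (_+ x) (sym e)) (-‿inverseˡ x))))

  -‿involutive : ∀ x → - - x ≡ x
  -‿involutive x = F.solve 1 (λ x → F.:- F.:- x F.:= x) refl x

  -x≢0 : ∀ {x} → x ≢ 0# → - x ≢ 0#
  -x≢0 {x} x≢0 e = x≢0 (trans (sym (-‿involutive x)) (trans (cong -_ e) (F.solve 0 (F.:- F.con 0ℤ F.:= F.con 0ℤ) refl)))

  count-0 : count (_≟ 0#) elements ≡ 1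
  count-0 = ℕ.≤-antisym
    (rel-length (λ x _ → x ≡ 0#) {ys = tt ∷ []} (Unique.filter⁺ (_≟ 0#) elements-unique)
      (λ x∈ → tt , here refl , proj₂ (∈-filter⁻ (_≟ 0#) {xs = elements} x∈)) (λ { _ _ refl refl → refl }))
    (rel-length {A = ⊤} (λ _ _ → ⊤) {xs = tt ∷ []} ([] ∷ [])
      (λ _ → 0# , ∈-filter⁺ (_≟ 0#) (∈-elements 0#) refl , tt) (λ _ _ _ _ → refl))

  count-nonzero : suc (count nonzero? elements) ≡ q
  count-nonzero = trans (cong (ℕ._+ count nonzero? elements) (sym count-0))
    (trans (cong₂ ℕ._+_ (count-cong (_≟ 0#) (λ x → yes tt ×-dec (x ≟ 0#)) {elements} (λ _ → tt ,_) (λ _ → proj₂))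
                        (count-cong nonzero? (λ x → yes tt ×-dec nonzero? x) {elements} (λ _ → tt ,_) (λ _ → proj₂)))
    (trans (sym (count-split (λ _ → yes tt) (_≟ 0#) nonzero? elements))
      (trans (count-all elements) length-elements)))

  count-sgn : Outcome → ℕ
  count-sgn o = count (λ a → sgn a ≟ᵒ o) elements

  square-roots : ∀ x y → x * x ≡ y * y → x ≡ y ⊎ x ≡ - y
  square-roots x y e with (x + - y) ≟ 0#
  ... | yes z = inj₁ (x-y≡0⇒x≡y z)
  ... | no nz with (x + y) ≟ 0#
  ...   | yes z = inj₂ (x-y≡0⇒x≡y (trans (cong (x +_) (-‿involutive y)) z))
  ...   | no nz′ = contradiction
    (trans (F.solve 2 (λ x y → (x F.:+ F.:- y) F.:* (x F.:+ y) F.:= x F.:* x F.:+ F.:- (y F.:* y)) refl x y)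
      (trans (cong (λ z → z + - (y * y)) e) (-‿inverseʳ (y * y)))) (*-nonzero nz nz′)

  -- Squaring is a bijection from one representative of each pair {x, −x} to the squares.
  count-pos : count nonzero? elements ≡ count-sgn pos ℕ.+ count-sgn pos
  count-pos = trans (count-involution nonzero? -_ -x≢0 -‿involutive -x≢x)
    (cong (λ h → h ℕ.+ h) (ℕ.≤-antisym
      (count-rel rep? pos? (λ x y → x * x ≡ y) elements-unique
        (λ { {x} _ (x≢0 , _) → x * x , ∈-elements _ , sgn-pos⁺ (*-nonzero x≢0 x≢0) refl , refl })
        (λ {x} {x′} (_ , l) (_ , l′) e e′ → same x x′ l l′ (trans e (sym e′))))
      (count-rel pos? rep? (λ y x → x * x ≡ y) elements-unique root (λ _ _ e e′ → trans (sym e) e′))))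
    where
    rep? : Decidable (λ x → x ≢ 0# × from x Fin.< from (- x))
    rep? x = nonzero? x ×-dec lower? nonzero? -_ -x≢0 -‿involutive -x≢x x
    pos? : Decidable (λ a → sgn a ≡ pos)
    pos? a = sgn a ≟ᵒ pos
    same : ∀ x y → from x Fin.< from (- x) → from y Fin.< from (- y) → x * x ≡ y * y → x ≡ y
    same x y l l′ e with square-roots x y e
    ... | inj₁ x≡y  = x≡y
    ... | inj₂ refl = contradiction l (σ-upper nonzero? -_ -x≢0 -‿involutive -x≢x l′)
    root : ∀ {y} → y ∈ elements → sgn y ≡ pos →
      ∃[ x ] (x ∈ elements × (x ≢ 0# × from x Fin.< from (- x)) × x * x ≡ y)
    root {y} _ e with sgn-pos⁻ e
    ... | x , xx≡y with lower? nonzero? -_ -x≢0 -‿involutive -x≢x x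
    ...   | yes l = x , ∈-elements x , (x≢0 , l) , xx≡y
      where
      x≢0 : x ≢ 0#
      x≢0 x≡0 = contradiction (trans (sym (sgn-zer⁺ (trans (sym xx≡y) (trans (cong (_* x) x≡0) (zeroˡ x))))) e) λ ()
    ...   | no ¬l = - x , ∈-elements (- x) , (-x≢0 x≢0 , σ-lower nonzero? -_ -x≢0 -‿involutive -x≢x x≢0 ¬l) ,
      trans (F.solve 1 (λ x → F.:- x F.:* F.:- x F.:= x F.:* x) refl x) xx≡y
      where
      x≢0 : x ≢ 0#
      x≢0 x≡0 = contradiction (trans (sym (sgn-zer⁺ (trans (sym xx≡y) (trans (cong (_* x) x≡0) (zeroˡ x))))) e) λ ()

  -- The nonzero squares already make up half of the nonzero elements, so the nonsquares are the
  -- other half.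
  count-neg : count nonzero? elements ≡ count-sgn neg ℕ.+ count-sgn neg
  count-neg = trans count-pos (cong (λ h → h ℕ.+ h) pos≡neg)
    where
    pos? : Decidable (λ a → sgn a ≡ pos)
    pos? a = sgn a ≟ᵒ pos
    nonzero-pos : ∀ {a} → sgn a ≡ pos → a ≢ 0#
    nonzero-pos e a≡0 = contradiction (trans (sym e) (sgn-zer⁺ a≡0)) λ ()
    nonpos : ∀ {a} → a ≢ 0# × ¬ sgn a ≡ pos → sgn a ≡ neg
    nonpos {a} (a≢0 , ne) with sgn a in eq
    ... | zer = contradiction (sgn-zer⁻ eq) a≢0
    ... | pos = contradiction refl ne
    ... | neg = refl
    neg⇒ : ∀ {a} → sgn a ≡ neg → a ≢ 0# × ¬ sgn a ≡ pos
    neg⇒ e = (λ a≡0 → contradiction (trans (sym e) (sgn-zer⁺ a≡0)) λ ()) ,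
             (λ e′ → contradiction (trans (sym e) e′) λ ())
    pos≡neg : count-sgn pos ≡ count-sgn neg
    pos≡neg = ℕ.+-cancelˡ-≡ (count-sgn pos) _ _ (trans (sym count-pos)
      (trans (count-split nonzero? pos? (λ a → ¬? (pos? a)) elements) (cong₂ ℕ._+_
        (count-cong (λ a → nonzero? a ×-dec pos? a) pos? {elements} (λ _ → proj₂) (λ _ e → nonzero-pos e , e))
        (count-cong (λ a → nonzero? a ×-dec ¬? (pos? a)) (λ a → sgn a ≟ᵒ neg) {elements}
          (λ _ → nonpos) (λ _ → neg⇒)))))

  -- Multiplication by the unit `a` permutes the field. In the application `b` is a value of the
  -- cofactor and `a` the value of the product of linear factors at the same point.
  count-sgn-* : ∀ o {a} → a ≢ 0# → count (λ b → sgn (b * a) ≟ᵒ o) elements ≡ count-sgn o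
  count-sgn-* o {a} a≢0 = ℕ.≤-antisym
    (count-rel (λ b → sgn (b * a) ≟ᵒ o) (λ b → sgn b ≟ᵒ o) (λ b c → b * a ≡ c) elements-unique
      (λ {b} _ e → b * a , ∈-elements _ , e , refl)
      (λ _ _ e e′ → *-cancelʳ-nonzero a≢0 (trans e (sym e′))))
    (count-rel (λ b → sgn b ≟ᵒ o) (λ b → sgn (b * a) ≟ᵒ o) (λ c b → b * a ≡ c) elements-unique
      (λ {c} _ e → c * a⁻¹ , ∈-elements _ , trans (cong sgn (undo c)) e , undo c)
      (λ _ _ e e′ → trans (sym e) e′))
    where
    a⁻¹ = proj₁ (inverse a a≢0)
    undo : ∀ c → c * a⁻¹ * a ≡ c
    undo c = trans (*-assoc c a⁻¹ a) (trans (cong (c *_) (trans (*-comm a⁻¹ a) (proj₂ (inverse a a≢0)))) (*-identityʳ c))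

-- Zeros and square factors

module Patterns {q : ℕ} (𝔽 : FiniteField q) (3≤q : 3 ≤ q) (2∤q : 2 ∤ q) where
  open Sieve 𝔽 3≤q
  open Signs 𝔽 2∤q

  points-unique : UniqueVec points
  points-unique = UniqueVec.tabulate⁺
    λ {i} {j} e → trans (sym (strictlyInverseʳ i)) (trans (cong from e) (strictlyInverseʳ j))

  on-points : ∀ {P : Carrier → Set} → VAll.All P points → ∀ x → P x
  on-points {P} ps x = subst P (trans (lookup∘tabulate to (from x)) (strictlyInverseˡ x)) (VAll.lookup⁺ ps (from x))

  lin : Carrier → Monic
  lin x = - x ∷ []

  eval-lin : ∀ x y → ev (mono (lin x)) y ≡ y + - x
  eval-lin x y = trans (F.solve 3 (λ x y u → F.:- x F.:+ y F.:* (u F.:+ y F.:* F.con 0ℤ) F.:= y F.:* u F.:+ F.:- x) refl x y 1#)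
    (cong (_+ - x) (*-identityʳ y))

  lin-irreducible : ∀ x → Irreducible (lin x)
  lin-irreducible x = s≤s z≤n , λ g h e → go g h (trans (sym (length-⊗ h g)) (cong length e))
    where
    go : ∀ (g h : Monic) → length h ℕ.+ length g ≡ 1 → length g ≡ 0 ⊎ length h ≡ 0
    go []      h       e = inj₁ refl
    go (a ∷ g) []      e = inj₂ refl
    go (a ∷ g) (b ∷ h) e = contradiction (trans (sym (ℕ.+-suc (length h) (length g))) (ℕ.suc-injective e)) λ ()

  -- The remainder modulo `X − x` is a constant, and evaluation at `x` shows that it is zero.
  root⇒lin∣ : ∀ f x → ev (mono f) x ≡ 0# → lin x ∣ f
  root⇒lin∣ f x fx≡0 with divide (lin x) (mono f)
  ... | u , c ∷ [] , _ , f≋ = monic-quotient u (lin x) f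
    (≋-sym (≋-trans f≋ (≋-trans (⊞-cong ≋-refl (≋-trans (∷-≋ c≡0 ≋-refl) 0∷[]≋[])) (⊞-identityʳ _))))
    where
    c≡0 : c ≡ 0#
    c≡0 = trans (F.solve 3 (λ u x c → c F.:= u F.:* (x F.:+ F.:- x) F.:+ (c F.:+ x F.:* F.con 0ℤ)) refl (ev u x) x c)
      (trans (cong (λ z → ev u x * z + (c + x * 0#)) (sym (eval-lin x x)))
      (trans (cong (_+ (c + x * 0#)) (sym (eval-⊠ u (mono (lin x)) x)))
      (trans (sym (eval-⊞ (u ⊠ mono (lin x)) (c ∷ []) x))
      (trans (sym (eval-cong (mono f) _ f≋ x)) fx≡0))))

  lin∣⇒root : ∀ f x → lin x ∣ f → ev (mono f) x ≡ 0#
  lin∣⇒root f x (h , e) = trans (cong (λ g → ev (mono g) x) e) (trans (eval-⊗ h (lin x) x)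
    (trans (cong (ev (mono h) x *_) (trans (eval-lin x x) (-‿inverseʳ x))) (zeroʳ _)))

  nonVanishing⁺ : ∀ f → (∀ x → ev f x ≢ 0#) → ∀ {n} (xs : Vec Carrier n) → NonZeros (Vec.map (ev f) xs)
  nonVanishing⁺ f h []       = []
  nonVanishing⁺ f h (x ∷ xs) = h x ∷ nonVanishing⁺ f h xs

  -- A zero would split off a linear factor. All irreducibles of degree at least two thus qualify
  -- for `sieve-step`.
  irreducible⇒nonVanishing : ∀ {p} → Irreducible p → 2 ≤ length p → NonVanishing p
  irreducible⇒nonVanishing {p} (_ , irr) 2≤p = nonVanishing⁺ (mono p) (λ x px≡0 → go x (root⇒lin∣ p x px≡0)) points
    where
    go : ∀ x → ¬ lin x ∣ p
    go x (h , e) with irr (lin x) h (sym e)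
    ... | inj₁ ()
    ... | inj₂ h≡0 = ℕ.<-irrefl (sym (trans (cong length e) (trans (length-⊗ h (lin x)) (cong (ℕ._+ 1) h≡0)))) 2≤p

  zeros : ∀ {n} → Vec Outcome n → ℕ
  zeros []        = 0
  zeros (zer ∷ ω) = suc (zeros ω)
  zeros (pos ∷ ω) = zeros ω
  zeros (neg ∷ ω) = zeros ω

  -- ∏ (X − x) over the places x at which ω is zer
  vanishing : ∀ {n} → Vec Outcome n → Vec Carrier n → Monic
  vanishing []        []       = []
  vanishing (zer ∷ ω) (x ∷ xs) = vanishing ω xs ⊗ lin x
  vanishing (pos ∷ ω) (x ∷ xs) = vanishing ω xs
  vanishing (neg ∷ ω) (x ∷ xs) = vanishing ω xs

  length-vanishing : ∀ {n} (ω : Vec Outcome n) xs → length (vanishing ω xs) ≡ zeros ω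
  length-vanishing []        []       = refl
  length-vanishing (zer ∷ ω) (x ∷ xs) = trans (length-⊗ (vanishing ω xs) (lin x))
    (trans (ℕ.+-comm _ 1) (cong suc (length-vanishing ω xs)))
  length-vanishing (pos ∷ ω) (x ∷ xs) = length-vanishing ω xs
  length-vanishing (neg ∷ ω) (x ∷ xs) = length-vanishing ω xs

  zeros≤ : ∀ {n} (ω : Vec Outcome n) → zeros ω ≤ n
  zeros≤ []        = z≤n
  zeros≤ (zer ∷ ω) = s≤s (zeros≤ ω)
  zeros≤ (pos ∷ ω) = ℕ.m≤n⇒m≤1+n (zeros≤ ω)
  zeros≤ (neg ∷ ω) = ℕ.m≤n⇒m≤1+n (zeros≤ ω)

  x-y≢0 : ∀ {x y} → x ≢ y → x + - y ≢ 0#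
  x-y≢0 x≢y e = x≢y (x-y≡0⇒x≡y e)

  eval-⊗-lin : ∀ f x y → ev (mono (f ⊗ lin x)) y ≡ ev (mono f) y * (y + - x)
  eval-⊗-lin f x y = trans (eval-⊗ f (lin x) y) (cong (ev (mono f) y *_) (eval-lin x y))

  vanishing-≢0 : ∀ {n} (ω : Vec Outcome n) xs {y} → VAll.All (λ x → y ≢ x) xs → ev (mono (vanishing ω xs)) y ≢ 0#
  vanishing-≢0 []        []       {y} []           e = 0≢1 (sym (trans (sym (trans (cong (1# +_) (zeroʳ y)) (+-identityʳ 1#))) e))
  vanishing-≢0 (zer ∷ ω) (x ∷ xs) {y} (y≢x ∷ y≢) e =
    *-nonzero (vanishing-≢0 ω xs y≢) (x-y≢0 y≢x) (trans (sym (eval-⊗-lin (vanishing ω xs) x y)) e)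
  vanishing-≢0 (pos ∷ ω) (x ∷ xs) (_ ∷ y≢) e = vanishing-≢0 ω xs y≢ e
  vanishing-≢0 (neg ∷ ω) (x ∷ xs) (_ ∷ y≢) e = vanishing-≢0 ω xs y≢ e

  ZerosOf : Monic → Outcome → Carrier → Set
  ZerosOf f o x = (o ≡ zer × ev (mono f) x ≡ 0#) ⊎ (o ≢ zer × ev (mono f) x ≢ 0#)

  ZerosOf-⊗-lin : ∀ f x {n} {ω : Vec Outcome n} {ys : Vec Carrier n} → VAll.All (λ y → x ≢ y) ys →
    Pointwise (ZerosOf f) ω ys → Pointwise (ZerosOf (f ⊗ lin x)) ω ys
  ZerosOf-⊗-lin f x []          []       = []
  ZerosOf-⊗-lin f x {ys = y ∷ _} (x≢y ∷ x≢) (inj₁ (o , e) ∷ ps) =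
    inj₁ (o , trans (eval-⊗-lin f x y) (trans (cong (_* (y + - x)) e) (zeroˡ _))) ∷ ZerosOf-⊗-lin f x x≢ ps
  ZerosOf-⊗-lin f x {ys = y ∷ _} (x≢y ∷ x≢) (inj₂ (o , e) ∷ ps) =
    inj₂ (o , λ z → *-nonzero e (x-y≢0 (x≢y ∘ sym)) (trans (sym (eval-⊗-lin f x y)) z)) ∷ ZerosOf-⊗-lin f x x≢ ps

  vanishing-zeros : ∀ {n} (ω : Vec Outcome n) xs → UniqueVec xs → Pointwise (ZerosOf (vanishing ω xs)) ω xs
  vanishing-zeros []        []       []       = []
  vanishing-zeros (zer ∷ ω) (x ∷ xs) (x∉ ∷ u) =
    inj₁ (refl , trans (eval-⊗-lin (vanishing ω xs) x x) (trans (cong (ev (mono (vanishing ω xs)) x *_) (-‿inverseʳ x)) (zeroʳ _))) ∷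
    ZerosOf-⊗-lin (vanishing ω xs) x x∉ (vanishing-zeros ω xs u)
  vanishing-zeros (pos ∷ ω) (x ∷ xs) (x∉ ∷ u) = inj₂ ((λ ()) , vanishing-≢0 ω xs x∉) ∷ vanishing-zeros ω xs u
  vanishing-zeros (neg ∷ ω) (x ∷ xs) (x∉ ∷ u) = inj₂ ((λ ()) , vanishing-≢0 ω xs x∉) ∷ vanishing-zeros ω xs u

  VanishesOn : Monic → Outcome → Carrier → Set
  VanishesOn f o x = o ≡ zer → ev (mono f) x ≡ 0#

  -- Linear factors are split off one at a time; the cofactor `g` still vanishes at the remaining
  -- zeros `y`, because `y − x` is nonzero for distinct points.
  vanishing-∣ : ∀ {n} (ω : Vec Outcome n) xs → UniqueVec xs → ∀ f →
    Pointwise (VanishesOn f) ω xs → vanishing ω xs ∣ f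
  vanishing-∣ []        []       []       f []       = f , sym (⊗-identityʳ f)
  vanishing-∣ (pos ∷ ω) (x ∷ xs) (x∉ ∷ u) f (_ ∷ ps) = vanishing-∣ ω xs u f ps
  vanishing-∣ (neg ∷ ω) (x ∷ xs) (x∉ ∷ u) f (_ ∷ ps) = vanishing-∣ ω xs u f ps
  vanishing-∣ (zer ∷ ω) (x ∷ xs) (x∉ ∷ u) f (p ∷ ps) with root⇒lin∣ f x (p refl)
  ... | g , f≡ with vanishing-∣ ω xs u g (cofactor x∉ ps)
    where
    cofactor : ∀ {n} {ω : Vec Outcome n} {ys : Vec Carrier n} → VAll.All (λ y → x ≢ y) ys →
      Pointwise (VanishesOn f) ω ys → Pointwise (VanishesOn g) ω ys
    cofactor []         []       = []
    cofactor {ys = y ∷ _} (x≢y ∷ x≢) (p ∷ ps) =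
      (λ o → *-cancelʳ-nonzero (x-y≢0 (x≢y ∘ sym)) (trans (sym (eval-⊗-lin g x y))
        (trans (cong (λ f → ev (mono f) y) (sym f≡)) (trans (p o) (sym (zeroˡ _)))))) ∷ cofactor x≢ ps
  ... | h , g≡ = h , trans f≡ (trans (cong (_⊗ lin x) g≡) (⊗-assoc h (vanishing ω xs) (lin x)))

  lin-∤-lin : ∀ {x y} → x ≢ y → ¬ lin x ∣ lin y
  lin-∤-lin {x} {y} x≢y d = x-y≢0 x≢y (trans (sym (eval-lin y x)) (lin∣⇒root (lin y) x d))

  -- The zeros are simple because the points are distinct: cancelling `lin y` leaves no zero at `y`,
  -- and for `x ≠ y` the factor `lin y` is coprime to `lin x`.
  vanishing-free : ∀ {n} (ω : Vec Outcome n) xs → UniqueVec xs → ∀ x → ¬ (lin x ⊗ lin x ∣ vanishing ω xs)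
  vanishing-free []        []       _        x d = irreducible-∤-[] (lin-irreducible x)
    (∣-trans {lin x} {lin x ⊗ lin x} {[]} (lin x , refl) d)
  vanishing-free (pos ∷ ω) (y ∷ ys) (_ ∷ u)  x d = vanishing-free ω ys u x d
  vanishing-free (neg ∷ ω) (y ∷ ys) (_ ∷ u)  x d = vanishing-free ω ys u x d
  vanishing-free (zer ∷ ω) (y ∷ ys) (y∉ ∷ u) x (t , e) with x ≟ y
  ... | yes refl = vanishing-≢0 ω ys y∉ (lin∣⇒root (vanishing ω ys) x
    (t , ⊗-cancelʳ (lin x) {vanishing ω ys} {t ⊗ lin x} (trans e (sym (⊗-assoc t (lin x) (lin x))))))
  ... | no x≢y   = vanishing-free ω ys u x (square-coprime (lin-irreducible x) (lin y) (vanishing ω ys) (lin-∤-lin x≢y)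
    (t , trans (⊗-comm (lin y) (vanishing ω ys)) e))

  irreducible-∤-vanishing : ∀ {p} → Irreducible p → 2 ≤ length p → ∀ {n} (ω : Vec Outcome n) xs → ¬ p ∣ vanishing ω xs
  irreducible-∤-vanishing irr 2≤p []        []       = irreducible-∤-[] irr
  irreducible-∤-vanishing irr 2≤p (pos ∷ ω) (x ∷ xs) = irreducible-∤-vanishing irr 2≤p ω xs
  irreducible-∤-vanishing irr 2≤p (neg ∷ ω) (x ∷ xs) = irreducible-∤-vanishing irr 2≤p ω xs
  irreducible-∤-vanishing {p} irr 2≤p (zer ∷ ω) (x ∷ xs) = irreducible-∤-⊗ irr (irreducible-∤-vanishing irr 2≤p ω xs)
    λ d → ℕ.<-irrefl refl (ℕ.<-≤-trans 2≤p (∣-length {p} {lin x} d))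

  -- Square-freeness in terms of monic and irreducible polynomials

  mono-nonConstant : ∀ g → 1 ≤ length g → NonConstant 𝔽 (mono g)
  mono-nonConstant (a ∷ g) _ = length g , λ e → 0≢1 (trans (sym e) (mono-lead g))

  squareFree⁻ : ∀ f → SquareFree 𝔽 (mono f) → ∀ g → 1 ≤ length g → ¬ (g ⊗ g ∣ f)
  squareFree⁻ f sf g 1≤g (h , e) = sf (mono g) (mono-nonConstant g 1≤g) (mono h , at (≋-trans
    (⊠-cong (≋-refl {mono h}) (≋-sym (mono-⊗ g g))) (≋-trans (≋-sym (mono-⊗ h (g ⊗ g))) (≋-reflexive (cong mono (sym e))))))

  -- With `g = a c` and `c` monic, the scalar moves into the cofactor: `h g² = (a² h) c²`. This
  -- bridges the definition through arbitrary polynomials and the arithmetic of `Monic`.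
  squareFree⁺ : ∀ f → (∀ g → 1 ≤ length g → ¬ (g ⊗ g ∣ f)) → SquareFree 𝔽 (mono f)
  squareFree⁺ f free g (n , gₙ≢0) (h , e) with normalise g
  ... | inj₁ g≋0 = gₙ≢0 (at g≋0 (suc n))
  ... | inj₂ (a , [] , _ , _ , g≋) = gₙ≢0 (at g≋ (suc n))
  ... | inj₂ (a , c@(_ ∷ _) , _ , _ , g≋) = free c (s≤s z≤n) (monic-quotient ((a * a) · h) (c ⊗ c) f (begin
    ((a * a) · h) ⊠ mono (c ⊗ c)            ≈⟨ ·-⊠-assoc (a * a) h (mono (c ⊗ c)) ⟩
    (a * a) · (h ⊠ mono (c ⊗ c))            ≈⟨ ·-cong refl (⊠-comm h (mono (c ⊗ c))) ⟩
    (a * a) · (mono (c ⊗ c) ⊠ h)            ≈⟨ ·-⊠-assoc (a * a) (mono (c ⊗ c)) h ⟨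
    ((a * a) · mono (c ⊗ c)) ⊠ h            ≈⟨ ⊠-comm ((a * a) · mono (c ⊗ c)) h ⟩
    h ⊠ ((a * a) · mono (c ⊗ c))            ≈⟨ ⊠-cong (≋-refl {h}) square ⟩
    h ⊠ (g ⊠ g)                             ≈⟨ mk e ⟩
    mono f                                  ∎))
    where
    open import Relation.Binary.Reasoning.Setoid polySetoid
    square : (a * a) · mono (c ⊗ c) ≋ g ⊠ g
    square = begin
      (a * a) · mono (c ⊗ c)            ≈⟨ ·-assoc a a (mono (c ⊗ c)) ⟩
      a · (a · mono (c ⊗ c))            ≈⟨ ·-cong (refl {x = a}) (·-cong refl (mono-⊗ c c)) ⟩
      a · (a · (mono c ⊠ mono c))       ≈⟨ ·-cong (refl {x = a}) (·-⊠-assoc a (mono c) (mono c)) ⟨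
      a · ((a · mono c) ⊠ mono c)       ≈⟨ ·-cong (refl {x = a}) (⊠-comm (a · mono c) (mono c)) ⟩
      a · (mono c ⊠ (a · mono c))       ≈⟨ ·-⊠-assoc a (mono c) (a · mono c) ⟨
      (a · mono c) ⊠ (a · mono c)       ≈⟨ ⊠-cong g≋ g≋ ⟨
      g ⊠ g                             ∎

  -- The square of an irreducible factor of `g` divides `g²`.
  squareFree-irreducible : ∀ f → (∀ p → Irreducible p → ¬ (p ⊗ p ∣ f)) → SquareFree 𝔽 (mono f)
  squareFree-irreducible f free = squareFree⁺ f λ g 1≤g gg∣f → go g gg∣f (irreducible-factor (length g) g ℕ.≤-refl 1≤g)
    where
    go : ∀ g → g ⊗ g ∣ f → ¬ (∃[ p ] (Irreducible p × p ∣ g))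
    go g gg∣f (p , irr , k , g≡) = free p irr (∣-trans {p ⊗ p} {g ⊗ g} {f} (k ⊗ k , square) gg∣f)
      where
      open ≡-Reasoning
      square : g ⊗ g ≡ (k ⊗ k) ⊗ (p ⊗ p)
      square = begin
        g ⊗ g                 ≡⟨ cong₂ _⊗_ g≡ g≡ ⟩
        (k ⊗ p) ⊗ (k ⊗ p)     ≡⟨ ⊗-assoc k p (k ⊗ p) ⟩
        k ⊗ (p ⊗ (k ⊗ p))     ≡⟨ cong (k ⊗_) (⊗-comm p (k ⊗ p)) ⟩
        k ⊗ ((k ⊗ p) ⊗ p)     ≡⟨ cong (k ⊗_) (⊗-assoc k p p) ⟩
        k ⊗ (k ⊗ (p ⊗ p))     ≡⟨ ⊗-assoc k k (p ⊗ p) ⟨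
        (k ⊗ k) ⊗ (p ⊗ p)     ∎

-- The distribution of the sign patterns

∏ : {A : Set} → (A → ℕ) → ∀ {n} → Vec A n → ℕ
∏ w []       = 1
∏ w (a ∷ as) = w a ℕ.* ∏ w as

outcomes : List Outcome
outcomes = zer ∷ pos ∷ neg ∷ []

∈-outcomes : ∀ o → o ∈ outcomes
∈-outcomes zer = here refl
∈-outcomes pos = there (here refl)
∈-outcomes neg = there (there (here refl))

outcomes-unique : Unique outcomes
outcomes-unique = ((λ ()) ∷ (λ ()) ∷ []) ∷ ((λ ()) ∷ []) ∷ [] ∷ []

withTotal : ∀ n → ℤ → List (Vec Outcome n)
withTotal n s = filter (λ ω → total ω ℤ.≟ s) (vectors outcomes n)

-- 2(q + 1) times the probability of the outcome
mass : ℕ → Outcome → ℕ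
mass q zer = 2
mass q pos = q
mass q neg = q

module _ {A B : Set} {R : A → B → Set} where
  pointwise-all : {P : B → Set} → (∀ {a b} → R a b → P b) →
    ∀ {n} {as : Vec A n} {bs : Vec B n} → Pointwise R as bs → VAll.All P bs
  pointwise-all f []       = []
  pointwise-all f (r ∷ rs) = f r ∷ pointwise-all f rs

  pointwise-× : {T : A → B → Set} → ∀ {n} {as : Vec A n} {bs : Vec B n} →
    Pointwise R as bs → Pointwise T as bs → Pointwise (λ a b → R a b × T a b) as bs
  pointwise-× []       []       = []
  pointwise-× (r ∷ rs) (t ∷ ts) = (r , t) ∷ pointwise-× rs ts

  pointwise-zip⁺ : {C D : Set} {T : A × C → D → Set} (f : B → C) (g : B → D) →
    (∀ {a b} → R a b → T (a , f b) (g b)) → ∀ {n} {as : Vec A n} {bs : Vec B n} →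
    Pointwise R as bs → Pointwise T (Vec.zip as (Vec.map f bs)) (Vec.map g bs)
  pointwise-zip⁺ f g h []       = []
  pointwise-zip⁺ f g h (r ∷ rs) = h r ∷ pointwise-zip⁺ f g h rs

module _ {A B C D : Set} {T : A × C → D → Set} (f : B → C) (g : B → D) where
  pointwise-zip⁻ : ∀ {n} {as : Vec A n} {bs : Vec B n} →
    Pointwise T (Vec.zip as (Vec.map f bs)) (Vec.map g bs) → Pointwise (λ a b → T (a , f b) (g b)) as bs
  pointwise-zip⁻ {as = []}    {[]}    []       = []
  pointwise-zip⁻ {as = _ ∷ _} {_ ∷ _} (t ∷ ts) = t ∷ pointwise-zip⁻ ts

module _ {A B : Set} (g : B → A) where
  pointwise-map⁻ : ∀ {n} {as : Vec A n} {bs : Vec B n} → Vec.map g bs ≡ as → Pointwise (λ a b → g b ≡ a) as bs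
  pointwise-map⁻ {as = []}    {[]}    e = []
  pointwise-map⁻ {as = _ ∷ _} {_ ∷ _} e = Vec.∷-injectiveˡ e ∷ pointwise-map⁻ (Vec.∷-injectiveʳ e)

  pointwise-map⁺ : ∀ {n} {as : Vec A n} {bs : Vec B n} → Pointwise (λ a b → g b ≡ a) as bs → Vec.map g bs ≡ as
  pointwise-map⁺ []       = refl
  pointwise-map⁺ (e ∷ es) = cong₂ _∷_ e (pointwise-map⁺ es)

module Distribution {q : ℕ} (𝔽 : FiniteField q) (3≤q : 3 ≤ q) (2∤q : 2 ∤ q) (d : ℕ) where
  open Sieve 𝔽 3≤q
  open Signs 𝔽 2∤q
  open Patterns 𝔽 3≤q 2∤q

  below-unique : ∀ n → Unique (below n)
  below-unique zero    = []
  below-unique (suc n) = Unique.++⁺ (words-unique n) (below-unique n)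
    λ (f∈ , f∈′) → ℕ.<-irrefl (length-∈-words f∈) (shorter n f∈′)
    where
    shorter : ∀ n {f} → f ∈ below n → length f < n
    shorter (suc n) f∈ with ∈-++⁻ (words n) f∈
    ... | inj₁ f∈w = s≤s (ℕ.≤-reflexive (length-∈-words f∈w))
    ... | inj₂ f∈b = ℕ.m≤n⇒m≤1+n (shorter n f∈b)

  nonlinear? : Decidable (λ p → 2 ≤ length p × Irreducible p)
  nonlinear? p = (2 ℕ.≤? length p) ×-dec irreducible? p

  -- An irreducible whose square divides a monic polynomial of degree at most `d` has itself degree
  -- at most `d`, so a finite list is enough.
  nonlinears : List Monic
  nonlinears = filter nonlinear? (below (suc d))

  nonlinear : ∀ {p} → p ∈ nonlinears → 2 ≤ length p × Irreducible p
  nonlinear p∈ = proj₂ (∈-filter⁻ nonlinear? {xs = below (suc d)} p∈)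

  nonlinears-unique : Unique nonlinears
  nonlinears-unique = Unique.filter⁺ nonlinear? (below-unique (suc d))

  nonlinears-irreducible : All Irreducible nonlinears
  nonlinears-irreducible = All.tabulate (proj₂ ∘ nonlinear)

  nonlinears-nonVanishing : All NonVanishing nonlinears
  nonlinears-nonVanishing = All.tabulate λ p∈ → irreducible⇒nonVanishing (proj₂ (nonlinear p∈)) (proj₁ (nonlinear p∈))

  signPattern : List Carrier → Vec Outcome q
  signPattern f = Vec.map (λ x → sgn (ev f x)) points

  infix 4 _≟ʷ_
  _≟ʷ_ : DecidableEquality (Vec Outcome q)
  _≟ʷ_ = Vec-≡-dec _≟ᵒ_

  -- Admissible values b of the cofactor of ∏ (X − x), at a place where the product is a.
  Compatible : Outcome × Carrier → Carrier → Set
  Compatible (zer , a) b = b ≢ 0#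
  Compatible (pos , a) b = sgn (b * a) ≡ pos
  Compatible (neg , a) b = sgn (b * a) ≡ neg

  compatible? : B.Decidable Compatible
  compatible? (zer , a) b = nonzero? b
  compatible? (pos , a) b = sgn (b * a) ≟ᵒ pos
  compatible? (neg , a) b = sgn (b * a) ≟ᵒ neg

  compatible⁺ : ∀ {o a b} → b ≢ 0# → sgn (b * a) ≡ o → Compatible (o , a) b
  compatible⁺ {zer} b≢0 e = b≢0
  compatible⁺ {pos} b≢0 e = e
  compatible⁺ {neg} b≢0 e = e

  sgn-*≢0 : ∀ {o a b} → o ≢ zer → sgn (b * a) ≡ o → b ≢ 0#
  sgn-*≢0 {a = a} o≢ e b≡0 = o≢ (trans (sym e) (sgn-zer⁺ (trans (cong (_* a) b≡0) (zeroˡ a))))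

  compatible-≢0 : ∀ {o a b} → Compatible (o , a) b → b ≢ 0#
  compatible-≢0 {zer} c = c
  compatible-≢0 {pos} c = sgn-*≢0 (λ ()) c
  compatible-≢0 {neg} c = sgn-*≢0 (λ ()) c

  compatible⁻ : ∀ {f o x b} → ZerosOf f o x → Compatible (o , ev (mono f) x) b → sgn (b * ev (mono f) x) ≡ o
  compatible⁻ {o = zer} {b = b} (inj₁ (_ , a≡0)) c = sgn-zer⁺ (trans (cong (b *_) a≡0) (zeroʳ b))
  compatible⁻ {o = zer} (inj₂ (o≢ , _))  c = contradiction refl o≢
  compatible⁻ {o = pos} z c = c
  compatible⁻ {o = neg} z c = c

  module Pattern (ω : Vec Outcome q) where
    v : Monic
    v = vanishing ω points

    -- Pairs the sign wanted of F at a point with the value of `v` there, the two data on which the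
    -- condition on the cofactor depends.
    places : Vec (Outcome × Carrier) q
    places = Vec.zip ω (vals (mono v))

    compatibles : List (Vec Carrier q)
    compatibles = filter (pointwise? compatible? places) (vectors elements q)

    hasPattern? : Decidable (λ f → SquareFree 𝔽 (mono f) × signPattern (mono f) ≡ ω)
    hasPattern? f = squareFree? 𝔽 (mono f) ×-dec (signPattern (mono f) ≟ʷ ω)

    withPattern : ℕ
    withPattern = count hasPattern? (words d)

    cofactor? : Decidable (λ h → Free nonlinears h × Pointwise Compatible places (vals (mono h)))
    cofactor? h = free? nonlinears h ×-dec pointwise? compatible? places (vals (mono h))

    size : ∀ {f h} → f ≡ h ⊗ v → length f ≡ zeros ω ℕ.+ length h
    size {f} {h} e = trans (cong length e) (trans (length-⊗ h v)
      (trans (ℕ.+-comm (length h) _) (cong (ℕ._+ length h) (length-vanishing ω points))))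

    split : ∀ {f} → length f ≡ d → SquareFree 𝔽 (mono f) → signPattern (mono f) ≡ ω →
      ∃[ h ] (h ∈ words↓ d (zeros ω) × (Free nonlinears h × Pointwise Compatible places (vals (mono h))) × f ≡ h ⊗ v)
    split {f} lf sf pat with vanishing-∣ ω points points-unique f
      (Pointwise.map (λ {o} {x} e o≡ → sgn-zer⁻ {ev (mono f) x} (trans e o≡)) (pointwise-map⁻ _ pat))
    ... | h , e = h , ∈-words↓ d (zeros ω) h (trans (sym (size {f} {h} e)) lf) ,
      (All.tabulate (λ {p} p∈ pp∣h → squareFree⁻ f sf p (ℕ.<⇒≤ (proj₁ (nonlinear p∈)))
        (subst (p ⊗ p ∣_) (sym e) (∣-⊗ʳ v {p ⊗ p} {h} pp∣h))) ,
       pointwise-zip⁺ (ev (mono v)) (ev (mono h)) (λ {o} {x} (z , e′) →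
           let e″ = trans (cong sgn (trans (sym (eval-⊗ h v x)) (cong (λ g → ev (mono g) x) (sym e)))) e′
           in compatible⁺ (h≢0 x z e″) e″)
         (pointwise-× (vanishing-zeros ω points points-unique) (pointwise-map⁻ _ pat))) ,
      e
      where
      -- At a zero of `v`, a zero of `h` would make `f` divisible by the square of `lin x`;
      -- elsewhere the nonzero sign of `f` excludes it.
      h≢0 : ∀ {o} x → ZerosOf v o x → sgn (ev (mono h) x * ev (mono v) x) ≡ o → ev (mono h) x ≢ 0#
      h≢0 x (inj₂ (o≢ , _))  e″ h≡0 = sgn-*≢0 o≢ e″ h≡0
      h≢0 x (inj₁ (_ , v≡0)) e″ h≡0 with root⇒lin∣ h x h≡0 | root⇒lin∣ v x v≡0
      ... | h′ , h≡ | v′ , v≡ = squareFree⁻ f sf (lin x) (s≤s z≤n) (h′ ⊗ v′ , (begin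
        f                                 ≡⟨ e ⟩
        h ⊗ v                             ≡⟨ cong₂ _⊗_ h≡ v≡ ⟩
        (h′ ⊗ lin x) ⊗ (v′ ⊗ lin x)       ≡⟨ ⊗-assoc h′ (lin x) (v′ ⊗ lin x) ⟩
        h′ ⊗ (lin x ⊗ (v′ ⊗ lin x))       ≡⟨ cong (h′ ⊗_) (⊗-comm (lin x) (v′ ⊗ lin x)) ⟩
        h′ ⊗ ((v′ ⊗ lin x) ⊗ lin x)       ≡⟨ cong (h′ ⊗_) (⊗-assoc v′ (lin x) (lin x)) ⟩
        h′ ⊗ (v′ ⊗ (lin x ⊗ lin x))       ≡⟨ ⊗-assoc h′ v′ (lin x ⊗ lin x) ⟨
        (h′ ⊗ v′) ⊗ (lin x ⊗ lin x)       ∎))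
        where open ≡-Reasoning

    -- Cases by the degree of `p`. A linear `p` does not divide `h`, so its square would divide `v`,
    -- whose zeros are simple. A nonlinear `p` does not divide `v`, so its square would divide `h`,
    -- against `Free`.
    squareFree-⊗-vanishing : ∀ {h} → zeros ω ℕ.+ length h ≡ d → Free nonlinears h → (∀ x → ev (mono h) x ≢ 0#) →
      SquareFree 𝔽 (mono (h ⊗ v))
    squareFree-⊗-vanishing {h} lh free h≢0 = squareFree-irreducible (h ⊗ v) go
      where
      go : ∀ p → Irreducible p → ¬ (p ⊗ p ∣ h ⊗ v)
      go [] (() , _)
      go (a ∷ []) irr pp∣hv = vanishing-free ω points points-unique (- a)
        (subst (λ p → p ⊗ p ∣ v) lin≡ (square-coprime irr h v
          (λ p∣h → h≢0 (- a) (lin∣⇒root h (- a) (subst (_∣ h) lin≡ p∣h))) pp∣hv))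
        where
        lin≡ : a ∷ [] ≡ lin (- a)
        lin≡ = cong (_∷ []) (sym (-‿involutive a))
      go p@(_ ∷ _ ∷ _) irr pp∣hv = All.lookup free (∈-filter⁺ nonlinear? (∈-below (suc d) p (s≤s p≤d)) (s≤s (s≤s z≤n) , irr)) pp∣h
        where
        pp∣h : p ⊗ p ∣ h
        pp∣h = square-coprime irr v h (irreducible-∤-vanishing irr (s≤s (s≤s z≤n)) ω points)
          (subst (p ⊗ p ∣_) (⊗-comm h v) pp∣hv)
        p≤d : length p ≤ d
        p≤d = ℕ.≤-trans (∣-length {p} {h} (∣-trans {p} {p ⊗ p} {h} (p , refl) pp∣h))
          (ℕ.≤-trans (ℕ.m≤n+m (length h) (zeros ω)) (ℕ.≤-reflexive lh))

    compatibles-≢0 : ∀ {h} → Pointwise Compatible places (vals (mono h)) → ∀ x → ev (mono h) x ≢ 0#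
    compatibles-≢0 {h} c = on-points (pointwise-all (λ {o} {x} c → compatible-≢0 {o} c)
      (pointwise-zip⁻ {T = Compatible} (ev (mono v)) (ev (mono h)) c))

    combine : ∀ {h} → h ∈ words↓ d (zeros ω) → Free nonlinears h → Pointwise Compatible places (vals (mono h)) →
      (h ⊗ v) ∈ words d × SquareFree 𝔽 (mono (h ⊗ v)) × signPattern (mono (h ⊗ v)) ≡ ω
    combine {h} h∈ free c = ∈-words (h ⊗ v) (trans (size {h ⊗ v} {h} refl) lh) ,
      squareFree-⊗-vanishing lh free (compatibles-≢0 {h} c) ,
      pointwise-map⁺ _ (Pointwise.map
        (λ {o} {x} (z , c) → trans (cong sgn (eval-⊗ h v x)) (compatible⁻ {v} {o} {x} z c))
        (pointwise-× (vanishing-zeros ω points points-unique)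
          (pointwise-zip⁻ {T = Compatible} (ev (mono v)) (ev (mono h)) c)))
      where
      lh = length-∈-words↓ d (zeros ω) h∈

    withPattern-cofactor : withPattern ≡ count cofactor? (words↓ d (zeros ω))
    withPattern-cofactor = ℕ.≤-antisym
      (count-rel hasPattern? cofactor? (λ f h → f ≡ h ⊗ v) (words-unique d)
        (λ f∈ (sf , pat) → split (length-∈-words f∈) sf pat)
        (λ _ _ e e′ → trans e (sym e′)))
      (count-rel cofactor? hasPattern? (λ h f → f ≡ h ⊗ v) (words↓-unique d (zeros ω))
        (λ {h} h∈ (free , c) → let f∈ , sf , pat = combine h∈ free c in h ⊗ v , f∈ , (sf , pat) , refl)
        (λ {h} {h′} _ _ e e′ → ⊗-cancelʳ v {h} {h′} (trans (sym e) e′)))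

    -- The cofactors are grouped by their value vectors, since the sieve treats one vector of
    -- prescribed values at a time.
    withPattern-sum : withPattern ≡ ∑ compatibles (sieved nonlinears d (zeros ω))
    withPattern-sum = trans withPattern-cofactor (trans
      (count-fibre cofactor? (vals ∘ mono) _≟ᵛ_ (Unique.filter⁺ (pointwise? compatible? places) (vectors-unique q elements-unique))
        (words↓ d (zeros ω))
        (λ {h} _ (_ , c) → ∈-filter⁺ (pointwise? compatible? places) (∈-vectors-complete ∈-elements (vals (mono h))) c))
      (∑-cong compatibles λ {b} b∈ → count-cong (λ h → cofactor? h ×-dec (vals (mono h) ≟ᵛ b)) (sieved? nonlinears b)
        {words↓ d (zeros ω)}
        (λ { _ ((free , _) , e) → free , e })
        (λ { _ (free , e) → (free , subst (Pointwise Compatible places) (sym e)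
          (proj₂ (∈-filter⁻ (pointwise? compatible? places) {xs = vectors elements q} b∈))) , e })))

  -- A reference vector without zeros, picked arbitrarily: up to the error of the sieve, the count
  -- does not depend on the prescribed values.
  ones : Vec Carrier q
  ones = Vec.replicate q 1#

  ones-≢0 : ∀ n → NonZeros (Vec.replicate n 1#)
  ones-≢0 zero    = []
  ones-≢0 (suc n) = (0≢1 ∘ sym) ∷ ones-≢0 n

  -- The common approximate value of q^z times the sieved counts in degree d − z.
  base : ℕ
  base = sieved nonlinears d 0 ones

  -- Pattern counts against the weights of the model

  module _ (L : ℕ) (d+q≤ : d ℕ.+ q ≤ suc (L ℕ.+ L)) where
    slack : ℕ
    slack = 4 ℕ.* q ℕ.^ L

    -- For every compatible vector `b`, `sieved-close` with `m = zeros ω` compares `base`, in degree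
    -- `d`, with the count for `b` in degree `d − zeros ω`. All compatible vectors thereby get the
    -- same approximate count.
    withPattern-close : ∀ ω → let open Pattern ω in
      Close (q ℕ.^ zeros ω ℕ.* withPattern) (length compatibles ℕ.* base) (length compatibles ℕ.* slack)
    withPattern-close ω = subst (λ x → Close x (length compatibles ℕ.* base) (length compatibles ℕ.* slack))
      (sym (trans (cong (q ℕ.^ zeros ω ℕ.*_) withPattern-sum) (∑-*ˡ compatibles (q ℕ.^ zeros ω) _)))
      (≡.subst₂ (Close _) (cong (ℕ._* base) (∑-one compatibles)) (cong (ℕ._* slack) (∑-one compatibles))
        (close-∑ compatibles _ (λ _ → 1) λ {b} b∈ → ≡.subst₂ (Close _) (sym (ℕ.*-identityˡ base)) (sym (ℕ.*-identityˡ slack))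
          (close-sym (close-weaken (error-bound (products nonlinears) (products-unique nonlinears-unique nonlinears-irreducible)
              d (zeros ω) L (zeros≤ ω) d+q≤)
            (sieved-close nonlinears nonlinears-unique nonlinears-irreducible nonlinears-nonVanishing
              d 0 (zeros ω) ones b (zeros≤ ω) (ones-≢0 q)
              (nonzeros (proj₂ (∈-filter⁻ (pointwise? compatible? places) {xs = vectors elements q} b∈))))))))
      where
      open Pattern ω
      nonzeros : ∀ {n} {as : Vec (Outcome × Carrier) n} {b : Vec Carrier n} → Pointwise Compatible as b → NonZeros b
      nonzeros []       = []
      nonzeros {as = (o , a) ∷ _} (c ∷ cs) = compatible-≢0 {o} {a} c ∷ nonzeros cs

    units : ℕ
    units = count nonzero? elements

    -- Chosen to meet two demands: `scale o` times the number of compatible values is `mass q o`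
    -- times `units`, and `∏ scale ω · q^zeros ω` is a power of `2q` that does not depend on `ω`.
    scale : Outcome → ℕ
    scale zer = 2
    scale pos = 2 ℕ.* q
    scale neg = 2 ℕ.* q

    scale-zeros : ∀ {n} (ω : Vec Outcome n) → (2 ℕ.* q) ℕ.^ n ≡ ∏ scale ω ℕ.* q ℕ.^ zeros ω
    scale-zeros []        = refl
    scale-zeros (zer ∷ ω) = trans (cong (2 ℕ.* q ℕ.*_) (scale-zeros ω))
      (solve 3 (λ q s z → con 2 :* q :* (s :* z) := con 2 :* s :* (q :* z)) refl q (∏ scale ω) (q ℕ.^ zeros ω))
      where open +-*-Solver
    scale-zeros (pos ∷ ω) = trans (cong (2 ℕ.* q ℕ.*_) (scale-zeros ω)) (sym (ℕ.*-assoc (2 ℕ.* q) _ _))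
    scale-zeros (neg ∷ ω) = trans (cong (2 ℕ.* q ℕ.*_) (scale-zeros ω)) (sym (ℕ.*-assoc (2 ℕ.* q) _ _))

    signed : ∀ s {c c′ P} m {p} → c ≡ c′ → units ≡ c′ ℕ.+ c′ → s ℕ.* P ≡ m ℕ.* p →
      2 ℕ.* q ℕ.* s ℕ.* (c ℕ.* P) ≡ q ℕ.* m ℕ.* (units ℕ.* p)
    signed s {c} {P = P} m {p} refl u e = begin
      2 ℕ.* q ℕ.* s ℕ.* (c ℕ.* P)   ≡⟨ solve 4 (λ q s c P → con 2 :* q :* s :* (c :* P) := q :* (c :+ c) :* (s :* P)) refl q s c P ⟩
      q ℕ.* (c ℕ.+ c) ℕ.* (s ℕ.* P) ≡⟨ cong₂ (λ u x → q ℕ.* u ℕ.* x) (sym u) e ⟩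
      q ℕ.* units ℕ.* (m ℕ.* p)     ≡⟨ solve 4 (λ q u m p → q :* u :* (m :* p) := q :* m :* (u :* p)) refl q units m p ⟩
      q ℕ.* m ℕ.* (units ℕ.* p)     ∎
      where
      open ≡-Reasoning
      open +-*-Solver

    -- At a zero the cofactor may take all `units` nonzero values, while the lost degree costs a
    -- factor `q`; at any other place half of the `units` are admissible for either sign. The ratio
    -- 1/q : 1/2 : 1/2 is the law of the model.
    scale-compatible : ∀ {n} {ω : Vec Outcome n} {xs} f → Pointwise (ZerosOf f) ω xs →
      ∏ scale ω ℕ.* ∏-count compatible? (Vec.zip ω (Vec.map (ev (mono f)) xs)) elements ≡ ∏ (mass q) ω ℕ.* units ℕ.^ n
    scale-compatible f [] = refl
    scale-compatible {suc n} {ω = zer ∷ ω} {x ∷ xs} f (z ∷ zs) = trans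
      (solve 3 (λ s u c → con 2 :* s :* (u :* c) := con 2 :* u :* (s :* c)) refl (∏ scale ω) units _)
      (trans (cong (2 ℕ.* units ℕ.*_) (scale-compatible f zs))
        (solve 3 (λ m u p → con 2 :* u :* (m :* p) := con 2 :* m :* (u :* p)) refl (∏ (mass q) ω) units (units ℕ.^ n)))
      where open +-*-Solver
    scale-compatible {ω = pos ∷ ω} f (inj₁ (() , _) ∷ zs)
    scale-compatible {ω = neg ∷ ω} f (inj₁ (() , _) ∷ zs)
    scale-compatible {ω = pos ∷ ω} f (inj₂ (_ , fx≢0) ∷ zs) =
      signed (∏ scale ω) _ (count-sgn-* pos fx≢0) count-pos (scale-compatible f zs)
    scale-compatible {ω = neg ∷ ω} f (inj₂ (_ , fx≢0) ∷ zs) =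
      signed (∏ scale ω) _ (count-sgn-* neg fx≢0) count-neg (scale-compatible f zs)

    withPattern-mass : ∀ ω → Close ((2 ℕ.* q) ℕ.^ q ℕ.* Pattern.withPattern ω)
      (∏ (mass q) ω ℕ.* (units ℕ.^ q ℕ.* base)) (∏ (mass q) ω ℕ.* (units ℕ.^ q ℕ.* slack))
    withPattern-mass ω = subst (λ x → Close x (∏ (mass q) ω ℕ.* (units ℕ.^ q ℕ.* base)) (∏ (mass q) ω ℕ.* (units ℕ.^ q ℕ.* slack)))
      (trans (sym (ℕ.*-assoc (∏ scale ω) _ _)) (cong (ℕ._* withPattern) (sym (scale-zeros ω))))
      (≡.subst₂ (Close _) (total-mass base) (total-mass slack) (close-* (∏ scale ω) (withPattern-close ω)))
      where
      open Pattern ω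
      total-mass : ∀ r → ∏ scale ω ℕ.* (length compatibles ℕ.* r) ≡ ∏ (mass q) ω ℕ.* (units ℕ.^ q ℕ.* r)
      total-mass r = trans (sym (ℕ.*-assoc (∏ scale ω) _ r)) (trans (cong (ℕ._* r)
        (trans (cong (∏ scale ω ℕ.*_) (count-pointwise compatible? places elements))
          (scale-compatible v (vanishing-zeros ω points points-unique)))) (ℕ.*-assoc (∏ (mass q) ω) _ r))

    sum-mass : ∀ ωs → Close ((2 ℕ.* q) ℕ.^ q ℕ.* ∑ ωs Pattern.withPattern)
      (∑ ωs (∏ (mass q)) ℕ.* (units ℕ.^ q ℕ.* base)) (∑ ωs (∏ (mass q)) ℕ.* (units ℕ.^ q ℕ.* slack))
    sum-mass ωs = subst (λ x → Close x (∑ ωs (∏ (mass q)) ℕ.* (units ℕ.^ q ℕ.* base)) (∑ ωs (∏ (mass q)) ℕ.* (units ℕ.^ q ℕ.* slack)))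
      (sym (∑-*ˡ ωs ((2 ℕ.* q) ℕ.^ q) Pattern.withPattern)) (close-∑ ωs _ (∏ (mass q)) (λ {ω} _ → withPattern-mass ω))

  -- Summation over the patterns and the size of 𝓕_d

  squareFreeMonic? : Decidable (SquareFree 𝔽 ∘ mono)
  squareFreeMonic? f = squareFree? 𝔽 (mono f)

  monics≡ : monics 𝔽 d ≡ map mono (words d)
  monics≡ = map-∘ (vectors elements d)

  length-𝓕 : length (𝓕 𝔽 d) ≡ count squareFreeMonic? (words d)
  length-𝓕 = trans (cong (λ fs → length (filter (squareFree? 𝔽) fs)) monics≡) (count-map (squareFree? 𝔽) mono (words d))

  patterns-unique : ∀ n → Unique (vectors outcomes n)
  patterns-unique n = vectors-unique n outcomes-unique

  length-𝓕-sum : length (𝓕 𝔽 d) ≡ ∑ (vectors outcomes q) Pattern.withPattern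
  length-𝓕-sum = trans length-𝓕 (count-fibre squareFreeMonic? (signPattern ∘ mono) _≟ʷ_ (patterns-unique q) (words d)
    (λ {f} _ _ → ∈-vectors-complete ∈-outcomes (signPattern (mono f))))

  total-pattern : ∀ f → total (signPattern f) ≡ S 𝔽 f
  total-pattern f = cong (foldr ℤ._+_ 0ℤ) (trans (values points) (cong (map (χ 𝔽 ∘ ev f)) toList-points))
    where
    values : ∀ {n} (xs : Vec Carrier n) →
      map value (toList (Vec.map (λ x → sgn (ev f x)) xs)) ≡ map (χ 𝔽 ∘ ev f) (toList xs)
    values []       = refl
    values (x ∷ xs) = cong₂ _∷_ (value-sgn (ev f x)) (values xs)
    toList-tabulate : ∀ {n} {A : Set} (g : Fin.Fin n → A) → toList (Vec.tabulate g) ≡ List.tabulate g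
    toList-tabulate {zero}  g = refl
    toList-tabulate {suc n} g = cong (g Fin.zero ∷_) (toList-tabulate (g ∘ Fin.suc))
    toList-points : toList points ≡ elements
    toList-points = trans (toList-tabulate to) (sym (map-tabulate id to))

  count-S : ∀ s → length (filter (λ f → S 𝔽 f ℤ.≟ s) (𝓕 𝔽 d)) ≡ ∑ (withTotal q s) Pattern.withPattern
  count-S s = trans (count-∧ (squareFree? 𝔽) S? (monics 𝔽 d))
    (trans (cong (count SF∧S?) monics≡) (trans (count-map SF∧S? mono (words d))
    (trans (count-fibre (SF∧S? ∘ mono) (signPattern ∘ mono) _≟ʷ_ (Unique.filter⁺ total? (patterns-unique q)) (words d)
      (λ {f} _ (_ , e) → ∈-filter⁺ total? (∈-vectors-complete ∈-outcomes (signPattern (mono f))) (trans (total-pattern (mono f)) e)))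
    (∑-cong (withTotal q s) λ {ω} ω∈ → count-cong (λ f → SF∧S? (mono f) ×-dec (signPattern (mono f) ≟ʷ ω)) (Pattern.hasPattern? ω) {words d}
      (λ { _ ((sf , _) , e) → sf , e })
      (λ { {f} _ (sf , e) → (sf , trans (sym (total-pattern (mono f))) (trans (cong total e)
        (proj₂ (∈-filter⁻ total? {xs = vectors outcomes q} ω∈)))) , e })))))
    where
    S? : Decidable (λ f → S 𝔽 f ≡ s)
    S? f = S 𝔽 f ℤ.≟ s
    SF∧S? : Decidable (λ f → SquareFree 𝔽 f × S 𝔽 f ≡ s)
    SF∧S? f = squareFree? 𝔽 f ×-dec S? f
    total? : Decidable (λ (ω : Vec Outcome q) → total ω ≡ s)
    total? ω = total ω ℤ.≟ s

  -- The word g ++ h determines g and h once the degree d of h g² is known.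
  many-squareFree : q ℕ.^ d ≤ 2 ℕ.* length (𝓕 𝔽 d)
  many-squareFree = ℕ.+-cancelʳ-≤ (2 ℕ.* rest) _ _ (begin
    q ℕ.^ d ℕ.+ 2 ℕ.* rest                       ≤⟨ ℕ.+-monoʳ-≤ (q ℕ.^ d) (ℕ.≤-trans (ℕ.*-monoʳ-≤ 2 few) (ℕ.<⇒≤ (2*below< d))) ⟩
    q ℕ.^ d ℕ.+ q ℕ.^ d                          ≡⟨ solve 1 (λ x → x :+ x := con 2 :* x) refl (q ℕ.^ d) ⟩
    2 ℕ.* q ℕ.^ d                                ≡⟨ cong (2 ℕ.*_) all ⟩
    2 ℕ.* (length (𝓕 𝔽 d) ℕ.+ rest)              ≡⟨ ℕ.*-distribˡ-+ 2 (length (𝓕 𝔽 d)) rest ⟩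
    2 ℕ.* length (𝓕 𝔽 d) ℕ.+ 2 ℕ.* rest          ∎)
    where
    open ℕ.≤-Reasoning
    open +-*-Solver
    ¬sf? : Decidable (¬_ ∘ SquareFree 𝔽 ∘ mono)
    ¬sf? f = ¬? (squareFreeMonic? f)
    rest : ℕ
    rest = count ¬sf? (words d)
    all : q ℕ.^ d ≡ length (𝓕 𝔽 d) ℕ.+ rest
    all = trans (sym (length-words d)) (trans (sym (count-all (words d)))
      (trans (count-split (λ _ → yes tt) squareFreeMonic? ¬sf? (words d)) (cong₂ ℕ._+_
        (trans (count-cong (λ f → yes tt ×-dec squareFreeMonic? f) squareFreeMonic? {words d} (λ _ → proj₂) (λ _ → tt ,_)) (sym length-𝓕))
        (count-cong (λ f → yes tt ×-dec ¬sf? f) ¬sf? {words d} (λ _ → proj₂) (λ _ → tt ,_)))))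
    Code : Monic → Monic → Set
    Code f w = ∃[ g ] ∃[ h ] (1 ≤ length g × f ≡ h ⊗ (g ⊗ g) × w ≡ g ++ h)
    size : ∀ g h → length (h ⊗ (g ⊗ g)) ≡ length g ℕ.+ length (g ++ h)
    size g h = trans (length-⊗ h (g ⊗ g)) (trans (cong (length h ℕ.+_) (length-⊗ g g))
      (trans (solve 2 (λ g h → h :+ (g :+ g) := g :+ (g :+ h)) refl (length g) (length h))
        (cong (length g ℕ.+_) (sym (length-++ g)))))
    encode : ∀ {f} → f ∈ words d → ¬ SquareFree 𝔽 (mono f) → ∃[ w ] (w ∈ below d × Code f w)
    encode {f} f∈ ¬sf with any? (λ p → irreducible? p ×-dec (p ⊗ p ∣? f)) (below (suc (length f)))
    ... | no none = contradiction (squareFree-irreducible f λ p irr pp∣f → none (lose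
      (∈-below (suc (length f)) p (s≤s (∣-length {p} {f} (∣-trans {p} {p ⊗ p} {f} (p , refl) pp∣f)))) (irr , pp∣f))) ¬sf
    ... | yes some with find some
    ... | g , _ , (1≤g , _) , h , e = g ++ h , ∈-below d (g ++ h) (ℕ.≤-trans (ℕ.+-monoˡ-≤ (length (g ++ h)) 1≤g)
        (ℕ.≤-reflexive (trans (sym (size g h)) (trans (cong length (sym e)) (length-∈-words f∈))))) ,
      g , h , 1≤g , e , refl
    few : rest ≤ length (below d)
    few = rel-length Code (Unique.filter⁺ ¬sf? (words-unique d))
      (λ f∈ → let f∈w , ¬sf = ∈-filter⁻ ¬sf? {xs = words d} f∈ in encode f∈w ¬sf) inj
      where
      inj : ∀ {f f′ w} → f ∈ filter ¬sf? (words d) → f′ ∈ filter ¬sf? (words d) → Code f w → Code f′ w → f ≡ f′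
      inj f∈ f′∈ (g , h , _ , refl , refl) (g′ , h′ , _ , refl , e) =
        let g≡ , h≡ = halves g g′ (ℕ.+-cancelʳ-≡ (length (g ++ h)) _ _ (trans (sym (size g h)) (trans
                        (trans (length-∈-words (proj₁ (∈-filter⁻ ¬sf? {xs = words d} f∈)))
                          (sym (length-∈-words (proj₁ (∈-filter⁻ ¬sf? {xs = words d} f′∈)))))
                        (trans (size g′ h′) (cong (λ w → length g′ ℕ.+ length w) (sym e)))))) e
        in cong₂ (λ g h → h ⊗ (g ⊗ g)) g≡ h≡
        where
        halves : ∀ g g′ → length g ≡ length g′ → g ++ h ≡ g′ ++ h′ → g ≡ g′ × h ≡ h′
        halves []      []        _ e = refl , e
        halves (x ∷ g) (y ∷ g′) l e =
          let g≡ , h≡ = halves g g′ (ℕ.suc-injective l) (∷-injectiveʳ e) in cong₂ _∷_ (∷-injectiveˡ e) g≡ , h≡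

-- Comparison of rationals

module ℚSolver = IntegerSolver ℚ.+-*-commutativeRing

ι : ℕ → ℚ
ι n = ℤ.+ n / 1

/1-+ : ∀ i j → (i ℤ.+ j) / 1 ≡ (i / 1) ℚ.+ (j / 1)
/1-+ i j = ℚ.toℚᵘ-injective (begin
  toℚᵘ ((i ℤ.+ j) / 1)              ≈⟨ ℚ.toℚᵘ-fromℚᵘ (mkℚᵘ (i ℤ.+ j) 0) ⟩
  mkℚᵘ (i ℤ.+ j) 0                  ≈⟨ ℚᵘ.*≡* (cong (ℤ._* 1ℤ) (cong₂ ℤ._+_ (ℤ.*-identityʳ i) (ℤ.*-identityʳ j))) ⟨
  mkℚᵘ i 0 ℚᵘ.+ mkℚᵘ j 0            ≈⟨ ℚᵘ.+-cong (ℚ.toℚᵘ-fromℚᵘ (mkℚᵘ i 0)) (ℚ.toℚᵘ-fromℚᵘ (mkℚᵘ j 0)) ⟨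
  toℚᵘ (i / 1) ℚᵘ.+ toℚᵘ (j / 1)    ≈⟨ ℚ.toℚᵘ-homo-+ (i / 1) (j / 1) ⟨
  toℚᵘ ((i / 1) ℚ.+ (j / 1))        ∎)
  where open ℚᵘ.≃-Reasoning

/1-* : ∀ i j → (i ℤ.* j) / 1 ≡ (i / 1) ℚ.* (j / 1)
/1-* i j = ℚ.toℚᵘ-injective (begin
  toℚᵘ ((i ℤ.* j) / 1)              ≈⟨ ℚ.toℚᵘ-fromℚᵘ (mkℚᵘ (i ℤ.* j) 0) ⟩
  mkℚᵘ i 0 ℚᵘ.* mkℚᵘ j 0            ≈⟨ ℚᵘ.*-cong (ℚ.toℚᵘ-fromℚᵘ (mkℚᵘ i 0)) (ℚ.toℚᵘ-fromℚᵘ (mkℚᵘ j 0)) ⟨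
  toℚᵘ (i / 1) ℚᵘ.* toℚᵘ (j / 1)    ≈⟨ ℚ.toℚᵘ-homo-* (i / 1) (j / 1) ⟨
  toℚᵘ ((i / 1) ℚ.* (j / 1))        ∎)
  where open ℚᵘ.≃-Reasoning

/-*-cancel : ∀ i n .{{_ : NonZero n}} → (i / n) ℚ.* ι n ≡ i / 1
/-*-cancel i n@(suc m) = ℚ.toℚᵘ-injective (begin
  toℚᵘ ((i / n) ℚ.* ι n)            ≈⟨ ℚ.toℚᵘ-homo-* (i / n) (ι n) ⟩
  toℚᵘ (i / n) ℚᵘ.* toℚᵘ (ι n)      ≈⟨ ℚᵘ.*-cong (ℚ.toℚᵘ-fromℚᵘ (mkℚᵘ i m)) (ℚ.toℚᵘ-fromℚᵘ (mkℚᵘ (ℤ.+ n) 0)) ⟩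
  mkℚᵘ i m ℚᵘ.* mkℚᵘ (ℤ.+ n) 0      ≈⟨ ℚᵘ.*≡* (trans (ℤ.*-assoc i (ℤ.+ n) 1ℤ)
                                        (cong (i ℤ.*_) (trans (ℤ.*-identityʳ (ℤ.+ n)) (cong ℤ.+_ (sym (ℕ.*-identityʳ n)))))) ⟩
  mkℚᵘ i 0                          ≈⟨ ℚ.toℚᵘ-fromℚᵘ (mkℚᵘ i 0) ⟨
  toℚᵘ (i / 1)                      ∎)
  where open ℚᵘ.≃-Reasoning

ι-+ : ∀ m n → ι (m ℕ.+ n) ≡ ι m ℚ.+ ι n
ι-+ m n = /1-+ (ℤ.+ m) (ℤ.+ n)

ι-* : ∀ m n → ι (m ℕ.* n) ≡ ι m ℚ.* ι n
ι-* m n = trans (cong (_/ 1) (ℤ.pos-* m n)) (/1-* (ℤ.+ m) (ℤ.+ n))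

ι-≤ : ∀ {m n} → m ≤ n → ι m ℚ.≤ ι n
ι-≤ {m} {n} m≤n = ℚ.toℚᵘ-cancel-≤ (begin
  toℚᵘ (ι m)        ≃⟨ ℚ.toℚᵘ-fromℚᵘ (mkℚᵘ (ℤ.+ m) 0) ⟩
  mkℚᵘ (ℤ.+ m) 0    ≤⟨ ℚᵘ.*≤* (ℤ.*-monoʳ-≤-nonNeg 1ℤ (ℤ.+≤+ m≤n)) ⟩
  mkℚᵘ (ℤ.+ n) 0    ≃⟨ ℚ.toℚᵘ-fromℚᵘ (mkℚᵘ (ℤ.+ n) 0) ⟨
  toℚᵘ (ι n)        ∎)
  where open ℚᵘ.≤-Reasoning

ι-< : ∀ {m n} → m < n → ι m ℚ.< ι n
ι-< {m} {n} m<n = ℚ.toℚᵘ-cancel-< (begin-strict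
  toℚᵘ (ι m)        ≃⟨ ℚ.toℚᵘ-fromℚᵘ (mkℚᵘ (ℤ.+ m) 0) ⟩
  mkℚᵘ (ℤ.+ m) 0    <⟨ ℚᵘ.*<* (ℤ.*-monoʳ-<-pos 1ℤ (ℤ.+<+ m<n)) ⟩
  mkℚᵘ (ℤ.+ n) 0    ≃⟨ ℚ.toℚᵘ-fromℚᵘ (mkℚᵘ (ℤ.+ n) 0) ⟨
  toℚᵘ (ι n)        ∎)
  where open ℚᵘ.≤-Reasoning

ι-positive : ∀ n → 0 < n → Positive (ι n)
ι-positive n 0<n = ℚ.positive (ι-< 0<n)

ι-nonNegative : ∀ n → NonNegative (ι n)
ι-nonNegative n = ℚ.nonNegative (ι-≤ (z≤n {n}))

*ι-injective : ∀ {p r} n → 0 < n → p ℚ.* ι n ≡ r ℚ.* ι n → p ≡ r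
*ι-injective {p} {r} n 0<n e = ℚ.≤-antisym
  (ℚ.*-cancelʳ-≤-pos (ι n) {{ι-positive n 0<n}} (ℚ.≤-reflexive e))
  (ℚ.*-cancelʳ-≤-pos (ι n) {{ι-positive n 0<n}} (ℚ.≤-reflexive (sym e)))

-- The model with denominators cleared

module _ (q : ℕ) where
  norm : ℕ
  norm = 2 ℕ.* suc q

  law-mass : ∀ o → law q o ℚ.* ι norm ≡ ι (mass q o)
  law-mass zer = begin
    law q zer ℚ.* ι (2 ℕ.* suc q)           ≡⟨ cong (law q zer ℚ.*_) (ι-* 2 (suc q)) ⟩
    law q zer ℚ.* (ι 2 ℚ.* ι (suc q))       ≡⟨ solve 3 (λ a b c → a :* (b :* c) := b :* (a :* c)) refl (law q zer) (ι 2) (ι (suc q)) ⟩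
    ι 2 ℚ.* (law q zer ℚ.* ι (suc q))       ≡⟨ cong (ι 2 ℚ.*_) (/-*-cancel (ℤ.+ 1) (suc q)) ⟩
    ι 2 ℚ.* ι 1                             ≡⟨ ι-* 2 1 ⟨
    ι 2                                     ∎
    where
    open ≡-Reasoning
    open ℚSolver
  law-mass pos = /-*-cancel (ℤ.+ q) norm
  law-mass neg = /-*-cancel (ℤ.+ q) norm

  weight-mass : ∀ {n} (ω : Vec Outcome n) → weight q ω ℚ.* ι (norm ℕ.^ n) ≡ ι (∏ (mass q) ω)
  weight-mass []      = refl
  weight-mass {suc n} (o ∷ ω) = begin
    (law q o ℚ.* weight q ω) ℚ.* ι (norm ℕ.* norm ℕ.^ n)
      ≡⟨ cong (law q o ℚ.* weight q ω ℚ.*_) (ι-* norm (norm ℕ.^ n)) ⟩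
    (law q o ℚ.* weight q ω) ℚ.* (ι norm ℚ.* ι (norm ℕ.^ n))
      ≡⟨ solve 4 (λ a b c d → (a :* b) :* (c :* d) := (a :* c) :* (b :* d)) refl (law q o) (weight q ω) (ι norm) (ι (norm ℕ.^ n)) ⟩
    (law q o ℚ.* ι norm) ℚ.* (weight q ω ℚ.* ι (norm ℕ.^ n))
      ≡⟨ cong₂ ℚ._*_ (law-mass o) (weight-mass ω) ⟩
    ι (mass q o) ℚ.* ι (∏ (mass q) ω)
      ≡⟨ ι-* (mass q o) (∏ (mass q) ω) ⟨
    ι (mass q o ℕ.* ∏ (mass q) ω) ∎
    where
    open ≡-Reasoning
    open ℚSolver

  sum-weight-mass : ∀ {n} (ωs : List (Vec Outcome n)) →
    foldr ℚ._+_ 0ℚ (map (weight q) ωs) ℚ.* ι (norm ℕ.^ n) ≡ ι (∑ ωs (∏ (mass q)))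
  sum-weight-mass {n} []       = ℚ.*-zeroˡ (ι (norm ℕ.^ n))
  sum-weight-mass {n} (ω ∷ ωs) = trans (ℚ.*-distribʳ-+ (ι (norm ℕ.^ n)) (weight q ω) _)
    (trans (cong₂ ℚ._+_ (weight-mass ω) (sum-weight-mass ωs)) (sym (ι-+ (∏ (mass q) ω) _)))

∑-map : {A B : Set} (f : A → B) (g : B → ℕ) → ∀ xs → ∑ (map f xs) g ≡ ∑ xs (g ∘ f)
∑-map f g []       = refl
∑-map f g (x ∷ xs) = cong (g (f x) ℕ.+_) (∑-map f g xs)

∑-++ : {A : Set} (xs ys : List A) (f : A → ℕ) → ∑ (xs ++ ys) f ≡ ∑ xs f ℕ.+ ∑ ys f
∑-++ []       ys f = refl
∑-++ (x ∷ xs) ys f = trans (cong (f x ℕ.+_) (∑-++ xs ys f)) (sym (ℕ.+-assoc (f x) _ _))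

∑-filter-≤ : {A : Set} {P : A → Set} (P? : Decidable P) (xs : List A) (f : A → ℕ) → ∑ (filter P? xs) f ≤ ∑ xs f
∑-filter-≤ P? []       f = z≤n
∑-filter-≤ P? (x ∷ xs) f with P? x
... | yes _ = ℕ.+-monoʳ-≤ (f x) (∑-filter-≤ P? xs f)
... | no  _ = ℕ.≤-trans (∑-filter-≤ P? xs f) (ℕ.m≤n+m _ (f x))

∑-vectors : {A : Set} (xs : List A) (w : A → ℕ) → ∀ n → ∑ (vectors xs n) (∏ w) ≡ ∑ xs w ℕ.^ n
∑-vectors xs w zero    = refl
∑-vectors xs w (suc n) = trans (go xs) (cong (∑ xs w ℕ.*_) (∑-vectors xs w n))
  where
  go : ∀ ys → ∑ (cartesianProductWith _∷_ ys (vectors xs n)) (∏ w) ≡ ∑ ys w ℕ.* ∑ (vectors xs n) (∏ w)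
  go []       = refl
  go (y ∷ ys) = trans (∑-++ (map (y ∷_) (vectors xs n)) _ (∏ w))
    (trans (cong₂ ℕ._+_ (trans (∑-map (y ∷_) (∏ w) (vectors xs n)) (sym (∑-*ˡ (vectors xs n) (w y) (∏ w)))) (go ys))
      (sym (ℕ.*-distribʳ-+ _ (w y) (∑ ys w))))

-- The reason is `2 + q + q = 2(q + 1)`: with denominators cleared, the probabilities of the three
-- outcomes add up to one.
total-mass : ∀ q n → ∑ (vectors outcomes n) (∏ (mass q)) ≡ norm q ℕ.^ n
total-mass q n = trans (∑-vectors outcomes (mass q) n) (cong (ℕ._^ n)
  (solve 1 (λ q → con 2 :+ (q :+ (q :+ con 0)) := con 2 :* (con 1 :+ q)) refl q))
  where open +-*-Solver

∣⊖∣-close : ∀ {a b e} → Close a b e → ℤ.∣ a ⊖ b ∣ ≤ e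
∣⊖∣-close {a} {b} {e} (a≤ , b≤) with ℕ.≤-total a b
... | inj₁ a≤b = ℕ.≤-trans (ℕ.≤-reflexive (ℤ.∣⊖∣-≤ a≤b)) (ℕ.m≤n+o⇒m∸n≤o b a b≤)
... | inj₂ b≤a = ℕ.≤-trans (ℕ.≤-reflexive (trans (ℤ.∣m⊖n∣≡∣n⊖m∣ a b) (ℤ.∣⊖∣-≤ b≤a))) (ℕ.m≤n+o⇒m∸n≤o a b a≤)

square-cancel-< : ∀ {a b} → a ℕ.* a < b ℕ.* b → a < b
square-cancel-< {a} {b} p = ℕ.≰⇒> λ b≤a → ℕ.<⇒≱ p (ℕ.*-mono-≤ b≤a b≤a)

*-cancelʳ-≤′ : ∀ {a b} n → 0 < n → a ℕ.* n ≤ b ℕ.* n → a ≤ b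
*-cancelʳ-≤′ {a} {b} n 0<n = ℕ.*-cancelʳ-≤ a b n {{ℕ.>-nonZero 0<n}}

-- p = c / T and P = W / M are compared through the integer cM − TW.
module Ratio {p P : ℚ} {c T W M e Q K : ℕ} (p≡ : p ℚ.* ι T ≡ ι c) (P≡ : P ℚ.* ι M ≡ ι W)
  (0<T : 0 < T) (0<M : 0 < M) (0<Q : 0 < Q)
  (close : Close (c ℕ.* M) (T ℕ.* W) e) (small : e ℕ.* e ℕ.* Q ≤ K ℕ.* ((T ℕ.* W) ℕ.* (T ℕ.* W))) where

  δ : ℤ
  δ = c ℕ.* M ⊖ T ℕ.* W

  ∣δ∣≤e : ℤ.∣ δ ∣ ≤ e
  ∣δ∣≤e = ∣⊖∣-close close

  δ≡ : δ / 1 ≡ ι c ℚ.* ι M ℚ.- ι T ℚ.* ι W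
  δ≡ = begin
    δ / 1                                    ≡⟨ solve 2 (λ a b → a := a :+ b :+ :- b) refl (δ / 1) (ι (T ℕ.* W)) ⟩
    (δ / 1) ℚ.+ ι (T ℕ.* W) ℚ.- ι (T ℕ.* W)  ≡⟨ cong (ℚ._- ι (T ℕ.* W)) (/1-+ δ (ℤ.+ (T ℕ.* W))) ⟨
    ((δ ℤ.+ ℤ.+ (T ℕ.* W)) / 1) ℚ.- ι (T ℕ.* W) ≡⟨ cong (λ i → (i / 1) ℚ.- ι (T ℕ.* W)) restore ⟩
    ι (c ℕ.* M) ℚ.- ι (T ℕ.* W)              ≡⟨ cong₂ ℚ._-_ (ι-* c M) (ι-* T W) ⟩
    ι c ℚ.* ι M ℚ.- ι T ℚ.* ι W              ∎
    where
    open ≡-Reasoning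
    open ℚSolver
    restore : δ ℤ.+ ℤ.+ (T ℕ.* W) ≡ ℤ.+ (c ℕ.* M)
    restore = trans (cong (ℤ._+ ℤ.+ (T ℕ.* W)) (sym (ℤ.m-n≡m⊖n (c ℕ.* M) (T ℕ.* W))))
      (trans (ℤ.+-assoc (ℤ.+ (c ℕ.* M)) (ℤ.- ℤ.+ (T ℕ.* W)) (ℤ.+ (T ℕ.* W))) (trans (cong (λ i → ℤ.+ (c ℕ.* M) ℤ.+ i) (ℤ.+-inverseˡ (ℤ.+ (T ℕ.* W)))) (ℤ.+-identityʳ _)))

  δ² : (δ / 1) ℚ.* (δ / 1) ≡ ι (ℤ.∣ δ ∣ ℕ.* ℤ.∣ δ ∣)
  δ² = trans (sym (/1-* δ δ)) (cong (_/ 1) (square δ))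
    where
    square : ∀ i → i ℤ.* i ≡ ℤ.+ (ℤ.∣ i ∣ ℕ.* ℤ.∣ i ∣)
    square (ℤ.+ n)    = sym (ℤ.pos-* n n)
    square (-[1+ n ]) = refl

  δ-small : ℤ.∣ δ ∣ ℕ.* ℤ.∣ δ ∣ ℕ.* Q ≤ K ℕ.* ((T ℕ.* W) ℕ.* (T ℕ.* W))
  δ-small = ℕ.≤-trans (ℕ.*-monoˡ-≤ Q (ℕ.*-mono-≤ ∣δ∣≤e ∣δ∣≤e)) small

  relative-error : ∃[ θ ] (p ≡ P ℚ.* (1ℚ ℚ.+ θ) × θ ℚ.* θ ℚ.* ι Q ℚ.≤ ι K)
  relative-error with W ℕ.≟ 0
  -- Here `small` forces `e = 0`, and then `close` forces `c = 0`. Both `p` and `P` vanish, and zero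
  -- is a valid relative error.
  ... | yes W≡0 = 0ℚ ,
    *ι-injective T 0<T (begin
      p ℚ.* ι T                        ≡⟨ p≡ ⟩
      ι c                              ≡⟨ cong ι c≡0 ⟩
      0ℚ                               ≡⟨ ℚ.*-zeroˡ (ι T) ⟨
      0ℚ ℚ.* ι T                       ≡⟨ cong (ℚ._* ι T) (ℚ.*-zeroˡ (1ℚ ℚ.+ 0ℚ)) ⟨
      0ℚ ℚ.* (1ℚ ℚ.+ 0ℚ) ℚ.* ι T       ≡⟨ cong (λ P → P ℚ.* (1ℚ ℚ.+ 0ℚ) ℚ.* ι T) P≡0 ⟨
      P ℚ.* (1ℚ ℚ.+ 0ℚ) ℚ.* ι T        ∎) ,
    ℚ.≤-trans (ℚ.≤-reflexive (trans (cong (ℚ._* ι Q) (ℚ.*-zeroˡ 0ℚ)) (ℚ.*-zeroˡ (ι Q)))) (ι-≤ (z≤n {K}))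
    where
    open ≡-Reasoning
    P≡0 : P ≡ 0ℚ
    P≡0 = *ι-injective M 0<M (trans P≡ (trans (cong ι W≡0) (sym (ℚ.*-zeroˡ (ι M)))))
    TW≡0 : T ℕ.* W ≡ 0
    TW≡0 = trans (cong (T ℕ.*_) W≡0) (ℕ.*-zeroʳ T)
    vanish : ∀ e → e ℕ.* e ℕ.* Q ≤ 0 → e ≡ 0
    vanish zero    _ = refl
    vanish (suc e) p = contradiction (ℕ.≤-trans (ℕ.*-mono-≤ (s≤s (z≤n {e ℕ.+ e ℕ.* suc e})) 0<Q) p) λ ()
    e≡0 : e ≡ 0
    e≡0 = vanish e (ℕ.≤-trans small (ℕ.≤-reflexive (trans (cong (λ z → K ℕ.* (z ℕ.* z)) TW≡0) (ℕ.*-zeroʳ K))))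
    c≡0 : c ≡ 0
    c≡0 = ℕ.n≤0⇒n≡0 (*-cancelʳ-≤′ M 0<M (ℕ.≤-trans (proj₁ close) (ℕ.≤-reflexive (cong₂ ℕ._+_ TW≡0 e≡0))))
  ... | no W≢0 = θ , factor , bound
    where
    open ℚSolver
    D : ℕ
    D = T ℕ.* W
    0<W : 0 < W
    0<W = ℕ.n≢0⇒n>0 W≢0
    0<D : 0 < D
    0<D = ℕ.*-mono-≤ 0<T 0<W
    instance
      D≢0 : NonZero D
      D≢0 = ℕ.>-nonZero 0<D
    θ : ℚ
    -- The only possible choice: `p / P − 1 = (c M − T W) / (T W)`.
    θ = δ / D
    θD : θ ℚ.* ι D ≡ δ / 1
    θD = /-*-cancel δ D
    factor : p ≡ P ℚ.* (1ℚ ℚ.+ θ)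
    factor = *ι-injective M 0<M (*ι-injective D 0<D (begin
      p ℚ.* ι M ℚ.* ι D                        ≡⟨ cong (p ℚ.* ι M ℚ.*_) (ι-* T W) ⟩
      p ℚ.* ι M ℚ.* (ι T ℚ.* ι W)              ≡⟨ solve 4 (λ p m t w → p :* m :* (t :* w) := w :* (t :* w :+ (p :* t :* m :+ :- (t :* w)))) refl p (ι M) (ι T) (ι W) ⟩
      ι W ℚ.* (ι T ℚ.* ι W ℚ.+ (p ℚ.* ι T ℚ.* ι M ℚ.- ι T ℚ.* ι W))
        ≡⟨ cong (λ z → ι W ℚ.* (ι T ℚ.* ι W ℚ.+ (z ℚ.* ι M ℚ.- ι T ℚ.* ι W))) p≡ ⟩
      ι W ℚ.* (ι T ℚ.* ι W ℚ.+ (ι c ℚ.* ι M ℚ.- ι T ℚ.* ι W))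
        ≡⟨ cong₂ (λ x y → ι W ℚ.* (x ℚ.+ y)) (sym (ι-* T W)) (trans (sym δ≡) (sym θD)) ⟩
      ι W ℚ.* (ι D ℚ.+ θ ℚ.* ι D)              ≡⟨ cong (ℚ._* (ι D ℚ.+ θ ℚ.* ι D)) P≡ ⟨
      P ℚ.* ι M ℚ.* (ι D ℚ.+ θ ℚ.* ι D)        ≡⟨ solve 4 (λ P m d θ → P :* m :* (d :+ θ :* d) := P :* (con 1ℤ :+ θ) :* m :* d) refl P (ι M) (ι D) θ ⟩
      P ℚ.* (1ℚ ℚ.+ θ) ℚ.* ι M ℚ.* ι D         ∎))
      where open ≡-Reasoning
    bound : θ ℚ.* θ ℚ.* ι Q ℚ.≤ ι K
    bound = ℚ.*-cancelʳ-≤-pos (ι (D ℕ.* D)) {{ι-positive (D ℕ.* D) (ℕ.*-mono-≤ 0<D 0<D)}} (begin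
      θ ℚ.* θ ℚ.* ι Q ℚ.* ι (D ℕ.* D)             ≡⟨ cong (θ ℚ.* θ ℚ.* ι Q ℚ.*_) (ι-* D D) ⟩
      θ ℚ.* θ ℚ.* ι Q ℚ.* (ι D ℚ.* ι D)           ≡⟨ solve 3 (λ θ d q → θ :* θ :* q :* (d :* d) := (θ :* d) :* (θ :* d) :* q) refl θ (ι D) (ι Q) ⟩
      (θ ℚ.* ι D) ℚ.* (θ ℚ.* ι D) ℚ.* ι Q         ≡⟨ cong (λ z → z ℚ.* z ℚ.* ι Q) θD ⟩
      (δ / 1) ℚ.* (δ / 1) ℚ.* ι Q                 ≡⟨ cong (ℚ._* ι Q) δ² ⟩
      ι (ℤ.∣ δ ∣ ℕ.* ℤ.∣ δ ∣) ℚ.* ι Q             ≡⟨ ι-* (ℤ.∣ δ ∣ ℕ.* ℤ.∣ δ ∣) Q ⟨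
      ι (ℤ.∣ δ ∣ ℕ.* ℤ.∣ δ ∣ ℕ.* Q)               ≤⟨ ι-≤ δ-small ⟩
      ι (K ℕ.* (D ℕ.* D))                         ≡⟨ ι-* K (D ℕ.* D) ⟩
      ι K ℚ.* ι (D ℕ.* D)                         ∎)
      where open ℚ.≤-Reasoning

  -- A positive rational is at least the reciprocal of its denominator `f`, so `|δ| f < T M` is
  -- enough. After squaring, this follows from `|δ|² Q ≤ K (T W)²`, `W ≤ M` and `K f² < Q`.
  absolute-error : W ≤ M → ∀ ε → 0ℚ ℚ.< ε → K ℕ.* (ℚ.↧ₙ ε ℕ.* ℚ.↧ₙ ε) < Q → ℚ.∣ p ℚ.- P ∣ ℚ.< ε
  absolute-error W≤M ε 0<ε large = ℚ.*-cancelʳ-<-nonNeg (ι (D ℕ.* f)) {{ι-nonNegative (D ℕ.* f)}} (begin-strict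
    ℚ.∣ p ℚ.- P ∣ ℚ.* ι (D ℕ.* f)            ≡⟨ cong (ℚ.∣ p ℚ.- P ∣ ℚ.*_) (ι-* D f) ⟩
    ℚ.∣ p ℚ.- P ∣ ℚ.* (ι D ℚ.* ι f)          ≡⟨ ℚ.*-assoc ℚ.∣ p ℚ.- P ∣ (ι D) (ι f) ⟨
    ℚ.∣ p ℚ.- P ∣ ℚ.* ι D ℚ.* ι f            ≡⟨ cong (ℚ._* ι f) scaled ⟩
    ι ℤ.∣ δ ∣ ℚ.* ι f                        ≡⟨ ι-* ℤ.∣ δ ∣ f ⟨
    ι (ℤ.∣ δ ∣ ℕ.* f)                        <⟨ ι-< {ℤ.∣ δ ∣ ℕ.* f} {D} (square-cancel-< {ℤ.∣ δ ∣ ℕ.* f} {D} less) ⟩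
    ι D                                      ≤⟨ ι-≤ (ℕ.m≤m*n D ℤ.∣ ℚ.↥ ε ∣ {{ℕ.>-nonZero 0<↥ε}}) ⟩
    ι (D ℕ.* ℤ.∣ ℚ.↥ ε ∣)                    ≡⟨ ι-* D ℤ.∣ ℚ.↥ ε ∣ ⟩
    ι D ℚ.* ι ℤ.∣ ℚ.↥ ε ∣                    ≡⟨ cong (ι D ℚ.*_) numerator ⟨
    ι D ℚ.* (ε ℚ.* ι f)                      ≡⟨ solve 3 (λ d ε f → d :* (ε :* f) := ε :* (d :* f)) refl (ι D) ε (ι f) ⟩
    ε ℚ.* (ι D ℚ.* ι f)                      ≡⟨ cong (ε ℚ.*_) (ι-* D f) ⟨
    ε ℚ.* ι (D ℕ.* f)                        ∎)
    where
    open ℚ.≤-Reasoning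
    open ℚSolver
    f D : ℕ
    f = ℚ.↧ₙ ε
    D = T ℕ.* M
    0<D : 0 < D
    0<D = ℕ.*-mono-≤ 0<T 0<M
    ε>0 : Positive ε
    ε>0 = ℚ.positive 0<ε
    ↥-positive : ∀ ε → Positive ε → 0 < ℤ.∣ ℚ.↥ ε ∣ × ℤ.+ ℤ.∣ ℚ.↥ ε ∣ ≡ ℚ.↥ ε
    ↥-positive (ℚ.mkℚ (ℤ.+ suc n) _ _) _ = s≤s z≤n , refl
    0<↥ε : 0 < ℤ.∣ ℚ.↥ ε ∣
    0<↥ε = proj₁ (↥-positive ε ε>0)
    numerator : ε ℚ.* ι f ≡ ι ℤ.∣ ℚ.↥ ε ∣
    numerator = trans (cong (ℚ._* ι f) (sym (ℚ.↥p/↧p≡p ε)))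
      (trans (/-*-cancel (ℚ.↥ ε) f) (cong (_/ 1) (sym (proj₂ (↥-positive ε ε>0)))))
    ∣/1∣ : ∀ i → ℚ.∣ i / 1 ∣ ≡ ι ℤ.∣ i ∣
    ∣/1∣ (ℤ.+ n)  = ℚ.0≤p⇒∣p∣≡p (ι-≤ (z≤n {n}))
    ∣/1∣ -[1+ n ] = trans (ℚ.∣-p∣≡∣p∣ (ι (suc n))) (ℚ.0≤p⇒∣p∣≡p (ι-≤ (z≤n {suc n})))
    scaled : ℚ.∣ p ℚ.- P ∣ ℚ.* ι D ≡ ι ℤ.∣ δ ∣
    scaled = begin-equality
      ℚ.∣ p ℚ.- P ∣ ℚ.* ι D                  ≡⟨ cong (ℚ.∣ p ℚ.- P ∣ ℚ.*_) (ℚ.0≤p⇒∣p∣≡p (ι-≤ (z≤n {D}))) ⟨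
      ℚ.∣ p ℚ.- P ∣ ℚ.* ℚ.∣ ι D ∣            ≡⟨ ℚ.∣p*q∣≡∣p∣*∣q∣ (p ℚ.- P) (ι D) ⟨
      ℚ.∣ (p ℚ.- P) ℚ.* ι D ∣                ≡⟨ cong (λ z → ℚ.∣ (p ℚ.- P) ℚ.* z ∣) (ι-* T M) ⟩
      ℚ.∣ (p ℚ.- P) ℚ.* (ι T ℚ.* ι M) ∣      ≡⟨ cong ℚ.∣_∣ (solve 4 (λ p P t m → (p :+ :- P) :* (t :* m) := p :* t :* m :+ :- (t :* (P :* m))) refl p P (ι T) (ι M)) ⟩
      ℚ.∣ p ℚ.* ι T ℚ.* ι M ℚ.- ι T ℚ.* (P ℚ.* ι M) ∣ ≡⟨ cong₂ (λ x y → ℚ.∣ x ℚ.* ι M ℚ.- ι T ℚ.* y ∣) p≡ P≡ ⟩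
      ℚ.∣ ι c ℚ.* ι M ℚ.- ι T ℚ.* ι W ∣      ≡⟨ cong ℚ.∣_∣ δ≡ ⟨
      ℚ.∣ δ / 1 ∣                            ≡⟨ ∣/1∣ δ ⟩
      ι ℤ.∣ δ ∣                              ∎
    less : ℤ.∣ δ ∣ ℕ.* f ℕ.* (ℤ.∣ δ ∣ ℕ.* f) < D ℕ.* D
    less = ℕ.*-cancelʳ-< Q _ _ (N.begin-strict
      ℤ.∣ δ ∣ ℕ.* f ℕ.* (ℤ.∣ δ ∣ ℕ.* f) ℕ.* Q      N.≡⟨ NS.solve 3 (λ n f q → n NS.:* f NS.:* (n NS.:* f) NS.:* q NS.:= (n NS.:* n NS.:* q) NS.:* (f NS.:* f)) refl ℤ.∣ δ ∣ f Q ⟩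
      (ℤ.∣ δ ∣ ℕ.* ℤ.∣ δ ∣ ℕ.* Q) ℕ.* (f ℕ.* f)    N.≤⟨ ℕ.*-monoˡ-≤ (f ℕ.* f) (ℕ.≤-trans δ-small
                                                       (ℕ.*-monoʳ-≤ K (ℕ.*-mono-≤ (ℕ.*-monoʳ-≤ T W≤M) (ℕ.*-monoʳ-≤ T W≤M)))) ⟩
      K ℕ.* (D ℕ.* D) ℕ.* (f ℕ.* f)                N.≡⟨ NS.solve 3 (λ k d f → k NS.:* d NS.:* f NS.:= k NS.:* f NS.:* d) refl K (D ℕ.* D) (f ℕ.* f) ⟩
      K ℕ.* (f ℕ.* f) ℕ.* (D ℕ.* D)                N.<⟨ ℕ.*-monoˡ-< (D ℕ.* D) {{ℕ.>-nonZero (ℕ.*-mono-≤ 0<D 0<D)}} large ⟩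
      Q ℕ.* (D ℕ.* D)                              N.≡⟨ ℕ.*-comm Q (D ℕ.* D) ⟩
      D ℕ.* D ℕ.* Q                                N.∎)
      where
      module N = ℕ.≤-Reasoning
      module NS = +-*-Solver

-- The final estimate and its constants

halve : ∀ n → ∃[ L ] (L ℕ.+ L ≤ n × n ≤ suc (L ℕ.+ L))
halve zero    = 0 , z≤n , z≤n
halve (suc n) with halve n
... | L , lo , hi with ℕ.m≤n⇒m<n∨m≡n hi
...   | inj₁ (s≤s n≤) = L , ℕ.m≤n⇒m≤1+n lo , s≤s n≤
...   | inj₂ refl     = suc L , ℕ.≤-reflexive (cong suc (ℕ.+-suc L L)) , ℕ.≤-trans (ℕ.n≤1+n _) (s≤s (s≤s (ℕ.≤-reflexive (sym (ℕ.+-suc L L)))))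

n<m^n : ∀ {m} → 1 < m → ∀ n → n < m ℕ.^ n
n<m^n 1<m zero    = s≤s z≤n
n<m^n {m} 1<m (suc n) = ℕ.≤-<-trans (n<m^n 1<m n) (ℕ.^-monoʳ-< m 1<m (ℕ.n<1+n n))

odd-field-size : ∀ {q} → FiniteField q → 2 ∤ q → 3 ≤ q
odd-field-size {0} 𝔽 2∤0 = contradiction (divides 0 refl) 2∤0
odd-field-size {1} 𝔽 _   = contradiction (trans (sym (strictlyInverseˡ 0#)) (trans (cong to (only _ _)) (strictlyInverseˡ 1#))) 0≢1
  where
  open FiniteField 𝔽
  open Inverse enumeration
  only : ∀ (i j : Fin.Fin 1) → i ≡ j
  only Fin.zero Fin.zero = refl
odd-field-size {2} 𝔽 2∤2 = contradiction (divides 1 refl) 2∤2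
odd-field-size {suc (suc (suc q))} 𝔽 _ = s≤s (s≤s (s≤s z≤n))

module Estimate {q : ℕ} (𝔽 : FiniteField q) (2∤q : 2 ∤ q) where
  3≤q : 3 ≤ q
  3≤q = odd-field-size 𝔽 2∤q

  1<q : 1 < q
  1<q = ℕ.≤-trans (s≤s (s≤s z≤n)) 3≤q

  open Sieve 𝔽 3≤q using (1≤q^; q^-mono)
  open Signs 𝔽 2∤q using (nonzero?; count-nonzero)
  open FiniteField 𝔽 using (elements)

  size : ℕ → ℕ
  size d = length (𝓕 𝔽 d)

  hits : ℕ → ℤ → ℕ
  hits d s = length (filter (λ f → S 𝔽 f ℤ.≟ s) (𝓕 𝔽 d))

  massAt : ℤ → ℕ
  massAt s = ∑ (withTotal q s) (∏ (mass q))

  M : ℕ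
  M = norm q ℕ.^ q

  0<M : 0 < M
  0<M = ℕ.m^n>0 (norm q) q

  many : ∀ d → q ℕ.^ d ≤ 2 ℕ.* size d
  many d = Distribution.many-squareFree 𝔽 3≤q 2∤q d

  0<size : ∀ d → 0 < size d
  0<size d with size d | many d
  ... | zero  | p = contradiction (ℕ.≤-trans (1≤q^ d) p) λ ()
  ... | suc _ | _ = s≤s z≤n

  massAt≤M : ∀ s → massAt s ≤ M
  massAt≤M s = ℕ.≤-trans (∑-filter-≤ (λ ω → total ω ℤ.≟ s) (vectors outcomes q) (∏ (mass q))) (ℕ.≤-reflexive (total-mass q q))

  units : ℕ
  units = count nonzero? elements

  *-^-distrib : ∀ a b n → (a ℕ.* b) ℕ.^ n ≡ a ℕ.^ n ℕ.* b ℕ.^ n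
  *-^-distrib a b zero    = refl
  *-^-distrib a b (suc n) = trans (cong (a ℕ.* b ℕ.*_) (*-^-distrib a b n))
    (solve 4 (λ a b x y → a :* b :* (x :* y) := a :* x :* (b :* y)) refl a b (a ℕ.^ n) (b ℕ.^ n))
    where open +-*-Solver

  -- 2(q + 1)(q − 1) ≤ 2q · q
  norm-units : M ℕ.* units ℕ.^ q ≤ (2 ℕ.* q) ℕ.^ q ℕ.* q ℕ.^ q
  norm-units = ≡.subst₂ _≤_ (*-^-distrib (norm q) units q) (*-^-distrib (2 ℕ.* q) q q)
    (ℕ.^-monoˡ-≤ q (subst (λ r → 2 ℕ.* suc r ℕ.* units ≤ 2 ℕ.* r ℕ.* r) count-nonzero (begin
      2 ℕ.* suc (suc units) ℕ.* units              ≤⟨ ℕ.m≤m+n _ 2 ⟩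
      2 ℕ.* suc (suc units) ℕ.* units ℕ.+ 2        ≡⟨ solve 1 (λ u → con 2 :* (con 2 :+ u) :* u :+ con 2 := con 2 :* (con 1 :+ u) :* (con 1 :+ u)) refl units ⟩
      2 ℕ.* suc units ℕ.* suc units                ∎)))
    where
    open ℕ.≤-Reasoning
    open +-*-Solver

  2q^q>0 : 0 < (2 ℕ.* q) ℕ.^ q
  2q^q>0 = ℕ.m^n>0 (2 ℕ.* q) {{ℕ.>-nonZero (ℕ.≤-trans (ℕ.<⇒≤ 1<q) (ℕ.m≤n*m q 2))}} q

  -- The square of `16 q^(3q/2)`. The sieve contributes 4; numerator and denominator of the
  -- proportion are both approximated, which doubles it; and `q^d ≤ 2 |𝓕_d|` doubles it again.
  K : ℕ
  K = 16 ℕ.^ 2 ℕ.* q ℕ.^ (3 ℕ.* q)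

  module _ (d : ℕ) (s : ℤ) where
    open Distribution 𝔽 3≤q 2∤q d using (sum-mass; count-S; length-𝓕-sum; base)

    c T W L : ℕ
    c = hits d s
    T = size d
    W = massAt s
    -- The integer part of `(d + q)/2`: the sieve asks for `d + q ≤ 2L + 1`, the final exponent for
    -- `2L ≤ d + q`.
    L = proj₁ (halve (d ℕ.+ q))

    Z r slack e : ℕ
    Z = (2 ℕ.* q) ℕ.^ q
    r = units ℕ.^ q ℕ.* base
    slack = 4 ℕ.* q ℕ.^ L
    -- Twice the sieve error `4 q^L`, with `M · units^q / (2q)^q` replaced by its bound `q^q`. The
    -- factor `W` is kept, so that the error is relative to the probability.
    e = 8 ℕ.* (q ℕ.^ q ℕ.* q ℕ.^ L) ℕ.* W

    closeWith : ∀ ωs → Close (Z ℕ.* ∑ ωs _) (∑ ωs (∏ (mass q)) ℕ.* r) (∑ ωs (∏ (mass q)) ℕ.* (units ℕ.^ q ℕ.* slack))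
    closeWith ωs = sum-mass L (proj₂ (proj₂ (halve (d ℕ.+ q)))) ωs

    close-hits : Close (Z ℕ.* c) (W ℕ.* r) (W ℕ.* (units ℕ.^ q ℕ.* slack))
    close-hits = subst (λ x → Close (Z ℕ.* x) (W ℕ.* r) (W ℕ.* (units ℕ.^ q ℕ.* slack))) (sym (count-S s)) (closeWith (withTotal q s))

    close-size : Close (Z ℕ.* T) (M ℕ.* r) (M ℕ.* (units ℕ.^ q ℕ.* slack))
    close-size = ≡.subst₂ (λ x y → Close (Z ℕ.* x) (y ℕ.* r) (y ℕ.* (units ℕ.^ q ℕ.* slack))) (sym length-𝓕-sum) (total-mass q q)
      (closeWith (vectors outcomes q))

    -- `Z c` is close to `W r` and `Z T` to `M r` with the same unknown `r`. Multiplication by `M`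
    -- and by `W` brings both to `M W r`, so the main term drops out, and `Z` is cancelled at the
    -- end.
    close : Close (c ℕ.* M) (T ℕ.* W) e
    close = descend (proj₁ bounds) , descend (proj₂ bounds)
      where
      open +-*-Solver
      x y z : ℕ
      x = Z ℕ.* (c ℕ.* M)
      y = Z ℕ.* (T ℕ.* W)
      z = M ℕ.* (W ℕ.* r)
      err : ℕ
      err = M ℕ.* (W ℕ.* (units ℕ.^ q ℕ.* slack))
      x≈z : Close x z err
      x≈z = subst (λ x → Close x z err) (solve 3 (λ m a c → m :* (a :* c) := a :* (c :* m)) refl M Z c) (close-* M close-hits)
      y≈z : Close y z err
      y≈z = subst (λ y → Close y z err) (solve 3 (λ w a t → w :* (a :* t) := a :* (t :* w)) refl W Z T)
        (≡.subst₂ (Close (W ℕ.* (Z ℕ.* T))) (swap r) (swap (units ℕ.^ q ℕ.* slack)) (close-* W close-size))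
        where
        swap : ∀ r → W ℕ.* (M ℕ.* r) ≡ M ℕ.* (W ℕ.* r)
        swap = solve 3 (λ w m r → w :* (m :* r) := m :* (w :* r)) refl W M
      err≤ : err ℕ.+ err ≤ Z ℕ.* e
      err≤ = ℕ.≤-trans (ℕ.≤-reflexive (solve 4 (λ m w u x → m :* (w :* (u :* (con 4 :* x))) :+ m :* (w :* (u :* (con 4 :* x)))
                 := m :* u :* (con 8 :* x :* w)) refl M W (units ℕ.^ q) (q ℕ.^ L)))
        (ℕ.≤-trans (ℕ.*-monoˡ-≤ (8 ℕ.* q ℕ.^ L ℕ.* W) norm-units)
          (ℕ.≤-reflexive (solve 4 (λ a g x w → a :* g :* (con 8 :* x :* w) := a :* (con 8 :* (g :* x) :* w)) refl Z (q ℕ.^ q) (q ℕ.^ L) W)))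
      bounds : Close x y (Z ℕ.* e)
      bounds = close-weaken err≤ (half x y x≈z y≈z , half y x y≈z x≈z)
        where
        half : ∀ x y → Close x z err → Close y z err → x ≤ y ℕ.+ (err ℕ.+ err)
        half x y (x≤ , _) (_ , z≤) = ℕ.≤-trans x≤ (ℕ.≤-trans (ℕ.+-monoˡ-≤ err z≤) (ℕ.≤-reflexive (ℕ.+-assoc y err err)))
      descend : ∀ {u v} → Z ℕ.* u ≤ Z ℕ.* v ℕ.+ Z ℕ.* e → u ≤ v ℕ.+ e
      descend {u} {v} p = ℕ.*-cancelˡ-≤ Z {{ℕ.>-nonZero 2q^q>0}} (ℕ.≤-trans p (ℕ.≤-reflexive (sym (ℕ.*-distribˡ-+ Z v e))))

    small : e ℕ.* e ℕ.* q ℕ.^ d ≤ K ℕ.* ((T ℕ.* W) ℕ.* (T ℕ.* W))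
    -- A second factor `q^d` is supplied, so that each factor `e` meets one `q^d` and the bound
    -- `q^d ≤ 2 T` applies twice.
    small = *-cancelʳ-≤′ (q ℕ.^ d) (1≤q^ d) (begin
      e ℕ.* e ℕ.* Q ℕ.* Q                              ≡⟨ solve 2 (λ e q → e :* e :* q :* q := (e :* q) :* (e :* q)) refl e Q ⟩
      (e ℕ.* Q) ℕ.* (e ℕ.* Q)                          ≤⟨ ℕ.*-mono-≤ eQ eQ ⟩
      16 ℕ.* (X ℕ.* (T ℕ.* W)) ℕ.* (16 ℕ.* (X ℕ.* (T ℕ.* W))) ≡⟨ solve 3 (λ a x d → a :* (x :* d) :* (a :* (x :* d)) := a :* (a :* con 1) :* (x :* x) :* (d :* d)) refl 16 X (T ℕ.* W) ⟩
      16 ℕ.^ 2 ℕ.* (X ℕ.* X) ℕ.* DD                    ≤⟨ ℕ.*-monoˡ-≤ DD (ℕ.*-monoʳ-≤ (16 ℕ.^ 2) XX) ⟩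
      16 ℕ.^ 2 ℕ.* (q ℕ.^ (3 ℕ.* q) ℕ.* Q) ℕ.* DD      ≡⟨ solve 4 (λ a x q d → a :* (x :* q) :* d := a :* x :* d :* q) refl (16 ℕ.^ 2) (q ℕ.^ (3 ℕ.* q)) Q DD ⟩
      K ℕ.* DD ℕ.* Q                                   ∎)
      where
      open ℕ.≤-Reasoning
      open +-*-Solver
      Q X DD : ℕ
      Q = q ℕ.^ d
      X = q ℕ.^ q ℕ.* q ℕ.^ L
      DD = (T ℕ.* W) ℕ.* (T ℕ.* W)
      eQ : e ℕ.* Q ≤ 16 ℕ.* (X ℕ.* (T ℕ.* W))
      eQ = ℕ.≤-trans (ℕ.*-monoʳ-≤ e (many d)) (ℕ.≤-reflexive
        (solve 3 (λ x w t → con 8 :* x :* w :* (con 2 :* t) := con 16 :* (x :* (t :* w))) refl X W T))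
      XX : X ℕ.* X ≤ q ℕ.^ (3 ℕ.* q) ℕ.* Q
      XX = begin
        X ℕ.* X                                      ≡⟨ cong₂ ℕ._*_ (ℕ.^-distribˡ-+-* q q L) (ℕ.^-distribˡ-+-* q q L) ⟨
        q ℕ.^ (q ℕ.+ L) ℕ.* q ℕ.^ (q ℕ.+ L)          ≡⟨ ℕ.^-distribˡ-+-* q (q ℕ.+ L) (q ℕ.+ L) ⟨
        q ℕ.^ (q ℕ.+ L ℕ.+ (q ℕ.+ L))                ≤⟨ q^-mono exponent ⟩
        q ℕ.^ (3 ℕ.* q ℕ.+ d)                        ≡⟨ ℕ.^-distribˡ-+-* q (3 ℕ.* q) d ⟩
        q ℕ.^ (3 ℕ.* q) ℕ.* Q                        ∎
        where
        exponent : q ℕ.+ L ℕ.+ (q ℕ.+ L) ≤ 3 ℕ.* q ℕ.+ d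
        exponent = begin
          q ℕ.+ L ℕ.+ (q ℕ.+ L)    ≡⟨ solve 2 (λ q l → q :+ l :+ (q :+ l) := q :+ q :+ (l :+ l)) refl q L ⟩
          q ℕ.+ q ℕ.+ (L ℕ.+ L)    ≤⟨ ℕ.+-monoʳ-≤ (q ℕ.+ q) (proj₁ (proj₂ (halve (d ℕ.+ q)))) ⟩
          q ℕ.+ q ℕ.+ (d ℕ.+ q)    ≡⟨ solve 2 (λ q d → q :+ q :+ (d :+ q) := con 3 :* q :+ d) refl q d ⟩
          3 ℕ.* q ℕ.+ d            ∎

    module Bounds .{{_ : NonZero (length (𝓕 𝔽 d))}} = Ratio {proportion 𝔽 d s} {Prob[ΣX≡ s ] q} {c} {T} {W} {M} {e} {q ℕ.^ d} {K}
      (/-*-cancel (ℤ.+ c) T) (sum-weight-mass q (withTotal q s))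
      (0<size d) 0<M (1≤q^ d) close small

open import Data.Integer.Base using (∣_∣)

theorem1 : ∃[ C ] ((q : ℕ) → OddPrimePower q → (𝔽 : FiniteField q) →
    Σ[ nonempty ∈ ((d : ℕ) → 3 ≤ d → NonZero (length (𝓕 𝔽 d))) ]
    ( ((s : ℤ) (ε : ℚ) → 0ℚ ℚ.< ε →
    ∃[ D ] ((d : ℕ) (3≤d : 3 ≤ d) → D ≤ d →
    ℚ.∣ proportion 𝔽 d {{nonempty d 3≤d}} s ℚ.- Prob[ΣX≡ s ] q ∣ ℚ.< ε))
    × ((d : ℕ) (3≤d : 3 ≤ d) (s : ℤ) → ∣ s ∣ ≤ q →
    ∃[ θ ] (proportion 𝔽 d {{nonempty d 3≤d}} s ≡ Prob[ΣX≡ s ] q ℚ.* (1ℚ ℚ.+ θ)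
    × ErrorBound C q d θ)) ))
theorem1 = 16 , λ q (_ , 2∤q) 𝔽 → let open Estimate 𝔽 2∤q in
  (λ d _ → ℕ.>-nonZero (0<size d)) ,
  -- This threshold suffices because `d < q^d`: with `f` the denominator of `ε`, it gives
  -- `K f² ≤ d < q^d`.
  (λ s ε 0<ε → K ℕ.* (ℚ.↧ₙ ε ℕ.* ℚ.↧ₙ ε) , λ d _ D≤d →
    Bounds.absolute-error d s {{ℕ.>-nonZero (0<size d)}} (massAt≤M s) ε 0<ε
      (ℕ.≤-<-trans D≤d (n<m^n 1<q d))) ,
  (λ d _ s _ → Bounds.relative-error d s {{ℕ.>-nonZero (0<size d)}})
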